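{- Let $n, k, r$ be positive integers with $n \geq k \geq 3$ and $t \geq r \geq 3$, where $t=\lfloor (n-1)/2\rfloor$. Let $H$ be an $n$-vertex $r$-uniform hypergraph. If (a) $k \leq r+1$ and $\delta(H) \geq k-1$, or (b) $r+2\leq k<t+2$ and $\delta(H) \geq \binom{k-2}{r-1}+1$, or (c) $k\geq t+2$ and $\delta(H) \geq \binom{t}{r-1} + 1$, then $H$ contains a Berge cycle of length $k$ or longer.
   Context: A hypergraph is a family of (distinct) subsets, called edges, of a vertex set; it is $r$-uniform if every edge has exactly $r$ vertices. $\delta(H)$ denotes the minimum number of edges containing a vertex. A Berge cycle of length $\ell$ is a list $v_1, e_1, v_2, \ldots, v_\ell, e_\ell, v_1$ of $\ell$ distinct vertices and $\ell$ distinct edges with $\{v_i, v_{i+1}\} \subseteq e_i$ for all $i$ (indices modulo $\ell$). -}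

module Defs where

open import Data.Nat using (ℕ; zero; suc; _+_; _≤_; _<_; _∸_)
open import Data.Fin using (Fin; zero; suc; toℕ; fromℕ<)
open import Data.Fin.Subset using (Subset; _∈_; ∣_∣)
open import Data.Fin.Subset.Properties using (_∈?_)
open import Data.List using (List; length; filter; lookup)
open import Data.List.Relation.Unary.Unique.Propositional using (Unique)
open import Data.List.Relation.Unary.All using (All)
open import Data.Product using (Σ; _×_; ∃)
open import Function.Definitions using (Injective)
open import Relation.Binary.PropositionalEquality using (_≡_)
open import Relation.Nullary using (yes; no)
open import Data.Nat using (_<?_)

record UniformHypergraph (n r : ℕ) : Set where
  field
    edges    : List (Subset n)
    distinct : Unique edges
    uniform  : All (λ e → ∣ e ∣ ≡ r) edges

open UniformHypergraph public

degree : ∀ {n r} → UniformHypergraph n r → Fin n → ℕ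
degree H v = length (filter (λ e → v ∈? e) (edges H))

minDegree≥ : ∀ {n r} → UniformHypergraph n r → ℕ → Set
minDegree≥ H d = ∀ v → d ≤ degree H v

csuc : ∀ {ℓ} → Fin ℓ → Fin ℓ
csuc {suc ℓ} i with suc (toℕ i) <? suc ℓ
... | yes p = fromℕ< p
... | no _ = zero

EdgeIndex : ∀ {n r} → UniformHypergraph n r → Set
EdgeIndex H = Fin (length (edges H))

edge : ∀ {n r} (H : UniformHypergraph n r) → EdgeIndex H → Subset n
edge H i = lookup (edges H) i

record BergeCycle {n r} (H : UniformHypergraph n r) (ℓ : ℕ) : Set where
  field
    vtx       : Fin ℓ → Fin n
    edg       : Fin ℓ → EdgeIndex H
    vtx-inj   : Injective _≡_ _≡_ vtx
    edg-inj   : Injective _≡_ _≡_ edg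
    here∈     : ∀ i → vtx i ∈ edge H (edg i)
    next∈     : ∀ i → vtx (csuc i) ∈ edge H (edg i)

HasBergeCycle≥ : ∀ {n r} → UniformHypergraph n r → ℕ → Set
HasBergeCycle≥ H k = Σ ℕ λ ℓ → k ≤ ℓ × BergeCycle H ℓ

{-# OPTIONS --safe #-}

-- In a longest Berge path P = v_0 e_0 v_1 … e_{p-1} v_p, an edge which is unused or equal to e_i and which contains
-- v_0 and v_{i+1} gives another longest path v_i … v_0 v_{i+1} … v_p, to whose start v_i the degree condition
-- applies as well.  If there is no cycle of length at least k, all edges at these starts are confined to the first
-- k - 1 vertices; (a) and (b) follow since the confined edges are too few or coincide.
--
-- For (c), t vertices are reached by (b), so that a cycle on the vertices of P would be left by some edge and yield a
-- longer path; hence P has no such cycle unless it is Hamiltonian.  Let A be the set of i such that an unused edge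
-- contains v_0 and v_{i+1}, let A′ be the set of i such that one contains v_p and v_i, and choose P with |A| + |A′|
-- maximal.  Then A and A′ are disjoint, v_0 is on at most C(|A|, r - 1) unused edges, and v_0 is on no link e_i with
-- i in A′.  If |A′| ≥ p - t the start has no room for its degree.  Otherwise p ≤ 2 t + 1 leaves three cases, according
-- to which of |A|, |A′| reach t: if both do, p = 2 t + 1 and A, A′ turn out to be intervals separated by one link,
-- which then contains too many vertices; if not, the ends must lie on many links, and counting the incidences between
-- links and possible ends gives a contradiction.  The counts are tight when r = t, where the unused edges, of which
-- there are at least four by double counting, are used in addition.

module Submission where

open import Defs
open import Data.Bool using (true; false)
open import Data.Empty using (⊥; ⊥-elim)
open import Data.Fin using (Fin; zero; suc; toℕ; fromℕ<; finToFun; funToFin) renaming (_≟_ to _≟ᶠ_)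
open import Data.Fin.Properties using (any?; pigeonhole; toℕ<n; toℕ-injective; toℕ-fromℕ<; fromℕ<-toℕ; fromℕ<-injective; finToFun-funToFin) renaming (all? to allᶠ?)
open import Data.Fin.Subset using (Subset; ∣_∣) renaming (_∈_ to _∈ₛ_)
open import Data.Fin.Subset.Properties using (_∈?_; ⊆-antisym; p⊂q⇒∣p∣<∣q∣; drop-there)
open import Data.List using (List; []; _∷_; _++_; map; length; filter; lookup; tabulate; upTo; allFin)
open import Data.List.Membership.Propositional using (_∈_)
open import Data.List.Membership.Propositional.Properties
open import Data.List.Properties using (length-++; length-map; length-filter; length-upTo; length-tabulate; filter-accept; filter-reject; tabulate-lookup; map-tabulate)
open import Data.List.Relation.Unary.All as All using (All; []; _∷_)
import Data.List.Relation.Unary.All.Properties as AllP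
open import Data.List.Relation.Unary.AllPairs using ([]; _∷_)
open import Data.List.Relation.Unary.Any using (here; there)
open import Data.List.Relation.Unary.Unique.Propositional using (Unique)
open import Data.List.Relation.Unary.Unique.Propositional.Properties using (upTo⁺; allFin⁺; filter⁺)
open import Data.Nat
open import Data.Nat.Combinatorics using (_C_; nC1≡n; nCn≡1; nCk+nC[k+1]≡[n+1]C[k+1])
open import Data.Nat.Combinatorics.Specification using (k>n⇒nCk≡0)
open import Data.Nat.DivMod using (m≡m%n+[m/n]*n; m%n<n)
open import Data.Nat.ListAction using (sum)
open import Data.Nat.Properties hiding (_≟_)
open import Data.Nat.Tactic.RingSolver using (solve-∀)
open import Data.Product using (∃; _×_; _,_; proj₁; proj₂)
open import Data.Sum using (_⊎_; inj₁; inj₂)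
open import Data.Vec using ([]; _∷_; here; there)
open import Function using (_∘_; id)
open import Relation.Binary.Definitions using (tri<; tri≈; tri>)
open import Relation.Binary.PropositionalEquality
open import Relation.Nullary using (Dec; yes; no; ¬_; ¬?; _×-dec_; _⊎-dec_; _→-dec_)
open import Relation.Nullary.Decidable using (decidable-stable)

-- In the code r = ρ + 2, t = τ + 1 and p = q + 1. The obstacle is the links, whose further vertices
-- may lie anywhere, and three devices control them. A rotation keeps v_p and merely permutes the
-- positions of its neighbours, so |A′| never drops; if |A| + |A′| is maximal, no rotation raises
-- |A|, and this is why the sum is chosen. Finally, a vertex x missed by a cycle through the rest of
-- P cannot be on two further edges: neighbours of x through different edges are never consecutive
-- on the cycle, the degree then puts them on every second place, and exchanging x with the vertices
-- in between overfills one link. This excludes an index of A directly after one of A′, which is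
-- what turns the two sets into intervals. The incidence count over the links needs ρ (2 τ + 3) < c
-- (c + 1) for c = C(τ, ρ); for r = t the number c is only τ and this fails.

module LinearArithmetic where

  -- Linear arithmetic over the natural numbers by checked certificates

  open import Data.Bool using (Bool; T; _∧_)
  open import Data.Integer as ℤ using (ℤ; +_; -[1+_])
  open import Data.List using (concatMap; foldr)
  open import Data.Unit using (⊤; tt)
  open import Data.Vec as Vec using (Vec; zipWith; replicate)

  infixl 7 _⊕_
  infixr 8 _⊛_ _⊠_
  infixl 7 _⊞_
  infix 5 _≼_ _≺_ _≈_
  infixr 4 _⇒_

  data Expr (n : ℕ) : Set where
    var : Fin n → Expr n
    con : ℕ → Expr n
    σ   : Expr n → Expr n
    _⊕_ : Expr n → Expr n → Expr n
    _⊛_ : ℕ → Expr n → Expr n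

  ⟦_⟧ : ∀ {n} → Expr n → Vec ℕ n → ℕ
  ⟦ var x ⟧ ρ = Vec.lookup ρ x
  ⟦ con k ⟧ ρ = k
  ⟦ σ a ⟧ ρ = suc (⟦ a ⟧ ρ)
  ⟦ a ⊕ b ⟧ ρ = ⟦ a ⟧ ρ + ⟦ b ⟧ ρ
  ⟦ k ⊛ a ⟧ ρ = k * ⟦ a ⟧ ρ

  data Seq (n : ℕ) : Set where
    _≼_ _≺_ _≈_ : Expr n → Expr n → Seq n
    absurd : Seq n
    _⇒_ : Seq n → Seq n → Seq n

  Sem : ∀ {n} → Seq n → Vec ℕ n → Set
  Sem (a ≼ b) ρ = ⟦ a ⟧ ρ ≤ ⟦ b ⟧ ρ
  Sem (a ≺ b) ρ = ⟦ a ⟧ ρ < ⟦ b ⟧ ρ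
  Sem (a ≈ b) ρ = ⟦ a ⟧ ρ ≡ ⟦ b ⟧ ρ
  Sem absurd  ρ = ⊥
  Sem (h ⇒ g) ρ = Sem h ρ → Sem g ρ

  Form : ℕ → Set
  Form n = Vec ℕ n × ℕ

  ⟨_⟩ : ∀ {n} → Form n → Vec ℕ n → ℕ
  ⟨ [] , k ⟩ [] = k
  ⟨ c ∷ cs , k ⟩ (x ∷ ρ) = c * x + ⟨ cs , k ⟩ ρ

  _⊞_ : ∀ {n} → Form n → Form n → Form n
  (c , k) ⊞ (c′ , k′) = zipWith _+_ c c′ , k + k′

  _⊠_ : ∀ {n} → ℕ → Form n → Form n
  m ⊠ (c , k) = Vec.map (m *_) c , m * k

  ⊞-sound : ∀ {n} (f g : Form n) ρ → ⟨ f ⊞ g ⟩ ρ ≡ ⟨ f ⟩ ρ + ⟨ g ⟩ ρ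
  ⊞-sound ([] , k) ([] , k′) [] = refl
  ⊞-sound (c ∷ cs , k) (d ∷ ds , l) (x ∷ ρ)
    rewrite ⊞-sound (cs , k) (ds , l) ρ = lem c d x (⟨ cs , k ⟩ ρ) (⟨ ds , l ⟩ ρ)
    where lem : ∀ c d x a b → (c + d) * x + (a + b) ≡ c * x + a + (d * x + b)
          lem = solve-∀

  ⊠-sound : ∀ {n} m (f : Form n) ρ → ⟨ m ⊠ f ⟩ ρ ≡ m * ⟨ f ⟩ ρ
  ⊠-sound m ([] , k) [] = refl
  ⊠-sound m (c ∷ cs , k) (x ∷ ρ) rewrite ⊠-sound m (cs , k) ρ = lem m c x (⟨ cs , k ⟩ ρ)
    where lem : ∀ m c x a → m * c * x + m * a ≡ m * (c * x + a)
          lem = solve-∀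

  const : ∀ {n} → ℕ → Form n
  const k = replicate _ 0 , k

  const-sound : ∀ {n} k (ρ : Vec ℕ n) → ⟨ const k ⟩ ρ ≡ k
  const-sound k [] = refl
  const-sound k (x ∷ ρ) = const-sound k ρ

  unit : ∀ {n} → Fin n → Form n
  unit zero = (1 ∷ replicate _ 0) , 0
  unit (suc i) = (0 ∷ proj₁ (unit i)) , 0

  unit-snd : ∀ {n} (i : Fin n) → proj₂ (unit i) ≡ 0
  unit-snd zero = refl
  unit-snd (suc i) = refl

  unit-sound : ∀ {n} (i : Fin n) ρ → ⟨ unit i ⟩ ρ ≡ Vec.lookup ρ i
  unit-sound zero (x ∷ ρ) = trans (cong₂ _+_ (+-identityʳ x) (const-sound 0 ρ)) (+-identityʳ x)
  unit-sound (suc i) (x ∷ ρ) =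
    trans (cong (λ k → ⟨ proj₁ (unit i) , k ⟩ ρ) (sym (unit-snd i))) (unit-sound i ρ)

  lin : ∀ {n} → Expr n → Form n
  lin (var x) = unit x
  lin (con k) = const k
  lin (σ a) = const 1 ⊞ lin a
  lin (a ⊕ b) = lin a ⊞ lin b
  lin (k ⊛ a) = k ⊠ lin a

  lin-sound : ∀ {n} (a : Expr n) ρ → ⟨ lin a ⟩ ρ ≡ ⟦ a ⟧ ρ
  lin-sound (var x) ρ = unit-sound x ρ
  lin-sound (con k) ρ = const-sound k ρ
  lin-sound (σ a) ρ = trans (⊞-sound (const 1) (lin a) ρ) (cong₂ _+_ (const-sound 1 ρ) (lin-sound a ρ))
  lin-sound (a ⊕ b) ρ = trans (⊞-sound (lin a) (lin b) ρ) (cong₂ _+_ (lin-sound a ρ) (lin-sound b ρ))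
  lin-sound (k ⊛ a) ρ = trans (⊠-sound k (lin a) ρ) (cong (k *_) (lin-sound a ρ))

  Ineq : ℕ → Set
  Ineq n = Form n × Form n

  Holds : ∀ {n} → Vec ℕ n → List (Ineq n) → Set
  Holds ρ [] = ⊤
  Holds ρ ((l , r) ∷ cs) = ⟨ l ⟩ ρ ≤ ⟨ r ⟩ ρ × Holds ρ cs

  add : ∀ {n} → ℕ → Ineq n → Ineq n → Ineq n
  add m (l , r) (l′ , r′) = (m ⊠ l ⊞ l′) , (m ⊠ r ⊞ r′)

  combine : ∀ {n} → List ℕ → List (Ineq n) → Ineq n
  combine (m ∷ ms) ((l , r) ∷ cs) = add m (l , r) (combine ms cs)
  combine _ _ = const 0 , const 0

  combine-sound : ∀ {n} ρ (ms : List ℕ) (cs : List (Ineq n)) → Holds ρ cs →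
                  ⟨ proj₁ (combine ms cs) ⟩ ρ ≤ ⟨ proj₂ (combine ms cs) ⟩ ρ
  combine-sound ρ [] _ _ = ≤-refl
  combine-sound ρ (_ ∷ _) [] _ = ≤-refl
  combine-sound ρ (m ∷ ms) ((l , r) ∷ cs) (h , hs)
    rewrite ⊞-sound (m ⊠ l) (proj₁ (combine ms cs)) ρ | ⊞-sound (m ⊠ r) (proj₂ (combine ms cs)) ρ
          | ⊠-sound m l ρ | ⊠-sound m r ρ = +-mono-≤ (*-monoʳ-≤ m h) (combine-sound ρ ms cs hs)

  -- Variables are natural numbers, so larger coefficients on the left only help: l ≤ r is absurd
  -- once l has coefficients at least those of r and a larger constant.
  dominates : ∀ {n} → Form n → Form n → Bool
  dominates ([] , k) ([] , l) = l <ᵇ k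
  dominates (c ∷ cs , k) (d ∷ ds , l) = (d ≤ᵇ c) ∧ dominates (cs , k) (ds , l)

  dominates-sound : ∀ {n} (f g : Form n) ρ → dominates f g ≡ true → ⟨ g ⟩ ρ < ⟨ f ⟩ ρ
  dominates-sound ([] , k) ([] , l) [] eq = <ᵇ⇒< l k (subst T (sym eq) tt)
  dominates-sound (c ∷ cs , k) (d ∷ ds , l) (x ∷ ρ) eq with d ≤ᵇ c in q
  ... | true = +-mono-≤-< (*-monoˡ-≤ x (≤ᵇ⇒≤ d c (subst T (sym q) tt))) (dominates-sound (cs , k) (ds , l) ρ eq)

  -- Fourier–Motzkin elimination, used only as an oracle for the multipliers
  -- of a Farkas certificate; `dominates` checks the certificate.
  private
    -- A row (c , k , m) stands for c · x + k ≥ 0, and m lists the multipliers of the hypotheses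
    -- that produce it. The rows for x ≥ 0 carry zero multipliers, since `dominates` absorbs them.
    Row : Set
    Row = List ℤ × ℤ × List ℕ

    comb : ℕ → ℕ → Row → Row → Row
    comb a b (c , k , m) (d , l , q) = zw c d , (+ a ℤ.* k ℤ.+ + b ℤ.* l) , zn m q
      where
      zw : List ℤ → List ℤ → List ℤ
      zw (x ∷ xs) (y ∷ ys) = (+ a ℤ.* x ℤ.+ + b ℤ.* y) ∷ zw xs ys
      zw _ _ = []
      zn : List ℕ → List ℕ → List ℕ
      zn (x ∷ xs) (y ∷ ys) = (a * x + b * y) ∷ zn xs ys
      zn _ _ = []

    Split : Set
    Split = List (ℕ × Row) × List (ℕ × Row) × List Row

    sort : Row → Split → Split
    sort ([] , k , m) (p , q , z) = p , q , ([] , k , m) ∷ z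
    sort (+ 0 ∷ c , k , m) (p , q , z) = p , q , (c , k , m) ∷ z
    sort (+ suc x ∷ c , k , m) (p , q , z) = (suc x , c , k , m) ∷ p , q , z
    sort (-[1+ x ] ∷ c , k , m) (p , q , z) = p , (suc x , c , k , m) ∷ q , z

    resolve : Split → List Row
    resolve (p , q , z) = concatMap (λ { (a , r) → map (λ { (b , s) → comb b a r s }) q }) p ++ z

    eliminate : ℕ → List Row → List Row
    eliminate zero rs = rs
    eliminate (suc n) rs = eliminate n (resolve (foldr sort ([] , [] , []) rs))

    find : List Row → List ℕ
    find [] = []
    find ((_ , -[1+ _ ] , m) ∷ rs) = m
    find (_ ∷ rs) = find rs

    zeros : ∀ {A : Set} → List A → List ℕ
    zeros = map (λ _ → 0)

    diff : ∀ {n} → Vec ℕ n → Vec ℕ n → List ℤ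
    diff [] [] = []
    diff (a ∷ as) (b ∷ bs) = (+ b ℤ.- + a) ∷ diff as bs

    rows : ∀ {n} → List (Ineq n) → List ℕ → List Row
    rows [] pre = []
    rows ((l , r) ∷ cs) pre =
      (diff (proj₁ l) (proj₁ r) , (+ proj₂ r ℤ.- + proj₂ l) , pre ++ 1 ∷ zeros cs) ∷ rows cs (0 ∷ pre)

    nonneg : ℕ → List ℕ → List Row
    nonneg zero m = []
    nonneg (suc n) m = (+ 1 ∷ map (λ _ → + 0) (toL n) , + 0 , m)
                       ∷ map (λ { (c , k , m) → + 0 ∷ c , k , m }) (nonneg n m)
      where
      toL : ℕ → List ℕ
      toL zero = []
      toL (suc n) = n ∷ toL n

    oracle : ∀ {n} → List (Ineq n) → List ℕ
    oracle {n} cs = find (eliminate n (rows cs [] ++ nonneg n (zeros cs)))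

  contradictory : ∀ {n} → Ineq n → Bool
  contradictory (l , r) = dominates l r

  refutes : ∀ {n} → List (Ineq n) → Bool
  refutes cs = contradictory (combine (oracle cs) cs)

  refutes-sound : ∀ {n} ρ (cs : List (Ineq n)) → refutes cs ≡ true → Holds ρ cs → ⊥
  refutes-sound ρ cs eq hs =
    <⇒≱ (dominates-sound (proj₁ c) (proj₂ c) ρ eq) (combine-sound ρ (oracle cs) cs hs)
    where c = combine (oracle cs) cs

  check : ∀ {n} → Seq n → List (Ineq n) → Bool
  check (a ≼ b) cs = refutes ((const 1 ⊞ lin b , lin a) ∷ cs)
  check (a ≺ b) cs = refutes ((lin b , lin a) ∷ cs)
  check (a ≈ b) cs = refutes ((const 1 ⊞ lin b , lin a) ∷ cs) ∧ refutes ((const 1 ⊞ lin a , lin b) ∷ cs)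
  check absurd cs = refutes cs
  check ((a ≼ b) ⇒ g) cs = check g ((lin a , lin b) ∷ cs)
  check ((a ≺ b) ⇒ g) cs = check g ((const 1 ⊞ lin a , lin b) ∷ cs)
  check ((a ≈ b) ⇒ g) cs = check g ((lin a , lin b) ∷ (lin b , lin a) ∷ cs)
  check (_ ⇒ g) cs = check g cs

  private
    to≤ : ∀ {n} (a b : Expr n) ρ → ⟦ a ⟧ ρ ≤ ⟦ b ⟧ ρ → ⟨ lin a ⟩ ρ ≤ ⟨ lin b ⟩ ρ
    to≤ a b ρ h rewrite lin-sound a ρ | lin-sound b ρ = h

    to< : ∀ {n} (a b : Expr n) ρ → ⟦ a ⟧ ρ < ⟦ b ⟧ ρ → ⟨ const 1 ⊞ lin a ⟩ ρ ≤ ⟨ lin b ⟩ ρ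
    to< a b ρ h rewrite lin-sound (σ a) ρ | lin-sound b ρ = h

    ∧-true : ∀ a b → a ∧ b ≡ true → a ≡ true × b ≡ true
    ∧-true true true refl = refl , refl

  check-sound : ∀ {n} ρ (g : Seq n) cs → check g cs ≡ true → Holds ρ cs → Sem g ρ
  check-sound ρ (a ≼ b) cs eq hs =
    ≮⇒≥ (λ b<a → refutes-sound ρ ((const 1 ⊞ lin b , lin a) ∷ cs) eq (to< b a ρ b<a , hs))
  check-sound ρ (a ≺ b) cs eq hs =
    ≰⇒> (λ b≤a → refutes-sound ρ ((lin b , lin a) ∷ cs) eq (to≤ b a ρ b≤a , hs))
  check-sound ρ (a ≈ b) cs eq hs
    with ∧-true (refutes ((const 1 ⊞ lin b , lin a) ∷ cs)) (refutes ((const 1 ⊞ lin a , lin b) ∷ cs)) eq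
  ... | e₁ , e₂ = ≤-antisym (≮⇒≥ (λ b<a → refutes-sound ρ ((const 1 ⊞ lin b , lin a) ∷ cs) e₁ (to< b a ρ b<a , hs)))
                            (≮⇒≥ (λ a<b → refutes-sound ρ ((const 1 ⊞ lin a , lin b) ∷ cs) e₂ (to< a b ρ a<b , hs)))
  check-sound ρ absurd cs eq hs = refutes-sound ρ _ eq hs
  check-sound ρ ((a ≼ b) ⇒ g) cs eq hs h = check-sound ρ g _ eq (to≤ a b ρ h , hs)
  check-sound ρ ((a ≺ b) ⇒ g) cs eq hs h = check-sound ρ g _ eq (to< a b ρ h , hs)
  check-sound ρ ((a ≈ b) ⇒ g) cs eq hs h =
    check-sound ρ g _ eq (to≤ a b ρ (≤-reflexive h) , to≤ b a ρ (≤-reflexive (sym h)) , hs)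
  check-sound ρ (absurd ⇒ g) cs eq hs ()
  check-sound ρ ((_ ⇒ _) ⇒ g) cs eq hs h = check-sound ρ g cs eq hs

  Fun : ℕ → ℕ → Set
  Fun zero m = Seq m
  Fun (suc n) m = Expr m → Fun n m

  apply : ∀ {n m} → Fun n m → Vec (Expr m) n → Seq m
  apply s [] = s
  apply f (x ∷ xs) = apply (f x) xs

  abstract
    -- The vector ρ lists the atoms, and the formula is a function of them so that each use can name
    -- them. The certificate is checked by `refl`.
    lia : ∀ {n} (ρ : Vec ℕ n) (f : Fun n n) → let g = apply f (Vec.tabulate var) in
          check g [] ≡ true → Sem g ρ
    lia ρ f eq = check-sound ρ (apply f (Vec.tabulate var)) [] eq tt

open LinearArithmetic using (lia; con; σ; _⊕_; _⊛_; _≼_; _≺_; _≈_; _⇒_; absurd)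

-- Counting

abstract
  -- Abstract, so that conversion checking does not unfold `filter`; outside of abstract blocks
  -- `cnt≡` gives access to the definition.
  cnt : {A : Set} {P : A → Set} → (∀ x → Dec (P x)) → List A → ℕ
  cnt P? xs = length (filter P? xs)

  cnt≡ : {A : Set} {P : A → Set} (P? : ∀ x → Dec (P x)) (xs : List A) → cnt P? xs ≡ length (filter P? xs)
  cnt≡ P? xs = refl

module _ {A B : Set} where

  abstract

    -- A relation replaces an injective function: the image of x may come from a case analysis, and
    -- R can carry the side conditions on which injectivity depends.
    length-injection : (R : A → B → Set) → (∀ {x x′ y} → R x y → R x′ y → x ≡ x′) →
      ∀ xs ys → Unique xs → (∀ {x} → x ∈ xs → ∃ λ y → y ∈ ys × R x y) → length xs ≤ length ys
    length-injection R inj [] ys u f = z≤n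
    length-injection R inj (x ∷ xs) ys (x∉ ∷ u) f with f (here refl)
    ... | y , y∈ , r with ∈-∃++ y∈
    ... | as , bs , refl = subst (suc (length xs) ≤_) (sym eq)
            (s≤s (length-injection R inj xs (as ++ bs) u f′))
      where
      eq : length (as ++ y ∷ bs) ≡ suc (length (as ++ bs))
      eq = trans (length-++ as) (trans (+-suc (length as) (length bs)) (cong suc (sym (length-++ as))))
      f′ : ∀ {x′} → x′ ∈ xs → ∃ λ y → y ∈ as ++ bs × R x′ y
      f′ {x′} x′∈ with f (there x′∈)
      ... | y′ , y′∈ , r′ with ∈-++⁻ as y′∈
      ... | inj₁ q = y′ , ∈-++⁺ˡ q , r′
      ... | inj₂ (here refl) = ⊥-elim (All.lookup x∉ x′∈ (inj r r′))
      ... | inj₂ (there q) = y′ , ∈-++⁺ʳ as q , r′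

    cnt-injection : {P : A → Set} (P? : ∀ x → Dec (P x)) {Q : B → Set} (Q? : ∀ y → Dec (Q y)) →
      (R : A → B → Set) → (∀ {x x′ y} → R x y → R x′ y → x ≡ x′) →
      ∀ {xs ys} → Unique xs → (∀ {x} → x ∈ xs → P x → ∃ λ y → y ∈ ys × Q y × R x y) →
      cnt P? xs ≤ cnt Q? ys
    cnt-injection P? Q? R inj {xs} {ys} u f =
      length-injection R inj (filter P? xs) (filter Q? ys) (filter⁺ P? u) g
      where
      g : ∀ {x} → x ∈ filter P? xs → ∃ λ y → y ∈ filter Q? ys × R x y
      g x∈ with ∈-filter⁻ P? {xs = xs} x∈
      ... | x∈xs , p with f x∈xs p
      ... | y , y∈ , q , r = y , ∈-filter⁺ Q? y∈ q , r

module _ {A : Set} where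

  abstract

    cnt-∷-yes : {P : A → Set} (P? : ∀ x → Dec (P x)) {x : A} {xs : List A} → P x → cnt P? (x ∷ xs) ≡ suc (cnt P? xs)
    cnt-∷-yes P? p = cong length (filter-accept P? p)

    cnt-∷-no : {P : A → Set} (P? : ∀ x → Dec (P x)) {x : A} {xs : List A} → ¬ P x → cnt P? (x ∷ xs) ≡ cnt P? xs
    cnt-∷-no P? p = cong length (filter-reject P? p)

    cnt≤length : {P : A → Set} (P? : ∀ x → Dec (P x)) (xs : List A) → cnt P? xs ≤ length xs
    cnt≤length = length-filter

    cnt-cover : {P Q S : A → Set} (P? : ∀ x → Dec (P x)) (Q? : ∀ x → Dec (Q x)) (S? : ∀ x → Dec (S x)) →
      ∀ xs → (∀ {x} → x ∈ xs → P x → Q x ⊎ S x) → cnt P? xs ≤ cnt Q? xs + cnt S? xs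
    cnt-cover P? Q? S? [] f = z≤n
    cnt-cover P? Q? S? (x ∷ xs) f with cnt-cover P? Q? S? xs (λ m → f (there m))
    ... | ih with P? x | Q? x | S? x
    ... | no p | no q | no s = ih
    ... | no p | no q | yes s = ≤-trans ih (+-monoʳ-≤ (cnt Q? xs) (n≤1+n _))
    ... | no p | yes q | no s = ≤-trans ih (n≤1+n _)
    ... | no p | yes q | yes s = ≤-trans ih (≤-trans (+-monoʳ-≤ (cnt Q? xs) (n≤1+n _)) (n≤1+n _))
    ... | yes p | yes q | no s = s≤s ih
    ... | yes p | yes q | yes s = s≤s (≤-trans ih (+-monoʳ-≤ (cnt Q? xs) (n≤1+n _)))
    ... | yes p | no q | yes s = ≤-trans (s≤s ih) (≤-reflexive (sym (+-suc (cnt Q? xs) (cnt S? xs))))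
    ... | yes p | no q | no s with f (here refl) p
    ... | inj₁ q′ = ⊥-elim (q q′)
    ... | inj₂ s′ = ⊥-elim (s s′)

    cnt-disjoint : {P Q S : A → Set} (P? : ∀ x → Dec (P x)) (Q? : ∀ x → Dec (Q x)) (S? : ∀ x → Dec (S x)) →
      ∀ xs → (∀ {x} → x ∈ xs → P x → S x) → (∀ {x} → x ∈ xs → Q x → S x) →
      (∀ {x} → x ∈ xs → P x → Q x → ⊥) → cnt P? xs + cnt Q? xs ≤ cnt S? xs
    cnt-disjoint P? Q? S? [] f g h = z≤n
    cnt-disjoint P? Q? S? (x ∷ xs) f g h
      with cnt-disjoint P? Q? S? xs (λ m → f (there m)) (λ m → g (there m)) (λ m → h (there m))
    ... | ih with P? x | Q? x | S? x
    ... | yes p | yes q | _ = ⊥-elim (h (here refl) p q)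
    ... | yes p | no q | no s = ⊥-elim (s (f (here refl) p))
    ... | no p | yes q | no s = ⊥-elim (s (g (here refl) q))
    ... | yes p | no q | yes s = s≤s ih
    ... | no p | yes q | yes s = ≤-trans (≤-reflexive (+-suc (cnt P? xs) (cnt Q? xs))) (s≤s ih)
    ... | no p | no q | no s = ih
    ... | no p | no q | yes s = ≤-trans ih (n≤1+n _)

    cnt-mono : {P Q : A → Set} (P? : ∀ x → Dec (P x)) (Q? : ∀ x → Dec (Q x)) →
      ∀ xs → (∀ {x} → x ∈ xs → P x → Q x) → cnt P? xs ≤ cnt Q? xs
    cnt-mono P? Q? [] f = z≤n
    cnt-mono P? Q? (x ∷ xs) f with cnt-mono P? Q? xs (λ m → f (there m))
    ... | ih with P? x | Q? x
    ... | yes p | yes q = s≤s ih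
    ... | yes p | no q = ⊥-elim (q (f (here refl) p))
    ... | no p | yes q = ≤-trans ih (n≤1+n _)
    ... | no p | no q = ih

    -- Tight counts become pointwise facts through this: an inclusion between sets of equal size is
    -- an equality.
    cnt-full : {P Q : A → Set} (P? : ∀ x → Dec (P x)) (Q? : ∀ x → Dec (Q x)) →
      ∀ xs → (∀ {x} → x ∈ xs → P x → Q x) → cnt Q? xs ≤ cnt P? xs → ∀ {x} → x ∈ xs → Q x → P x
    cnt-full P? Q? (y ∷ xs) f le x∈ q with cnt-mono P? Q? xs (λ m → f (there m)) | P? y | Q? y
    cnt-full P? Q? (y ∷ xs) f le (here refl) q | mono | yes p | _ = p
    cnt-full P? Q? (y ∷ xs) f le (here refl) q | mono | no p | yes _ = ⊥-elim (<⇒≱ le mono)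
    cnt-full P? Q? (y ∷ xs) f le (here refl) q | mono | no p | no q′ = ⊥-elim (q′ q)
    cnt-full P? Q? (y ∷ xs) f le (there x∈) q | mono | yes p | yes _ =
      cnt-full P? Q? xs (λ m → f (there m)) (s≤s⁻¹ le) x∈ q
    cnt-full P? Q? (y ∷ xs) f le (there x∈) q | mono | yes p | no q′ = ⊥-elim (q′ (f (here refl) p))
    cnt-full P? Q? (y ∷ xs) f le (there x∈) q | mono | no p | yes _ = ⊥-elim (<⇒≱ le mono)
    cnt-full P? Q? (y ∷ xs) f le (there x∈) q | mono | no p | no _ =
      cnt-full P? Q? xs (λ m → f (there m)) le x∈ q

    cnt-differ : {P Q : A → Set} (P? : ∀ x → Dec (P x)) (Q? : ∀ x → Dec (Q x)) →
      ∀ xs → cnt P? xs < cnt Q? xs → ∃ λ x → x ∈ xs × Q x × ¬ P x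
    cnt-differ P? Q? (x ∷ xs) lt with P? x | Q? x
    ... | no p | yes q = x , here refl , q , p
    ... | yes p | yes q = let (y , m , r) = cnt-differ P? Q? xs (s≤s⁻¹ lt) in y , there m , r
    ... | yes p | no q = let (y , m , r) = cnt-differ P? Q? xs (<-trans (n<1+n _) lt) in y , there m , r
    ... | no p | no q = let (y , m , r) = cnt-differ P? Q? xs lt in y , there m , r

    cnt-∃ : {Q : A → Set} (Q? : ∀ x → Dec (Q x)) → ∀ xs → 1 ≤ cnt Q? xs → ∃ λ x → x ∈ xs × Q x
    cnt-∃ Q? (x ∷ xs) lt with Q? x
    ... | yes q = x , here refl , q
    ... | no q = let (y , m , r) = cnt-∃ Q? xs lt in y , there m , r

    cnt≥1 : {Q : A → Set} (Q? : ∀ x → Dec (Q x)) → ∀ {xs x} → x ∈ xs → Q x → 1 ≤ cnt Q? xs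
    cnt≥1 Q? {y ∷ xs} m q with Q? y
    cnt≥1 Q? {y ∷ xs} m q | yes _ = s≤s z≤n
    cnt≥1 Q? {y ∷ xs} (here refl) q | no q′ = ⊥-elim (q′ q)
    cnt≥1 Q? {y ∷ xs} (there m) q | no _ = cnt≥1 Q? m q

    cnt-0 : {Q : A → Set} (Q? : ∀ x → Dec (Q x)) → ∀ xs → cnt Q? xs ≡ 0 → ∀ {x} → x ∈ xs → ¬ Q x
    cnt-0 Q? (y ∷ xs) eq m q with Q? y
    cnt-0 Q? (y ∷ xs) eq (here refl) q | no q′ = q′ q
    cnt-0 Q? (y ∷ xs) eq (there m) q | no q′ = cnt-0 Q? xs eq m q

    cnt-none : {Q : A → Set} (Q? : ∀ x → Dec (Q x)) → ∀ xs → (∀ {x} → x ∈ xs → ¬ Q x) → cnt Q? xs ≡ 0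
    cnt-none Q? [] f = refl
    cnt-none Q? (x ∷ xs) f with Q? x
    ... | yes q = ⊥-elim (f (here refl) q)
    ... | no q = cnt-none Q? xs (λ m → f (there m))

    cnt-all : {Q : A → Set} (Q? : ∀ x → Dec (Q x)) → ∀ xs → (∀ {x} → x ∈ xs → Q x) → cnt Q? xs ≡ length xs
    cnt-all Q? [] f = refl
    cnt-all Q? (x ∷ xs) f with Q? x
    ... | yes q = cong suc (cnt-all Q? xs (λ m → f (there m)))
    ... | no q = ⊥-elim (q (f (here refl)))

    cnt-¬ : {P : A → Set} (P? : ∀ x → Dec (P x)) → ∀ xs → cnt P? xs + cnt (λ x → ¬? (P? x)) xs ≡ length xs
    cnt-¬ P? [] = refl
    cnt-¬ P? (x ∷ xs) with P? x
    ... | yes p = cong suc (cnt-¬ P? xs)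
    ... | no p = trans (+-suc (cnt P? xs) _) (cong suc (cnt-¬ P? xs))

    cnt≤1 : {Q : A → Set} (Q? : ∀ x → Dec (Q x)) → ∀ xs → Unique xs →
      (∀ {x y} → x ∈ xs → y ∈ xs → Q x → Q y → x ≡ y) → cnt Q? xs ≤ 1
    cnt≤1 Q? [] u f = z≤n
    cnt≤1 Q? (x ∷ xs) (x∉ ∷ u) f with Q? x
    ... | no q = cnt≤1 Q? xs u (λ a b → f (there a) (there b))
    ... | yes q = s≤s (≤-reflexive (cnt-none Q? xs λ m q′ → All.lookup x∉ m (f (here refl) (there m) q q′)))

    two-elements : {Q : A → Set} (Q? : ∀ x → Dec (Q x)) → (∀ (x y : A) → Dec (x ≡ y)) → ∀ xs → Unique xs →
      2 ≤ cnt Q? xs → ∀ x → ∃ λ y → y ∈ xs × Q y × y ≢ x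
    two-elements Q? _≟_ xs u le x = let (y , m , q , n) = cnt-differ (λ y → y ≟ x) Q? xs
                                          (≤-trans (s≤s (cnt≤1 (λ y → y ≟ x) xs u λ { _ _ refl refl → refl })) le)
                                    in y , m , q , n

    sum-mono : (f g : A → ℕ) → ∀ xs → (∀ {x} → x ∈ xs → f x ≤ g x) → sum (map f xs) ≤ sum (map g xs)
    sum-mono f g [] h = z≤n
    sum-mono f g (x ∷ xs) h = +-mono-≤ (h (here refl)) (sum-mono f g xs (λ m → h (there m)))

    sum-const : (c : ℕ) → ∀ (xs : List A) → sum (map (λ _ → c) xs) ≡ length xs * c
    sum-const c [] = refl
    sum-const c (x ∷ xs) = cong (c +_) (sum-const c xs)

    sum-+ : (f g : A → ℕ) → ∀ xs → sum (map (λ x → f x + g x) xs) ≡ sum (map f xs) + sum (map g xs)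
    sum-+ f g [] = refl
    sum-+ f g (x ∷ xs) rewrite sum-+ f g xs = assocs (f x) (g x) (sum (map f xs)) (sum (map g xs))
      where
      assocs : ∀ a b c d → a + b + (c + d) ≡ a + c + (b + d)
      assocs a b c d = lia (a ∷ b ∷ c ∷ d ∷ []) (λ a b c d → a ⊕ b ⊕ (c ⊕ d) ≈ a ⊕ c ⊕ (b ⊕ d)) refl

module _ {A B : Set} {R : A → B → Set} (R? : ∀ x y → Dec (R x y)) where

  abstract

    private
      ind : A → B → ℕ
      ind x y with R? x y
      ... | yes _ = 1
      ... | no _ = 0

      cnt-ind : ∀ x ys → cnt (R? x) ys ≡ sum (map (ind x) ys)
      cnt-ind x [] = refl
      cnt-ind x (y ∷ ys) with R? x y
      ... | yes _ = cong suc (cnt-ind x ys)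
      ... | no _ = cnt-ind x ys

      cnt-indʳ : ∀ y x xs → cnt (λ x → R? x y) (x ∷ xs) ≡ ind x y + cnt (λ x → R? x y) xs
      cnt-indʳ y x xs with R? x y
      ... | yes _ = refl
      ... | no _ = refl

      sum-cong : (f g : B → ℕ) → ∀ ys → (∀ y → f y ≡ g y) → sum (map f ys) ≡ sum (map g ys)
      sum-cong f g [] h = refl
      sum-cong f g (y ∷ ys) h = cong₂ _+_ (h y) (sum-cong f g ys h)

    double-count : ∀ xs ys → sum (map (λ x → cnt (R? x) ys) xs) ≡ sum (map (λ y → cnt (λ x → R? x y) xs) ys)
    double-count [] ys = sym (trans (sum-const 0 ys) (*-zeroʳ (length ys)))
    double-count (x ∷ xs) ys = begin
      cnt (R? x) ys + sum (map (λ x → cnt (R? x) ys) xs)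
        ≡⟨ cong₂ _+_ (cnt-ind x ys) (double-count xs ys) ⟩
      sum (map (ind x) ys) + sum (map (λ y → cnt (λ x → R? x y) xs) ys)
        ≡⟨ sum-+ (ind x) _ ys ⟨
      sum (map (λ y → ind x y + cnt (λ x → R? x y) xs) ys)
        ≡⟨ sum-cong _ _ ys (λ y → sym (cnt-indʳ y x xs)) ⟩
      sum (map (λ y → cnt (λ x → R? x y) (x ∷ xs)) ys) ∎
      where open ≡-Reasoning

abstract
  𝟙 : {X : Set} → Dec X → ℕ
  𝟙 (yes _) = 1
  𝟙 (no _) = 0

  𝟙≥1 : {X : Set} (d : Dec X) → X → 1 ≤ 𝟙 d
  𝟙≥1 (yes _) _ = s≤s z≤n
  𝟙≥1 (no n) x = ⊥-elim (n x)

  cnt≡sum : {A : Set} {P : A → Set} (P? : ∀ x → Dec (P x)) (xs : List A) → cnt P? xs ≡ sum (map (λ x → 𝟙 (P? x)) xs)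
  cnt≡sum P? [] = refl
  cnt≡sum P? (x ∷ xs) with P? x
  ... | yes _ = cong suc (cnt≡sum P? xs)
  ... | no _ = cnt≡sum P? xs

-- Binomial coefficients

-- An opaque copy of _C_, whose definition by factorials unfolds badly in conversion checking.
infixl 6.5 _choose_

abstract
  _choose_ : ℕ → ℕ → ℕ
  n choose k = n C k

  C≡ : ∀ n k → n choose k ≡ n C k
  C≡ n k = refl

  pascal : ∀ n k → suc n choose suc k ≡ n choose k + n choose suc k
  pascal n k = sym (nCk+nC[k+1]≡[n+1]C[k+1] n k)

  choose-0 : ∀ n → n choose 0 ≡ 1
  choose-0 zero = refl
  choose-0 (suc n) = refl

  choose-1 : ∀ n → n choose 1 ≡ n
  choose-1 = nC1≡n

  choose-self : ∀ n → n choose n ≡ 1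
  choose-self = nCn≡1

  C≡0 : ∀ {a k} → a < k → a choose k ≡ 0
  C≡0 = k>n⇒nCk≡0

C-suc : ∀ n k → n choose k ≤ suc n choose k
C-suc n zero = ≤-reflexive (trans (choose-0 n) (sym (choose-0 (suc n))))
C-suc n (suc k) = ≤-trans (m≤n+m (n choose suc k) (n choose k)) (≤-reflexive (sym (pascal n k)))

C-mono : ∀ {m n} k → m ≤ n → m choose k ≤ n choose k
C-mono {m} {n} k m≤n = go (≤⇒≤′ m≤n)
  where
  go : ∀ {n} → m ≤′ n → m choose k ≤ n choose k
  go ≤′-refl = ≤-refl
  go (≤′-step h) = ≤-trans (go h) (C-suc _ k)

C-pos : ∀ n k → k ≤ n → 1 ≤ n choose k
C-pos n zero h = ≤-reflexive (sym (choose-0 n))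
C-pos (suc n) (suc k) (s≤s h) = ≤-trans (C-pos n k h) (≤-trans (m≤m+n _ _) (≤-reflexive (sym (pascal n k))))

C≥n : ∀ n k → 1 ≤ k → suc k ≤ n → n ≤ n choose k
C≥n (suc n) (suc zero) h g = ≤-reflexive (sym (choose-1 (suc n)))
C≥n (suc n) (suc (suc k)) h (s≤s g) = subst (suc n ≤_) (sym (pascal n (suc k)))
  (lia (n ∷ n choose suc k ∷ n choose suc (suc k) ∷ []) (λ n a b → n ≼ a ⇒ con 1 ≼ b ⇒ σ n ≼ a ⊕ b) refl
    (C≥n n (suc k) (s≤s z≤n) g) (C-pos n (suc (suc k)) g))

-- Both summands in Pascal's rule are at least n - 1 by `C≥n`.
C≥2n∸2 : ∀ n k → 2 ≤ k → suc (suc k) ≤ n → 2 * n ≤ 2 + n choose k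
C≥2n∸2 (suc n) (suc zero) (s≤s ()) g
C≥2n∸2 (suc n) (suc (suc k)) h (s≤s g) = subst (λ c → 2 * suc n ≤ 2 + c) (sym (pascal n (suc k)))
  (lia (n ∷ n choose suc k ∷ n choose suc (suc k) ∷ [])
    (λ n a b → n ≼ a ⇒ n ≼ b ⇒ 2 ⊛ σ n ≼ con 2 ⊕ (a ⊕ b)) refl
    (C≥n n (suc k) (s≤s z≤n) (≤-trans (n≤1+n _) g)) (C≥n n (suc (suc k)) (s≤s z≤n) g))

cnt-≢ : ∀ {j q} → j < q → cnt (λ i → ¬? (i ≟ j)) (upTo q) < q
cnt-≢ {j} {q} j< = subst (suc (cnt (λ i → ¬? (i ≟ j)) (upTo q)) ≤_) (length-upTo q)
  (≤-trans (+-monoˡ-≤ _ (cnt≥1 (λ i → i ≟ j) (∈-upTo⁺ j<) refl)) (≤-reflexive (cnt-¬ (λ i → i ≟ j) (upTo q))))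

cnt-upTo≤ : {P : ℕ → Set} (P? : ∀ i → Dec (P i)) → ∀ q → cnt P? (upTo q) ≤ q
cnt-upTo≤ P? q = subst (cnt P? (upTo q) ≤_) (length-upTo q) (cnt≤length P? (upTo q))

cnt-upTo-full : {P : ℕ → Set} (P? : ∀ i → Dec (P i)) → ∀ q → q ≤ cnt P? (upTo q) → ∀ {i} → i < q → P i
cnt-upTo-full P? q le {i} i< = cnt-full P? (λ i → i <? q) (upTo q) (λ m _ → ∈-upTo⁻ m)
  (≤-trans (cnt-upTo≤ (λ i → i <? q) q) le) (∈-upTo⁺ i<) i<

C≤1 : ∀ {a k} → a ≤ k → a choose k ≤ 1
C≤1 {a} {k} a≤ = ≤-trans (C-mono k a≤) (≤-reflexive (choose-self k))

-- Each step of Pascal's rule adds C(j + a, ρ) ≥ j + a ≥ 2. In the count around a missed vertex, one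
-- neighbour fewer frees two links of the cycle; the loss of edges makes up for that.
C-grow₂ : ∀ {ρ a} → 1 ≤ ρ → suc ρ ≤ a → ∀ j → 2 * j + a choose suc ρ ≤ (j + a) choose suc ρ
C-grow₂ {ρ} {a} h g zero = ≤-refl
C-grow₂ {ρ} {a} h g (suc j) = subst (2 * suc j + a choose suc ρ ≤_) (sym (pascal (j + a) ρ))
  (lia (j ∷ a choose suc ρ ∷ (j + a) choose ρ ∷ (j + a) choose suc ρ ∷ [])
    (λ j c x y → 2 ⊛ j ⊕ c ≼ y ⇒ con 2 ≼ x ⇒ 2 ⊛ σ j ⊕ c ≼ x ⊕ y) refl
    (C-grow₂ h g j) (≤-trans (≤-trans (s≤s h) (≤-trans g (m≤n+m a j))) (C≥n (j + a) ρ h (≤-trans g (m≤n+m a j)))))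

-- With one more element in a, each step adds at least 3, which strictly outweighs the two links
-- freed by a lost neighbour.
C-grow₃ : ∀ {ρ a} → 1 ≤ ρ → suc (suc ρ) ≤ a → ∀ j → 3 * j + a choose suc ρ ≤ (j + a) choose suc ρ
C-grow₃ {ρ} {a} h g zero = ≤-refl
C-grow₃ {ρ} {a} h g (suc j) = subst (3 * suc j + a choose suc ρ ≤_) (sym (pascal (j + a) ρ))
  (lia (j ∷ a choose suc ρ ∷ (j + a) choose ρ ∷ (j + a) choose suc ρ ∷ [])
    (λ j c x y → 3 ⊛ j ⊕ c ≼ y ⇒ con 3 ≼ x ⇒ 3 ⊛ σ j ⊕ c ≼ x ⊕ y) refl
    (C-grow₃ h g j) (≤-trans (≤-trans (s≤s (s≤s h)) (≤-trans g (m≤n+m a j)))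
      (C≥n (j + a) ρ h (≤-trans (n≤1+n _) (≤-trans g (m≤n+m a j))))))

-- For K + 1 < t this is weaker than `C≥2n∸2`, and for t = K + 1 both sides equal 2 t. In its use K
-- + 1 is r.
C≥2t∸K : ∀ {t K} → 2 ≤ K → suc K ≤ t → 2 * t ≤ suc K + t choose K
C≥2t∸K {t} {K} h g with m≤n⇒m<n∨m≡n g
... | inj₁ lt = lia (t ∷ K ∷ t choose K ∷ []) (λ t K c → 2 ⊛ t ≼ con 2 ⊕ c ⇒ con 2 ≼ K ⇒ 2 ⊛ t ≼ σ K ⊕ c) refl (C≥2n∸2 t K h lt) h
... | inj₂ refl = lia (K ∷ suc K choose K ∷ []) (λ K c → σ K ≼ c ⇒ 2 ⊛ σ K ≼ σ K ⊕ c) refl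
                    (C≥n (suc K) K (≤-trans (n≤1+n 1) h) ≤-refl)

-- Cyclic order, links touched by a set of positions, reversal of an initial segment

abstract
  nxt : ℕ → ℕ → ℕ
  nxt q k with k <? q
  ... | yes _ = suc k
  ... | no _ = 0

  nxt-lo : ∀ {q k} → k < q → nxt q k ≡ suc k
  nxt-lo {q} {k} h with k <? q
  ... | yes _ = refl
  ... | no g = ⊥-elim (g h)

  nxt-hi : ∀ q → nxt q q ≡ 0
  nxt-hi q with q <? q
  ... | yes h = ⊥-elim (<-irrefl refl h)
  ... | no _ = refl

  nxt-≤ : ∀ q k → nxt q k ≤ q
  nxt-≤ q k with k <? q
  ... | yes h = h
  ... | no _ = z≤n

nxt-inj : ∀ {q k l} → k ≤ q → l ≤ q → nxt q k ≡ nxt q l → k ≡ l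
nxt-inj {q} k≤ l≤ eq with m≤n⇒m<n∨m≡n k≤ | m≤n⇒m<n∨m≡n l≤
... | inj₁ a | inj₁ b = suc-injective (trans (sym (nxt-lo a)) (trans eq (nxt-lo b)))
... | inj₁ a | inj₂ refl with trans (sym (nxt-lo a)) (trans eq (nxt-hi q))
... | ()
nxt-inj {q} k≤ l≤ eq | inj₂ refl | inj₁ b with trans (sym (nxt-lo b)) (trans (sym eq) (nxt-hi q))
... | ()
nxt-inj {q} k≤ l≤ eq | inj₂ refl | inj₂ refl = refl

nxt-onto : ∀ q {l} → l ≤ q → ∃ λ k → k ≤ q × nxt q k ≡ l
nxt-onto q {zero} _ = q , ≤-refl , nxt-hi q
nxt-onto q {suc l} h = l , <⇒≤ h , nxt-lo h

cnt-nxt : ∀ q {X : ℕ → Set} (X? : ∀ k → Dec (X k)) → cnt X? (upTo (suc q)) ≤ cnt (λ k → X? (nxt q k)) (upTo (suc q))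
cnt-nxt q {X} X? = cnt-injection X? (λ k → X? (nxt q k)) (λ l k → l ≡ nxt q k) (λ { refl refl → refl }) (upTo⁺ (suc q))
  λ m h → let (k , k≤ , eq) = nxt-onto q (s≤s⁻¹ (∈-upTo⁻ m)) in k , ∈-upTo⁺ (s≤s k≤) , subst X (sym eq) h , sym eq

-- The links k (from k to nxt k) touched by X.
Touch : ℕ → (ℕ → Set) → ℕ → Set
Touch q X k = X k ⊎ X (nxt q k)

touch? : ∀ q {X : ℕ → Set} → (∀ k → Dec (X k)) → ∀ k → Dec (Touch q X k)
touch? q X? k = X? k ⊎-dec X? (nxt q k)

-- Every position in X touches the link at it and the one before it, and sparsity makes all these
-- links different.
touch-sparse : ∀ q {X : ℕ → Set} (X? : ∀ k → Dec (X k)) → (∀ {k} → k ≤ q → X k → X (nxt q k) → ⊥) →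
  2 * cnt X? (upTo (suc q)) ≤ cnt (touch? q X?) (upTo (suc q))
touch-sparse q X? sparse = ≤-trans
  (lia (cnt X? (upTo (suc q)) ∷ cnt (λ k → X? (nxt q k)) (upTo (suc q)) ∷ []) (λ a b → a ≼ b ⇒ 2 ⊛ a ≼ a ⊕ b) refl (cnt-nxt q X?))
  (cnt-disjoint X? (λ k → X? (nxt q k)) (touch? q X?) (upTo (suc q)) (λ _ → inj₁) (λ _ → inj₂)
    (λ m → sparse (s≤s⁻¹ (∈-upTo⁻ m))))

-- Otherwise every touched link starts in X, so X is closed under cyclic predecessors: from i it
-- reaches 0, from there q, and then every position.
touch-boundary : ∀ q {X : ℕ → Set} (X? : ∀ k → Dec (X k)) → ∀ {i j} → i ≤ q → X i → j ≤ q → ¬ X j →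
  cnt X? (upTo (suc q)) < cnt (touch? q X?) (upTo (suc q))
touch-boundary q {X} X? {i} {j} i≤ xi j≤ ¬xj = ≰⇒> λ le → ¬xj (all le (m+[n∸m]≡n j≤))
  where
  module _ (le : cnt (touch? q X?) (upTo (suc q)) ≤ cnt X? (upTo (suc q))) where
    back : ∀ {k} → k ≤ q → X (nxt q k) → X k
    back k≤ h = cnt-full X? (touch? q X?) (upTo (suc q)) (λ _ → inj₁) le (∈-upTo⁺ (s≤s k≤)) (inj₂ h)
    to-0 : ∀ {k} → k ≤ q → X k → X 0
    to-0 {zero} _ h = h
    to-0 {suc k} k< h = to-0 (<⇒≤ k<) (back (<⇒≤ k<) (subst X (sym (nxt-lo k<)) h))
    all : ∀ {m k} → k + m ≡ q → X k
    all {zero} {k} eq = subst X (sym (trans (sym (+-identityʳ k)) eq)) (back ≤-refl (subst X (sym (nxt-hi q)) (to-0 i≤ xi)))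
    all {suc m} {k} eq = back (<⇒≤ k<) (subst X (sym (nxt-lo k<)) (all {m} {suc k} (trans (sym (+-suc k m)) eq)))
      where k< = subst (k <_) eq (m<m+n k (s≤s z≤n))

Apart : ℕ → (ℕ → Set) → (ℕ → Set) → Set
Apart q X Y = ∀ {k} → k ≤ q → (X k → Y k → ⊥) × (X k → Y (nxt q k) → ⊥) × (X (nxt q k) → Y k → ⊥)

apart-touch : ∀ q (X Y : ℕ → Set) → Apart q X Y → ∀ {k} → k ≤ q → Touch q X k → Touch q Y k → ⊥
apart-touch q X Y ap k≤ (inj₁ x) (inj₁ y) = proj₁ (ap k≤) x y
apart-touch q X Y ap k≤ (inj₁ x) (inj₂ y) = proj₁ (proj₂ (ap k≤)) x y
apart-touch q X Y ap k≤ (inj₂ x) (inj₁ y) = proj₂ (proj₂ (ap k≤)) x y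
apart-touch q X Y ap k≤ (inj₂ x) (inj₂ y) = proj₁ (ap (nxt-≤ q _)) x y

abstract
  -- The positions under a rotation at i: the segment 0, ..., i is reversed and the rest is fixed.
  -- It is an involution, so one map serves both directions.
  flip : ℕ → ℕ → ℕ
  flip i k with k ≤? i
  ... | yes _ = i ∸ k
  ... | no _ = k

  flip-lo : ∀ {i a b} → a + b ≡ i → flip i a ≡ b
  flip-lo {i} {a} {b} refl with a ≤? a + b
  ... | yes _ = m+n∸m≡n a b
  ... | no h = ⊥-elim (h (m≤m+n a b))

  flip-hi : ∀ {i k} → i < k → flip i k ≡ k
  flip-hi {i} {k} h with k ≤? i
  ... | yes g = ⊥-elim (<⇒≱ h g)
  ... | no _ = refl

  flip-inj : ∀ i {k l} → flip i k ≡ flip i l → k ≡ l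
  flip-inj i {k} {l} eq with k ≤? i | l ≤? i
  ... | yes a | yes b = ∸-cancelˡ-≡ a b eq
  ... | yes a | no b = ⊥-elim (b (subst (_≤ i) eq (m∸n≤m i k)))
  ... | no a | yes b = ⊥-elim (a (subst (_≤ i) (sym eq) (m∸n≤m i l)))
  ... | no a | no b = eq

  flip-≤ : ∀ {i p k} → i ≤ p → k ≤ p → flip i k ≤ p
  flip-≤ {i} {p} {k} a b with k ≤? i
  ... | yes _ = ≤-trans (m∸n≤m i k) a
  ... | no _ = b

  flip-flip : ∀ i k → flip i (flip i k) ≡ k
  flip-flip i k with k ≤? i
  ... | yes h = flip-lo (m∸n+n≡m h)
  ... | no h = flip-hi (≰⇒> h)

  flip-< : ∀ {i p k} → i < p → k < p → flip i k < p
  flip-< {i} {suc p} (s≤s a) (s≤s b) = s≤s (flip-≤ a b)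

≤-split : ∀ {a i} → a ≤ i → ∃ λ b → a + b ≡ i
≤-split h = _ , m+[n∸m]≡n h

<-split : ∀ {a i} → a < i → ∃ λ b → suc (a + b) ≡ i
<-split h = ≤-split h

max : {P : ℕ → Set} → (∀ i → Dec (P i)) → ∀ p {i} → i < p → P i →
  ∃ λ j → j < p × P j × (∀ {k} → j < k → k < p → ¬ P k)
max P? (suc p) {i} i< h with P? p
... | yes hp = p , ≤-refl , hp , λ p<k k< → ⊥-elim (<⇒≱ p<k (s≤s⁻¹ k<))
... | no ¬hp with m≤n⇒m<n∨m≡n (s≤s⁻¹ i<)
... | inj₂ refl = ⊥-elim (¬hp h)
... | inj₁ lt with max P? p lt h
... | j , j< , hj , above = j , <-trans j< ≤-refl , hj , λ j<k k< hk → last k< j<k hk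
  where
  last : ∀ {k} → k < suc p → j < k → ¬ _
  last k< j<k hk with m≤n⇒m<n∨m≡n (s≤s⁻¹ k<)
  ... | inj₁ k<p = above j<k k<p hk
  ... | inj₂ refl = ¬hp hk

-- Numerical contradictions for the extremal counts

private
  -- In the count around a missed vertex, a is the number of neighbours on single edges, x and u
  -- count touched links, b the links that contain the vertex, f and d the single and double edges.
  -- As x ≥ 2 a, at most 2 j + 1 links remain for u + b, so d + b ≤ 2 j and s + b ≤ y + 2 j ≤ z.
  singles-bound : ∀ {a j x u b q t s f d p y z} → 2 * a ≤ x → x + u + b ≤ suc q → q ≤ 2 * suc t → a + j ≡ suc t →
    suc z ≤ s + b → s ≤ f + d → f ≤ y → d ≤ p → p < u → 2 * j + y ≤ z → ⊥
  singles-bound {a} {j} {x} {u} {b} {q} {t} {s} {f} {d} {p} {y} {z} =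
    lia (a ∷ j ∷ x ∷ u ∷ b ∷ q ∷ t ∷ s ∷ f ∷ d ∷ p ∷ y ∷ z ∷ [])
      (λ a j x u b q t s f d p y z → 2 ⊛ a ≼ x ⇒ x ⊕ u ⊕ b ≼ σ q ⇒ q ≼ 2 ⊛ σ t ⇒ a ⊕ j ≈ σ t ⇒
        σ z ≼ s ⊕ b ⇒ s ≼ f ⊕ d ⇒ f ≼ y ⇒ d ≼ p ⇒ p ≺ u ⇒ 2 ⊛ j ⊕ y ≼ z ⇒ absurd) refl

  -- With T = suc t, the touched links give 2 d + b ≤ 2 T, and two different edges give b ≤ 2 T + 1
  -- - 2 r. Adding them, 2 (d + b) ≤ 4 T + 1 - 2 r, whereas d + b ≥ z + 1 ≥ 2 T + 1 - r.
  doubles-bound : ∀ {d p u x b q t s f ρ r z} → 2 * d ≤ p → p < u → x + u + b ≤ suc q → q ≤ 2 * suc t →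
    suc z ≤ s + b → s ≤ f + d → f ≡ 0 → r ≡ suc (suc ρ) → 2 * r + b ≤ suc q → 2 * suc t ≤ suc (suc ρ) + z → ⊥
  doubles-bound {d} {p} {u} {x} {b} {q} {t} {s} {f} {ρ} {r} {z} =
    lia (d ∷ p ∷ u ∷ x ∷ b ∷ q ∷ t ∷ s ∷ f ∷ ρ ∷ r ∷ z ∷ [])
      (λ d p u x b q t s f ρ r z → 2 ⊛ d ≼ p ⇒ p ≺ u ⇒ x ⊕ u ⊕ b ≼ σ q ⇒ q ≼ 2 ⊛ σ t ⇒
        σ z ≼ s ⊕ b ⇒ s ≼ f ⊕ d ⇒ f ≈ con 0 ⇒ r ≈ σ (σ ρ) ⇒ 2 ⊛ r ⊕ b ≼ σ q ⇒ 2 ⊛ σ t ≼ σ (σ ρ) ⊕ z ⇒ absurd) refl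

private
  -- The coefficient is τ for ρ = 1 and at least 2 τ - 2 otherwise. The factor 3 + 2 τ bounds the
  -- number of links, each with ρ vertices besides the two that it joins.
  product-bound : ∀ {ρ τ} → 1 ≤ ρ → suc (suc ρ) ≤ τ → suc (ρ * (3 + 2 * τ)) ≤ suc (τ choose ρ) * (τ choose ρ)
  product-bound {suc zero} {τ} _ 3≤ with ≤-split 3≤
  ... | s , refl rewrite choose-1 (3 + s) = ≤-trans (m≤m+n _ (s * (5 + s) + 2)) (≤-reflexive (lem s))
    where
    lem : ∀ s → suc (1 * (3 + 2 * (3 + s))) + (s * (5 + s) + 2) ≡ suc (3 + s) * (3 + s)
    lem = solve-∀
  product-bound {suc (suc ρ)} {τ} _ le with ≤-split le
  ... | s , refl = ≤-trans (≤-trans (m≤m+n _ (4 * ρ + 2 * (2 + ρ) * s + 11 * s + 2 * s * s + 19)) (≤-reflexive (lem ρ s)))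
      (*-mono-≤ {7 + 2 * ρ + 2 * s} {_} {6 + ρ + s}
        (s≤s (lia (ρ ∷ s ∷ c ∷ []) (λ ρ s c → 2 ⊛ (σ (σ (σ (σ ρ))) ⊕ s) ≼ con 2 ⊕ c ⇒ con 6 ⊕ 2 ⊛ ρ ⊕ 2 ⊛ s ≼ c) refl c≥))
        (lia (ρ ∷ s ∷ c ∷ []) (λ ρ s c → 2 ⊛ (σ (σ (σ (σ ρ))) ⊕ s) ≼ con 2 ⊕ c ⇒ con 6 ⊕ ρ ⊕ s ≼ c) refl c≥))
    where
    c = (4 + ρ + s) choose (2 + ρ)
    c≥ : 2 * (4 + ρ + s) ≤ 2 + c
    c≥ = C≥2n∸2 (4 + ρ + s) (2 + ρ) (s≤s (s≤s z≤n)) (m≤m+n (4 + ρ) s)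
    lem : ∀ ρ s → suc ((2 + ρ) * (3 + 2 * (4 + ρ + s))) + (4 * ρ + 2 * (2 + ρ) * s + 11 * s + 2 * s * s + 19) ≡ (7 + 2 * ρ + 2 * s) * (6 + ρ + s)
    lem = solve-∀

  -- When d grows by one, the left side grows by c + 1 ≥ 2 and the right side by 2, so d = c + 1 is
  -- the extreme case; there the inequality reads (c + 1) c ≤ ρ p.
  degree-sum-bound : ∀ {ρ c p d} → suc (ρ * p) ≤ suc c * c → suc c ≤ d → suc d * suc c ≤ ρ * p + (d + d) → ⊥
  degree-sum-bound {ρ} {suc c} {p} {d} pb d≥ le with ≤-split d≥
  ... | m , refl = <⇒≱ pb (+-cancelʳ-≤ (suc (suc c) + m + (suc (suc c) + m)) (suc (suc c) * suc c) (ρ * p)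
                     (≤-trans (≤-trans (m≤m+n _ (m * c)) (≤-reflexive (lem c m))) le))
    where
    lem : ∀ c m → suc (suc c) * suc c + (suc (suc c) + m + (suc (suc c) + m)) + m * c ≡ suc (suc (suc c) + m) * suc (suc c)
    lem = solve-∀

-- Counting edges inside a set of vertices

module Incidence
  (n M r : ℕ)
  (_∊_ : Fin n → Fin M → Set)
  (_∊?_ : ∀ v e → Dec (v ∊ e))
  (size : ∀ e → cnt (λ v → v ∊? e) (allFin n) ≡ r)
  -- Distinctness and uniformity in one: an inclusion between edges of equal size is an equality.
  (ext : ∀ e f → (∀ v → v ∊ e → v ∊ f) → e ≡ f)
  where

  V E : Set
  V = Fin n
  E = Fin M

  degree≥ : V → ℕ → Set
  degree≥ v d = d ≤ cnt (λ e → v ∊? e) (allFin M)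

  private
    size′ : ∀ e → length (filter (λ v → v ∊? e) (allFin n)) ≡ r
    size′ e = trans (sym (cnt≡ (λ v → v ∊? e) (allFin n))) (size e)

  members≤ : ∀ e xs → Unique xs → (∀ {x} → x ∈ xs → x ∊ e) → length xs ≤ r
  members≤ e xs u f = subst (length xs ≤_) (size′ e)
    (length-injection _≡_ (λ { refl refl → refl }) xs _ u
      (λ {x} m → x , ∈-filter⁺ (λ v → v ∊? e) (∈-allFin x) (f m) , refl))

  cover≥ : ∀ e xs → (∀ v → v ∊ e → v ∈ xs) → r ≤ length xs
  cover≥ e xs f = subst (_≤ length xs) (size′ e)
    (length-injection _≡_ (λ { refl refl → refl }) _ xs (filter⁺ (λ v → v ∊? e) (allFin⁺ n))
      (λ {x} m → x , f x (proj₂ (∈-filter⁻ (λ v → v ∊? e) {xs = allFin n} m)) , refl))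

  indexed≤ : ∀ e {I : ℕ → Set} (I? : ∀ i → Dec (I i)) q (g : ℕ → V) →
    (∀ {i j} → i < q → j < q → I i → I j → g i ≡ g j → i ≡ j) →
    (∀ {i} → i < q → I i → g i ∊ e) → cnt I? (upTo q) ≤ r
  indexed≤ e {I} I? q g inj f = subst (cnt I? (upTo q) ≤_) (size e)
    (cnt-injection I? (λ v → v ∊? e) (λ i v → g i ≡ v × i < q × I i)
      (λ { (refl , a , b) (eq , c , d) → inj a c b d (sym eq) }) (upTo⁺ q)
      (λ {i} m h → g i , ∈-allFin (g i) , f (∈-upTo⁻ m) h , refl , ∈-upTo⁻ m , h))

  open import Data.List.Membership.DecPropositional (_≟ᶠ_ {n}) using () renaming (_∈?_ to _∈ᵛ?_)

  private
    Between : List V → List V → E → Set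
    Between X cs e = (∀ {x} → x ∈ X → x ∊ e) × (∀ {w} → w ∊ e → w ∈ X ⊎ w ∈ cs)

    exact : ∀ {X} → Unique X → length X ≡ r → ∀ {e} → (∀ {x} → x ∈ X → x ∊ e) → ∀ {w} → w ∊ e → w ∈ X
    exact {X} uX eq {e} X⊆ {w} w∊ with w ∈ᵛ? X
    ... | yes h = h
    ... | no h = ⊥-elim (<⇒≱ (s≤s (≤-reflexive (sym eq)))
                   (members≤ e (w ∷ X) (AllP.¬Any⇒All¬ X h ∷ uX)
                     (λ { (here refl) → w∊ ; (there m) → X⊆ m })))

    atMostOne : ∀ {X} → Unique X → length X ≡ r → ∀ L → Unique L → (∀ {e} → e ∈ L → (∀ {x} → x ∈ X → x ∊ e)) → length L ≤ 1
    atMostOne uX eq [] uL f = z≤n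
    atMostOne uX eq (e ∷ []) uL f = s≤s z≤n
    atMostOne uX eq (e ∷ e′ ∷ L) ((e≢ ∷ _) ∷ _) f =
      ⊥-elim (e≢ (ext e e′ (λ v v∊ → f (there (here refl)) (exact uX eq (f (here refl)) v∊))))

    -- Pascal's rule, splitting by whether an edge contains c. The recursion avoids listing subsets,
    -- and `cs` may repeat vertices or meet X, so callers need not show that their positions give
    -- different vertices.
    edges≤ : ∀ (cs X : List V) (L : List E) k → Unique L → Unique X → length X + k ≡ r →
      (∀ {e} → e ∈ L → Between X cs e) → length L ≤ length cs choose k
    edges≤ cs X L zero uL uX eq f = subst (length L ≤_) (sym (choose-0 (length cs)))
      (atMostOne uX (trans (sym (+-identityʳ _)) eq) L uL (λ m → proj₁ (f m)))
    edges≤ [] X [] (suc k) uL uX eq f = z≤n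
    edges≤ [] X (e ∷ L) (suc k) uL uX eq f = ⊥-elim (<⇒≱ (subst (length X <_) eq (m<m+n (length X) (s≤s z≤n)))
      (cover≥ e X (λ v v∊ → drop (proj₂ (f (here refl)) v∊))))
      where
      drop : ∀ {w} → w ∈ X ⊎ w ∈ [] → w ∈ X
      drop (inj₁ h) = h
    edges≤ (c ∷ cs) X L (suc k) uL uX eq f with c ∈ᵛ? X
    ... | yes c∈X = ≤-trans (edges≤ cs X L (suc k) uL uX eq (λ m → proj₁ (f m) , λ w∊ → shift (proj₂ (f m) w∊)))
                            (C-suc (length cs) (suc k))
      where
      shift : ∀ {w} → w ∈ X ⊎ w ∈ c ∷ cs → w ∈ X ⊎ w ∈ cs
      shift (inj₁ h) = inj₁ h
      shift (inj₂ (here refl)) = inj₁ c∈X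
      shift (inj₂ (there h)) = inj₂ h
    ... | no c∉X = subst (length L ≤_) (sym (pascal (length cs) k)) (≤-trans (≤-reflexive (sym (trans (sym (cong₂ _+_ (cnt≡ (c ∊?_) L) (cnt≡ (λ e → ¬? (c ∊? e)) L))) (cnt-¬ (c ∊?_) L))))
        (+-mono-≤
          (edges≤ cs (c ∷ X) (filter (c ∊?_) L) k (filter⁺ (c ∊?_) uL) (AllP.¬Any⇒All¬ X c∉X ∷ uX)
            (trans (sym (+-suc (length X) k)) eq) (λ m → with-c (∈-filter⁻ (c ∊?_) {xs = L} m)))
          (edges≤ cs X (filter (λ e → ¬? (c ∊? e)) L) (suc k) (filter⁺ (λ e → ¬? (c ∊? e)) uL) uX eq
            (λ m → without-c (∈-filter⁻ (λ e → ¬? (c ∊? e)) {xs = L} m)))))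
      where
      with-c : ∀ {e} → e ∈ L × c ∊ e → Between (c ∷ X) cs e
      with-c {e} (m , c∊) = (λ { (here refl) → c∊ ; (there h) → proj₁ (f m) h }) , λ w∊ → shift (proj₂ (f m) w∊)
        where
        shift : ∀ {w} → w ∈ X ⊎ w ∈ c ∷ cs → w ∈ c ∷ X ⊎ w ∈ cs
        shift (inj₁ h) = inj₁ (there h)
        shift (inj₂ (here refl)) = inj₁ (here refl)
        shift (inj₂ (there h)) = inj₂ h
      without-c : ∀ {e} → e ∈ L × ¬ (c ∊ e) → Between X cs e
      without-c {e} (m , c∌) = proj₁ (f m) , λ w∊ → shift w∊ (proj₂ (f m) w∊)
        where
        shift : ∀ {w} → w ∊ e → w ∈ X ⊎ w ∈ c ∷ cs → w ∈ X ⊎ w ∈ cs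
        shift _ (inj₁ h) = inj₁ h
        shift w∊ (inj₂ (here refl)) = ⊥-elim (c∌ w∊)
        shift _ (inj₂ (there h)) = inj₂ h

  module _ {Q : E → Set} (Q? : ∀ e → Dec (Q e)) {I : ℕ → Set} (I? : ∀ i → Dec (I i)) (q : ℕ) (g : ℕ → V) where

    private
      cs : List V
      cs = map g (filter I? (upTo q))

      ∈cs : ∀ {i} → i < q → I i → g i ∈ cs
      ∈cs i< h = ∈-map⁺ g (∈-filter⁺ I? (∈-upTo⁺ i<) h)

      len : ∀ k → length cs choose k ≡ cnt I? (upTo q) choose k
      len k = cong (_choose k) (trans (length-map g (filter I? (upTo q))) (sym (cnt≡ I? (upTo q))))

    edges-at≤ : ∀ k → r ≡ suc k → (u : V) → (∀ {e} → Q e → u ∊ e) →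
      (∀ {e w} → Q e → w ∊ e → w ≡ u ⊎ ∃ λ i → i < q × I i × w ≡ g i) →
      cnt Q? (allFin M) ≤ cnt I? (upTo q) choose k
    edges-at≤ k eq u u∊ inside = ≤-trans (≤-reflexive (cnt≡ Q? (allFin M))) (≤-trans
      (edges≤ cs (u ∷ []) (filter Q? (allFin M)) k (filter⁺ Q? (allFin⁺ M)) ([] ∷ []) (sym eq)
        (λ m → let h = proj₂ (∈-filter⁻ Q? {xs = allFin M} m) in
          (λ { (here refl) → u∊ h }) , λ w∊ → conv (inside h w∊)))
      (≤-reflexive (len k)))
      where
      conv : ∀ {w} → w ≡ u ⊎ (∃ λ i → i < q × I i × w ≡ g i) → w ∈ u ∷ [] ⊎ w ∈ cs
      conv (inj₁ refl) = inj₁ (here refl)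
      conv (inj₂ (i , i< , h , refl)) = inj₂ (∈cs i< h)

  -- Berge paths v_0 e_0 v_1 … e_{p-1} v_p

  record Path (p : ℕ) : Set where
    field
      v : ℕ → V
      e : ℕ → E
      v-inj : ∀ {i j} → i ≤ p → j ≤ p → v i ≡ v j → i ≡ j
      e-inj : ∀ {i j} → i < p → j < p → e i ≡ e j → i ≡ j
      inl : ∀ {i} → i < p → v i ∊ e i
      inr : ∀ {i} → i < p → v (suc i) ∊ e i

  open Path public

  Used : ∀ {p} → Path p → E → Set
  Used {p} P h = ∃ λ k → k < p × h ≡ e P k

  Unused : ∀ {p} → Path p → E → Set
  Unused P h = ¬ Used P h

  unused? : ∀ {p} (P : Path p) h → Dec (Unused P h)
  unused? {p} P h = ¬? (anyUpTo? (λ k → h ≟ᶠ e P k) p)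

  Free : ∀ {p} → Path p → ℕ → E → Set
  Free {p} P i h = ∀ {k} → k < p → k ≢ i → h ≢ e P k

  unused⇒free : ∀ {p} (P : Path p) {i h} → Unused P h → Free P i h
  unused⇒free P u k< _ eq = u (_ , k< , eq)

  own-free : ∀ {p} (P : Path p) {i} → i < p → Free P i (e P i)
  own-free P i< k< ne eq = ne (sym (e-inj P i< k< eq))

  path<n : ∀ {p} → Path p → p < n
  path<n {p} P = ≮⇒≥ λ n≤p → case (pigeonhole (s≤s (s≤s⁻¹ n≤p)) (λ (i : Fin (suc p)) → v P (Data.Fin.toℕ i)))
    where
    import Data.Fin
    open import Data.Fin.Properties using (toℕ<n; toℕ-injective)
    case : (∃ λ i → ∃ λ j → i Data.Fin.< j × v P (Data.Fin.toℕ i) ≡ v P (Data.Fin.toℕ j)) → ⊥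
    case (i , j , lt , eq) = <⇒≢ lt (v-inj P (s≤s⁻¹ (toℕ<n i)) (s≤s⁻¹ (toℕ<n j)) eq)

  module _ {p : ℕ} (P : Path p) where

    reverse : Path p
    reverse .v k = v P (p ∸ k)
    reverse .e k = e P (p ∸ suc k)
    reverse .v-inj {i} {j} a b eq = ∸-cancelˡ-≡ a b (v-inj P (m∸n≤m p i) (m∸n≤m p j) eq)
    reverse .e-inj a b eq = suc-injective (∸-cancelˡ-≡ a b (e-inj P (∸-< a) (∸-< b) eq))
      where
      ∸-< : ∀ {i} → i < p → p ∸ suc i < p
      ∸-< {i} h = ∸-monoʳ-< (s≤s z≤n) h
    reverse .inl {i} h = subst (λ k → v P k ∊ e P (p ∸ suc i)) (suc-∸ h) (inr P (∸-monoʳ-< (s≤s z≤n) h))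
      where
      suc-∸ : ∀ {i p} → i < p → suc (p ∸ suc i) ≡ p ∸ i
      suc-∸ {zero} {suc p} _ = refl
      suc-∸ {suc i} {suc p} (s≤s h) = suc-∸ h
    reverse .inr {i} h = inl P (∸-monoʳ-< (s≤s z≤n) h)

    -- Positions are related by sums such as a + b ≡ p, which `lia` can handle, in place of
    -- truncated subtraction.
    reverse-v : ∀ {a b} → a + b ≡ p → v reverse a ≡ v P b
    reverse-v {a} {b} eq = cong (v P) (trans (cong (_∸ a) (sym eq)) (m+n∸m≡n a b))

    reverse-e : ∀ {a b} → suc (a + b) ≡ p → e reverse a ≡ e P b
    reverse-e {a} {b} eq = cong (e P) (trans (cong (_∸ suc a) (sym eq)) (m+n∸m≡n a b))

    reverse-unused : ∀ {h} → Unused P h → Unused reverse h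
    reverse-unused u (k , k< , eq) = u (p ∸ suc k , ∸-monoʳ-< (s≤s z≤n) k< , eq)

    unused-reverse : ∀ {h} → Unused reverse h → Unused P h
    unused-reverse u (k , k< , eq) with <-split k<
    ... | b , eq′ = u (b , subst (suc b ≤_) eq′ (s≤s (m≤n+m b k)) , trans eq (sym (reverse-e (trans (cong suc (+-comm b k)) eq′))))

    replace : (j : ℕ) (f : E) → v P j ∊ f → v P (suc j) ∊ f → Free P j f → Path p
    replace j f a b fr = record
      { v = v P ; e = e′ ; v-inj = v-inj P ; e-inj = inj ; inl = il ; inr = ir }
      where
      e′ : ℕ → E
      e′ k with k ≟ j
      ... | yes _ = f
      ... | no _ = e P k
      inj : ∀ {k l} → k < p → l < p → e′ k ≡ e′ l → k ≡ l
      inj {k} {l} k< l< eq with k ≟ j | l ≟ j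
      ... | yes refl | yes refl = refl
      ... | yes refl | no ne = ⊥-elim (fr l< ne eq)
      ... | no ne | yes refl = ⊥-elim (fr k< ne (sym eq))
      ... | no _ | no _ = e-inj P k< l< eq
      il : ∀ {k} → k < p → v P k ∊ e′ k
      il {k} k< with k ≟ j
      ... | yes refl = a
      ... | no _ = inl P k<
      ir : ∀ {k} → k < p → v P (suc k) ∊ e′ k
      ir {k} k< with k ≟ j
      ... | yes refl = b
      ... | no _ = inr P k<

    module _ {j f} (a : v P j ∊ f) (b : v P (suc j) ∊ f) (fr : Free P j f) where

      replace-e : ∀ {k} → k ≢ j → e (replace j f a b fr) k ≡ e P k
      replace-e {k} ne with k ≟ j
      ... | yes eq = ⊥-elim (ne eq)
      ... | no _ = refl

      replace-unused : ∀ {h} → Unused P h → h ≢ f → Unused (replace j f a b fr) h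
      replace-unused {h} u ne (k , k< , eq) with k ≟ j
      ... | yes refl = ne eq
      ... | no _ = u (k , k< , eq)

      replace-unused-mid : j < p → e P j ≢ f → Unused (replace j f a b fr) (e P j)
      replace-unused-mid j< ne (k , k< , eq) with k ≟ j
      ... | yes refl = ne eq
      ... | no k≢ = k≢ (sym (e-inj P j< k< eq))

    re : ℕ → E → ℕ → E
    re i ε k with <-cmp k i
    ... | tri< _ _ _ = e P (i ∸ suc k)
    ... | tri≈ _ _ _ = ε
    ... | tri> _ _ _ = e P k

    re-lo : ∀ {i ε a b} → suc (a + b) ≡ i → re i ε a ≡ e P b
    re-lo {i} {ε} {a} {b} eq with <-cmp a i
    ... | tri< _ _ _ = cong (e P) (trans (cong (_∸ suc a) (sym eq)) (m+n∸m≡n a b))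
    ... | tri≈ ne _ _ = ⊥-elim (ne (subst (a <_) eq (s≤s (m≤m+n a b))))
    ... | tri> ne _ _ = ⊥-elim (ne (subst (a <_) eq (s≤s (m≤m+n a b))))

    re-mid : ∀ {i ε} → re i ε i ≡ ε
    re-mid {i} with <-cmp i i
    ... | tri< _ ne _ = ⊥-elim (ne refl)
    ... | tri≈ _ _ _ = refl
    ... | tri> _ ne _ = ⊥-elim (ne refl)

    re-hi : ∀ {i ε k} → i < k → re i ε k ≡ e P k
    re-hi {i} {ε} {k} h with <-cmp k i
    ... | tri< _ _ ne = ⊥-elim (ne h)
    ... | tri≈ _ _ ne = ⊥-elim (ne h)
    ... | tri> _ _ _ = refl

    -- The rotation v_i … v_0 ε v_{i+1} … v_p.
    module _ {i : ℕ} (i< : i < p) (ε : E) (x∊ : v P 0 ∊ ε) (s∊ : v P (suc i) ∊ ε) (fr : Free P i ε) where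

      private
        v′ : ℕ → V
        v′ k = v P (flip i k)

        lo< : ∀ {k} → k < i → i ∸ suc k < p
        lo< {k} k< = <-trans (∸-monoʳ-< (s≤s z≤n) k<) i<

        lo≢ : ∀ {k} → k < i → i ∸ suc k ≢ i
        lo≢ {k} k< = <⇒≢ (∸-monoʳ-< (s≤s z≤n) k<)

        einj : ∀ {k l} → k < p → l < p → re i ε k ≡ re i ε l → k ≡ l
        einj {k} {l} k< l< eq with <-cmp k i | <-cmp l i
        ... | tri< a _ _ | tri< b _ _ = suc-injective (∸-cancelˡ-≡ a b (e-inj P (lo< a) (lo< b) eq))
        ... | tri< a _ _ | tri≈ _ refl _ = ⊥-elim (fr (lo< a) (lo≢ a) (sym eq))
        ... | tri< a _ _ | tri> _ _ b = ⊥-elim (<⇒≢ (<-trans (∸-monoʳ-< (s≤s z≤n) a) b) (e-inj P (lo< a) l< eq))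
        ... | tri≈ _ refl _ | tri< b _ _ = ⊥-elim (fr (lo< b) (lo≢ b) eq)
        ... | tri≈ _ refl _ | tri≈ _ refl _ = refl
        ... | tri≈ _ refl _ | tri> _ ne _ = ⊥-elim (fr l< ne eq)
        ... | tri> _ _ a | tri< b _ _ = ⊥-elim (<⇒≢ (<-trans (∸-monoʳ-< (s≤s z≤n) b) a) (sym (e-inj P k< (lo< b) eq)))
        ... | tri> _ ne _ | tri≈ _ refl _ = ⊥-elim (fr k< ne (sym eq))
        ... | tri> _ _ _ | tri> _ _ _ = e-inj P k< l< eq

        il : ∀ {k} → k < p → v′ k ∊ re i ε k
        il {k} k< with <-cmp k i
        ... | tri< a _ _ with <-split a
        ... | b , eq rewrite flip-lo {i} {k} {suc b} (trans (+-suc k b) eq)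
                           | trans (cong (_∸ suc k) (sym eq)) (m+n∸m≡n k b) =
              inr P (<-trans (subst (b <_) eq (s≤s (m≤n+m b k))) i<)
        il {k} k< | tri≈ _ refl _ rewrite flip-lo {k} {k} {0} (+-identityʳ k) = x∊
        il {k} k< | tri> _ _ a rewrite flip-hi a = inl P k<

        ir : ∀ {k} → k < p → v′ (suc k) ∊ re i ε k
        ir {k} k< with <-cmp k i
        ... | tri< a _ _ with <-split a
        ... | b , eq rewrite flip-lo {i} {suc k} {b} eq
                           | trans (cong (_∸ suc k) (sym eq)) (m+n∸m≡n k b) =
              inl P (<-trans (subst (b <_) eq (s≤s (m≤n+m b k))) i<)
        ir {k} k< | tri≈ _ refl _ rewrite flip-hi (n<1+n k) = s∊
        ir {k} k< | tri> _ _ a rewrite flip-hi {i} {suc k} (<-trans a (n<1+n k)) = inr P k<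

      rotate : Path p
      rotate .v = v′
      rotate .e = re i ε
      rotate .v-inj a b eq = flip-inj i (v-inj P (flip-≤ (<⇒≤ i<) a) (flip-≤ (<⇒≤ i<) b) eq)
      rotate .e-inj = einj
      rotate .inl = il
      rotate .inr = ir

      rotate-v-lo : ∀ {a b} → a + b ≡ i → v rotate a ≡ v P b
      rotate-v-lo eq = cong (v P) (flip-lo eq)

      rotate-v-hi : ∀ {k} → i < k → v rotate k ≡ v P k
      rotate-v-hi h = cong (v P) (flip-hi h)

      rotate-v-start : v rotate 0 ≡ v P i
      rotate-v-start = rotate-v-lo refl

      rotate-v-end : v rotate p ≡ v P p
      rotate-v-end = rotate-v-hi i<

      rotate-unused : ∀ {h} → Unused P h → h ≢ ε → Unused rotate h
      rotate-unused u ne (k , k< , eq) with <-cmp k i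
      ... | tri< a _ _ = u (i ∸ suc k , lo< a , eq)
      ... | tri≈ _ _ _ = ne eq
      ... | tri> _ _ a = u (k , k< , eq)

      rotate-unused-free : ∀ {h} → Free P i h → h ≢ ε → Unused rotate h
      rotate-unused-free fr′ ne (k , k< , eq) with <-cmp k i
      ... | tri< a _ _ = fr′ (lo< a) (lo≢ a) eq
      ... | tri≈ _ _ _ = ne eq
      ... | tri> _ k≢ a = fr′ k< k≢ eq

      rotate-unused-mid : e P i ≢ ε → Unused rotate (e P i)
      rotate-unused-mid ne (k , k< , eq) with <-cmp k i
      ... | tri< a _ _ = lo≢ a (sym (e-inj P i< (lo< a) eq))
      ... | tri≈ _ _ _ = ne eq
      ... | tri> _ k≢ a = k≢ (sym (e-inj P i< k< eq))

      unused-rotate : ∀ {h} → Unused rotate h → h ≢ e P i → Unused P h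
      unused-rotate {h} u ne (k , k< , eq) with <-cmp k i
      ... | tri≈ _ refl _ = ne eq
      ... | tri> _ _ a = u (k , k< , trans eq (sym (re-hi a)))
      ... | tri< a _ _ with <-split a
      ... | b , eq′ = u (b , <-trans (subst (b <_) eq′ (s≤s (m≤n+m b k))) i< ,
                         trans eq (sym (re-lo (trans (cong suc (+-comm b k)) eq′))))

      unused-rotate≢ : ∀ {h} → Unused rotate h → h ≢ ε
      unused-rotate≢ u eq = u (i , i< , trans eq (sym (re-mid {i})))

  tail : ∀ {p} → Path (suc p) → Path p
  tail P .v k = v P (suc k)
  tail P .e k = e P (suc k)
  tail P .v-inj a b eq = suc-injective (v-inj P (s≤s a) (s≤s b) eq)
  tail P .e-inj a b eq = suc-injective (e-inj P (s≤s a) (s≤s b) eq)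
  tail P .inl a = inl P (s≤s a)
  tail P .inr a = inr P (s≤s a)

  cons : ∀ {p} (P : Path p) (w : V) (h : E) → (∀ {k} → k ≤ p → w ≢ v P k) → Unused P h → w ∊ h → v P 0 ∊ h → Path (suc p)
  cons {p} P w h w∉ u w∊ x∊ = record
    { v = v′ ; e = e′ ; v-inj = λ {i} {j} → vi {i} {j} ; e-inj = λ {i} {j} → ei {i} {j}
    ; inl = λ {i} → il {i} ; inr = λ {i} → ir {i} }
    where
    v′ : ℕ → V
    v′ zero = w
    v′ (suc k) = v P k
    e′ : ℕ → E
    e′ zero = h
    e′ (suc k) = e P k
    vi : ∀ {i j} → i ≤ suc p → j ≤ suc p → v′ i ≡ v′ j → i ≡ j
    vi {zero} {zero} _ _ _ = refl
    vi {zero} {suc j} _ (s≤s b) eq = ⊥-elim (w∉ b eq)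
    vi {suc i} {zero} (s≤s a) _ eq = ⊥-elim (w∉ a (sym eq))
    vi {suc i} {suc j} (s≤s a) (s≤s b) eq = cong suc (v-inj P a b eq)
    ei : ∀ {i j} → i < suc p → j < suc p → e′ i ≡ e′ j → i ≡ j
    ei {zero} {zero} _ _ _ = refl
    ei {zero} {suc j} _ (s≤s b) eq = ⊥-elim (u (j , b , eq))
    ei {suc i} {zero} (s≤s a) _ eq = ⊥-elim (u (i , a , sym eq))
    ei {suc i} {suc j} (s≤s a) (s≤s b) eq = cong suc (e-inj P a b eq)
    il : ∀ {i} → i < suc p → v′ i ∊ e′ i
    il {zero} _ = w∊
    il {suc i} (s≤s a) = inl P a
    ir : ∀ {i} → i < suc p → v′ (suc i) ∊ e′ i
    ir {zero} _ = x∊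
    ir {suc i} (s≤s a) = inr P a

  cons-unused : ∀ {p} (P : Path p) {w h} (a : ∀ {k} → k ≤ p → w ≢ v P k) (u : Unused P h) (w∊ : w ∊ h) (x∊ : v P 0 ∊ h) →
    ∀ {g} → Unused P g → g ≢ h → Unused (cons P w h a u w∊ x∊) g
  cons-unused P a u w∊ x∊ ug ne (zero , _ , eq) = ne eq
  cons-unused P a u w∊ x∊ ug ne (suc k , s≤s k< , eq) = ug (k , k< , eq)

  -- The path v_{j+1} … v_p g v_j … v_0.
  module _ {p : ℕ} (P : Path p) {j} (j< : j < p) (g : E) (y∊ : v P p ∊ g) (j∊ : v P j ∊ g) (fr : Free P j g) where

    private
      -- The index of e_j in the reversed path, which is rotated there along g.
      k₀ = proj₁ (<-split j<)
      k₀+j : suc (j + k₀) ≡ p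
      k₀+j = proj₂ (<-split j<)
      j+k₀ : suc (k₀ + j) ≡ p
      j+k₀ = trans (cong suc (+-comm k₀ j)) k₀+j
      k₀< : k₀ < p
      k₀< = subst (k₀ <_) k₀+j (s≤s (m≤n+m k₀ j))
      R = reverse P
      x∊′ : v R 0 ∊ g
      x∊′ = subst (_∊ g) (sym (reverse-v P refl)) y∊
      s∊′ : v R (suc k₀) ∊ g
      s∊′ = subst (_∊ g) (sym (reverse-v P j+k₀)) j∊
      frR : Free R k₀ g
      frR {k} k< k≢ eq with <-split k<
      ... | b , eq′ = fr (subst (b <_) eq′ (s≤s (m≤n+m b k))) b≢ (trans eq (reverse-e P eq′))
        where
        b≢ : b ≢ j
        b≢ refl = k≢ (+-cancelʳ-≡ j k k₀ (suc-injective (trans eq′ (sym j+k₀))))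

    turn : Path p
    turn = rotate R k₀< g x∊′ s∊′ frR

    turn-v : ∀ {k} → suc (j + k) ≤ p → v turn k ≡ v P (suc (j + k))
    turn-v {k} le with ≤-split le
    ... | b , eq = trans (rotate-v-lo R k₀< g x∊′ s∊′ frR {k} {b} eq′)
                         (reverse-v P (trans (+-comm b (suc (j + k))) eq))
      where
      eq′ : k + b ≡ k₀
      eq′ = lia (j ∷ k ∷ b ∷ k₀ ∷ p ∷ []) (λ j k b k₀ p → σ (j ⊕ k) ⊕ b ≈ p ⇒ σ (j ⊕ k₀) ≈ p ⇒ k ⊕ b ≈ k₀) refl eq k₀+j

    turn-e : ∀ {k} → suc (suc (j + k)) ≤ p → e turn k ≡ e P (suc (j + k))
    turn-e {k} le with ≤-split le
    ... | b , eq = trans (re-lo R {k₀} {g} {k} {b} eq′)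
                         (reverse-e P (trans (+-comm (suc b) (suc (j + k))) (trans (+-suc (suc (j + k)) b) eq)))
      where
      eq′ : suc (k + b) ≡ k₀
      eq′ = lia (j ∷ k ∷ b ∷ k₀ ∷ p ∷ []) (λ j k b k₀ p → σ (σ (j ⊕ k)) ⊕ b ≈ p ⇒ σ (j ⊕ k₀) ≈ p ⇒ σ (k ⊕ b) ≈ k₀) refl eq k₀+j

    turn-start : v turn 0 ≡ v P (suc j)
    turn-start = trans (turn-v {0} (subst (λ k → suc k ≤ p) (sym (+-identityʳ j)) j<)) (cong (λ k → v P (suc k)) (+-identityʳ j))

    turn-end : v turn p ≡ v P 0
    turn-end = trans (rotate-v-end R k₀< g x∊′ s∊′ frR) (reverse-v P (+-identityʳ p))

    turn-unused : ∀ {h} → Unused P h → h ≢ g → Unused turn h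
    turn-unused w ne = rotate-unused R k₀< g x∊′ s∊′ frR (reverse-unused P w) ne

    turn-free : e P j ≢ g → Unused turn (e P j)
    turn-free ne = subst (Unused turn) (reverse-e P j+k₀)
      (rotate-unused-mid R k₀< g x∊′ s∊′ frR λ eq → ne (trans (sym (reverse-e P j+k₀)) eq))

    turn-on : ∀ {w k} → k ≤ p → w ≡ v turn k → ∃ λ l → l ≤ p × w ≡ v P l
    turn-on {w} {k} k≤ eq = _ , m∸n≤m p (flip k₀ k) , eq

  -- The path v_0 ... v_k h u h′ v_{k+2} ... v_p, which releases the vertex v_{k+1} and the links
  -- e_k and e_{k+1}.
  module _ {p : ℕ} (P : Path p) {k} (k< : suc k < p) (u : V) (u∉ : ∀ {l} → l ≤ p → u ≢ v P l) {h h′ : E}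
           (uh : Unused P h) (uh′ : Unused P h′) (h≢h′ : h ≢ h′)
           (u∊h : u ∊ h) (u∊h′ : u ∊ h′) (k∊ : v P k ∊ h) (k∊′ : v P (suc (suc k)) ∊ h′) where

    private
      v′ : ℕ → V
      v′ l with l ≟ suc k
      ... | yes _ = u
      ... | no _ = v P l

      e′ : ℕ → E
      e′ l with l ≟ k | l ≟ suc k
      ... | yes _ | _ = h
      ... | no _ | yes _ = h′
      ... | no _ | no _ = e P l

      vi : ∀ {i j} → i ≤ p → j ≤ p → v′ i ≡ v′ j → i ≡ j
      vi {i} {j} i≤ j≤ eq with i ≟ suc k | j ≟ suc k
      ... | yes refl | yes refl = refl
      ... | yes refl | no _ = ⊥-elim (u∉ j≤ eq)
      ... | no _ | yes refl = ⊥-elim (u∉ i≤ (sym eq))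
      ... | no _ | no _ = v-inj P i≤ j≤ eq

      ei : ∀ {i j} → i < p → j < p → e′ i ≡ e′ j → i ≡ j
      ei {i} {j} i< j< eq with i ≟ k | i ≟ suc k | j ≟ k | j ≟ suc k
      ... | yes refl | _ | yes refl | _ = refl
      ... | yes refl | _ | no _ | yes refl = ⊥-elim (h≢h′ eq)
      ... | yes refl | _ | no _ | no _ = ⊥-elim (uh (j , j< , eq))
      ... | no _ | yes refl | yes refl | _ = ⊥-elim (h≢h′ (sym eq))
      ... | no _ | yes refl | no _ | yes refl = refl
      ... | no _ | yes refl | no _ | no _ = ⊥-elim (uh′ (j , j< , eq))
      ... | no _ | no _ | yes refl | _ = ⊥-elim (uh (i , i< , sym eq))
      ... | no _ | no _ | no _ | yes refl = ⊥-elim (uh′ (i , i< , sym eq))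
      ... | no _ | no _ | no _ | no _ = e-inj P i< j< eq

      il : ∀ {i} → i < p → v′ i ∊ e′ i
      il {i} i< with i ≟ suc k | i ≟ k
      ... | yes refl | yes ()
      ... | yes refl | no _ = u∊h′
      ... | no _ | yes refl = k∊
      ... | no _ | no _ = inl P i<

      ir : ∀ {i} → i < p → v′ (suc i) ∊ e′ i
      ir {i} i< with suc i ≟ suc k | i ≟ k | i ≟ suc k
      ... | yes refl | yes _ | _ = u∊h
      ... | yes refl | no ne | _ = ⊥-elim (ne refl)
      ... | no ne | yes refl | _ = ⊥-elim (ne refl)
      ... | no _ | no _ | yes refl = k∊′
      ... | no _ | no _ | no _ = inr P i<

    revertex : Path p
    revertex = record { v = v′ ; e = e′ ; v-inj = vi ; e-inj = ei ; inl = il ; inr = ir }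

    revertex-v : ∀ {l} → l ≢ suc k → v revertex l ≡ v P l
    revertex-v {l} ne with l ≟ suc k
    ... | yes eq = ⊥-elim (ne eq)
    ... | no _ = refl

    revertex-v-mid : v revertex (suc k) ≡ u
    revertex-v-mid with suc k ≟ suc k
    ... | yes eq = refl
    ... | no ne = ⊥-elim (ne refl)

    revertex-unused : ∀ {g} → (∀ {l} → l < p → l ≢ k → l ≢ suc k → g ≢ e P l) → g ≢ h → g ≢ h′ → Unused revertex g
    revertex-unused f n₁ n₂ (l , l< , eq) with l ≟ k | l ≟ suc k
    ... | yes _ | _ = n₁ eq
    ... | no _ | yes _ = n₂ eq
    ... | no a | no b = f l< a b eq

    unused-revertex : ∀ {g} → Unused revertex g → g ≢ h × g ≢ h′ × (∀ {l} → l < p → l ≢ k → l ≢ suc k → g ≢ e P l)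
    unused-revertex {g} ug = (λ eq → ug (k , <-trans (n<1+n k) k< , trans eq (sym at-k))) , (λ eq → ug (suc k , k< , trans eq (sym at-sk))) ,
        λ l< a b eq → ug (_ , l< , trans eq (sym (at-l a b)))
      where
      at-k : e′ k ≡ h
      at-k with k ≟ k
      ... | yes _ = refl
      ... | no ne = ⊥-elim (ne refl)
      at-sk : e′ (suc k) ≡ h′
      at-sk with suc k ≟ k | suc k ≟ suc k
      ... | yes () | _
      ... | no _ | yes _ = refl
      ... | no _ | no ne = ⊥-elim (ne refl)
      at-l : ∀ {l} → l ≢ k → l ≢ suc k → e′ l ≡ e P l
      at-l {l} a b with l ≟ k | l ≟ suc k
      ... | yes eq | _ = ⊥-elim (a eq)
      ... | no _ | yes eq = ⊥-elim (b eq)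
      ... | no _ | no _ = refl

  on-path? : ∀ {p} (P : Path p) w → Dec (∃ λ k → k < suc p × w ≡ v P k)
  on-path? {p} P w = anyUpTo? (λ k → w ≟ᶠ v P k) (suc p)

  #on-path≥ : ∀ {p} (P : Path p) → suc p ≤ cnt (on-path? P) (allFin n)
  #on-path≥ {p} P = ≤-trans (≤-reflexive (sym (trans (cnt-all (λ k → k <? suc p) (upTo (suc p)) ∈-upTo⁻) (length-upTo (suc p)))))
    (cnt-injection (λ k → k <? suc p) (on-path? P) (λ k x → k ≤ p × x ≡ v P k)
      (λ { (k≤ , refl) (l≤ , eq) → v-inj P k≤ l≤ eq }) (upTo⁺ (suc p))
      λ {k} m k< → v P k , ∈-allFin (v P k) , (k , k< , refl) , s≤s⁻¹ k< , refl)

  degree-split : ∀ {p} (P : Path p) u →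
    cnt (u ∊?_) (allFin M) ≤ cnt (λ h → unused? P h ×-dec (u ∊? h)) (allFin M) + cnt (λ i → u ∊? e P i) (upTo p)
  degree-split {p} P u = ≤-trans
    (cnt-cover (u ∊?_) (λ h → unused? P h ×-dec (u ∊? h)) (λ h → anyUpTo? (λ k → h ≟ᶠ e P k) p ×-dec (u ∊? h)) (allFin M) split)
    (+-monoʳ-≤ _ (cnt-injection (λ h → anyUpTo? (λ k → h ≟ᶠ e P k) p ×-dec (u ∊? h)) (λ i → u ∊? e P i)
      (λ h i → h ≡ e P i) (λ { refl refl → refl }) (allFin⁺ M)
      (λ { {h} _ ((k , k< , refl) , u∊) → k , ∈-upTo⁺ k< , u∊ , refl })))
    where
    split : ∀ {h} → h ∈ allFin M → u ∊ h → (Unused P h × u ∊ h) ⊎ (Used P h × u ∊ h)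
    split {h} _ u∊ with anyUpTo? (λ k → h ≟ᶠ e P k) p
    ... | yes us = inj₂ (us , u∊)
    ... | no un = inj₁ (un , u∊)

  take : ∀ {p} (P : Path p) {j} → j ≤ p → Path j
  take P j≤ .v = v P
  take P j≤ .e = e P
  take P j≤ .v-inj a b = v-inj P (≤-trans a j≤) (≤-trans b j≤)
  take P j≤ .e-inj a b = e-inj P (≤-trans a j≤) (≤-trans b j≤)
  take P j≤ .inl a = inl P (≤-trans a j≤)
  take P j≤ .inr a = inr P (≤-trans a j≤)

  take-unused : ∀ {p} (P : Path p) {j} (j≤ : j ≤ p) {h} → Unused P h → Unused (take P j≤) h
  take-unused P j≤ u (k , k< , eq) = u (k , ≤-trans k< j≤ , eq)

  take-unused-own : ∀ {p} (P : Path p) {j} (j< : j < p) → Unused (take P (<⇒≤ j<)) (e P j)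
  take-unused-own P j< (k , k< , eq) = <⇒≢ k< (sym (e-inj P j< (<-trans k< j<) eq))

  -- Conditions (a) and (b): longest paths without long cycles

  NoCycle≥ : ℕ → Set
  NoCycle≥ k = ∀ {p} → k ≤ suc p → (P : Path p) (h : E) → Unused P h → v P 0 ∊ h → v P p ∊ h → ⊥

  Initial : ∀ {p} → ℕ → Path p → V → Set
  Initial {p} s P w = ∃ λ j → j ≤ s × j ≤ p × w ≡ v P j

  module _ {s p : ℕ} (noCycle : NoCycle≥ (suc (suc s))) (longest : Path (suc p) → ⊥) where

    unused-initial : (P : Path p) {h : E} → Unused P h → v P 0 ∊ h → ∀ {w} → w ∊ h → Initial s P w
    unused-initial P {h} u x∊ {w} w∊ with on-path? P w
    ... | no off = ⊥-elim (longest (cons P w h (λ k≤ eq → off (_ , s≤s k≤ , eq)) u w∊ x∊))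
    ... | yes (j , s≤s j≤ , refl) with j ≤? s
    ... | yes j≤s = j , j≤s , j≤ , refl
    ... | no j≰s = ⊥-elim (noCycle (s≤s (≰⇒> j≰s)) (take P j≤) h (take-unused P j≤ u) x∊ w∊)

    own-link≤ : (P : Path p) → ∀ {i} → i < p → v P 0 ∊ e P i → i ≤ s
    own-link≤ P {i} i< x∊ = ≮⇒≥ λ s<i →
      noCycle (s≤s s<i) (take P (<⇒≤ i<)) (e P i) (take-unused-own P i<) x∊ (inl P i<)

  module SmallLength {κ p : ℕ} (1≤κ : 1 ≤ κ) (κ<r : suc κ ≤ r) (noCycle : NoCycle≥ (suc (suc κ)))
           (deg : ∀ u → degree≥ u (suc κ)) (longest : Path (suc p) → ⊥) where

    private
      initial-full : (P : Path p) {h : E} → (∀ {w} → w ∊ h → Initial κ P w) → ∀ {j} → j ≤ κ → v P j ∊ h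
      initial-full P {h} init {j} j≤ with v P j ∊? h
      ... | yes h∋ = h∋
      ... | no h∌ = ⊥-elim (<⇒≱ (cnt-≢ (s≤s j≤))
            (≤-trans κ<r (≤-trans (cover≥ h (map (v P) xs) covers) (≤-reflexive (trans (length-map (v P) xs) (sym (cnt≡ (λ i → ¬? (i ≟ j)) (upTo (suc κ)))))))))
        where
        xs = filter (λ i → ¬? (i ≟ j)) (upTo (suc κ))
        covers : ∀ w → w ∊ h → w ∈ map (v P) xs
        covers w w∊ with init w∊
        ... | i , i≤ , _ , refl =
          ∈-map⁺ (v P) (∈-filter⁺ (λ i → ¬? (i ≟ j)) (∈-upTo⁺ (s≤s i≤)) λ { refl → h∌ w∊ })

      no-unused : (P : Path p) {h : E} → Unused P h → v P 0 ∊ h → ⊥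
      no-unused P {h} u x∊ = u (0 , 0<p , sym (ext (e P 0) h λ w w∊ → e₀⊆ (unused-initial noCycle longest P′ un (inl P 0<p) w∊)))
        where
        init : ∀ {w} → w ∊ h → Initial κ P w
        init = unused-initial noCycle longest P u x∊
        full : ∀ {j} → j ≤ κ → v P j ∊ h
        full = initial-full P init
        0<p : 0 < p
        0<p with init (full 1≤κ)
        -- Here `v P 1` might be a value off the path, as p = 0 is not yet excluded; but h has at
        -- least κ + 1 ≥ 2 vertices, all among the p + 1 vertices of P.
        ... | zero , _ , _ , eq = s≤s⁻¹ (≤-trans (s≤s 1≤κ) (≤-trans κ<r (≤-trans (cover≥ h (map (v P) (upTo (suc p)))
                  (λ w w∊ → let (j , _ , j≤ , eq) = init w∊ in subst (_∈ _) (sym eq) (∈-map⁺ (v P) (∈-upTo⁺ (s≤s j≤)))))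
                  (≤-reflexive (trans (length-map (v P) (upTo (suc p))) (length-upTo (suc p)))))))
        ... | suc j , _ , j≤ , _ = ≤-trans (s≤s z≤n) j≤
        fr = unused⇒free P {0} u
        P′ = replace P 0 h x∊ (full 1≤κ) fr
        un : Unused P′ (e P 0)
        un = replace-unused-mid P x∊ (full 1≤κ) fr 0<p (λ eq → u (0 , 0<p , sym eq))
        e₀⊆ : ∀ {w} → Initial κ P′ w → w ∊ h
        e₀⊆ (j , j≤ , _ , refl) = full j≤

      -- The κ + 1 edges at v_0 are all links, and only e_0, ..., e_κ are possible.
      links-full : (P : Path p) → ∀ {i} → i ≤ κ → i < p × v P 0 ∊ e P i
      links-full P {i} i≤ = cnt-upTo-full (λ i → (i <? p) ×-dec (v P 0 ∊? e P i)) (suc κ)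
        (≤-trans (deg (v P 0)) (≤-trans (degree-split P (v P 0)) (≤-trans (≤-reflexive (cong (_+ _)
          (cnt-none (λ h → unused? P h ×-dec (v P 0 ∊? h)) (allFin M) λ _ (u , x∊) → no-unused P u x∊)))
          (cnt-injection (λ i → v P 0 ∊? e P i) (λ i → (i <? p) ×-dec (v P 0 ∊? e P i)) _≡_ (λ { refl refl → refl }) (upTo⁺ p)
            λ {i} m x∊ → i , ∈-upTo⁺ (s≤s (own-link≤ noCycle longest P (∈-upTo⁻ m) x∊)) , (∈-upTo⁻ m , x∊) , refl))))
        (s≤s i≤)

    -- The links e_0 and e_κ coincide. A vertex of e_0 can be made the start of a longest path with
    -- the same link κ, by a rotation along a link or, off the path, in place of v_0; it is on e_κ
    -- by `links-full`. A vertex beyond v_{κ+1} would close a cycle from v_1 on through e_0.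
    path-absurd : Path p → ⊥
    path-absurd P = <⇒≢ 1≤κ (e-inj P (proj₁ (links-full P z≤n)) κ<p (ext (e P 0) (e P κ) λ w w∊ → contained w w∊))
      where
      κ<p = proj₁ (links-full P ≤-refl)
      contained : ∀ w → w ∊ e P 0 → w ∊ e P κ
      contained w w∊ with on-path? P w
      contained w w∊ | yes (j , s≤s j≤p , refl) with <-cmp j (suc κ)
      ... | tri< (s≤s j≤) _ _ = subst₂ _∊_ (rotate-v-start P j< (e P j) x∊ (inr P j<) fr) (at-κ (m≤n⇒m<n∨m≡n j≤))
                                  (proj₂ (links-full (rotate P j< (e P j) x∊ (inr P j<) fr) ≤-refl))
        where
        j< = proj₁ (links-full P j≤)
        x∊ = proj₂ (links-full P j≤)
        fr = own-free P j<
        at-κ : j < κ ⊎ j ≡ κ → re P j (e P j) κ ≡ e P κ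
        at-κ (inj₁ lt) = re-hi P lt
        at-κ (inj₂ refl) = re-mid P {j}
      ... | tri≈ _ refl _ = inr P κ<p
      ... | tri> _ _ gt with j
      ... | suc j′ = ⊥-elim (noCycle gt (tail (take P j≤p)) (e P 0)
                       (λ { (k , k< , eq) → <⇒≢ (s≤s z≤n) (e-inj P (≤-trans (s≤s z≤n) j≤p) (≤-trans (s≤s k<) j≤p) eq) })
                       (inr P (≤-trans (s≤s z≤n) j≤p)) w∊)
      contained w w∊ | no off = go P off w∊ κ<p λ P′ → proj₂ (links-full P′ ≤-refl)
        where
        go : ∀ {q} (P : Path q) → ¬ (∃ λ k → k < suc q × w ≡ v P k) → w ∊ e P 0 → κ < q →
             (∀ (P′ : Path q) → v P′ 0 ∊ e P′ κ) → w ∊ e P κ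
        go {suc q} P off w∊ κ< f = go′ κ 1≤κ (f P′)
          where
          P′ = cons (tail P) w (e P 0) (λ k≤ eq → off (_ , s≤s (s≤s k≤) , eq))
                 (λ { (k , k< , eq) → <⇒≢ (s≤s z≤n) (e-inj P (s≤s z≤n) (s≤s k<) eq) }) w∊ (inr P (s≤s z≤n))
          go′ : ∀ κ → 1 ≤ κ → w ∊ e P′ κ → w ∊ e P κ
          go′ (suc κ) _ h = h

  module MediumLength {ρ s p : ℕ} (1≤ρ : 1 ≤ ρ) (r≡ : r ≡ suc (suc ρ)) (r≤s : suc ρ ≤ s)
           (noCycle : NoCycle≥ (suc (suc (suc s))))
           (deg : ∀ u → degree≥ u (suc (suc s choose suc ρ))) (longest : Path (suc p) → ⊥) where

    private
      -- k = s + 3, so S = k - 2, and confined edges lie in v_0, ..., v_S.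
      S = suc s

      Next : Path p → ℕ → Set
      Next P i = i < p × ∃ λ h → Unused P h × v P 0 ∊ h × v P (suc i) ∊ h

      next? : ∀ P i → Dec (Next P i)
      next? P i = (i <? p) ×-dec any? (λ h → unused? P h ×-dec ((v P 0 ∊? h) ×-dec (v P (suc i) ∊? h)))

      Own : Path p → ℕ → Set
      Own P i = i < p × v P 0 ∊ e P i

      own? : ∀ P i → Dec (Own P i)
      own? P i = (i <? p) ×-dec (v P 0 ∊? e P i)

      unused≤ : (P : Path p) → cnt (λ h → unused? P h ×-dec (v P 0 ∊? h)) (allFin M) ≤ cnt (next? P) (upTo S) choose suc ρ
      unused≤ P = edges-at≤ _ (next? P) S (λ i → v P (suc i)) (suc ρ) r≡ (v P 0) proj₂ inside
        where
        inside : ∀ {h w} → Unused P h × v P 0 ∊ h → w ∊ h → w ≡ v P 0 ⊎ ∃ λ i → i < S × Next P i × w ≡ v P (suc i)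
        inside {h} (u , x∊) w∊ with unused-initial noCycle longest P u x∊ w∊
        ... | zero , _ , _ , eq = inj₁ eq
        ... | suc i , i≤ , i< , refl = inj₂ (i , i≤ , (i< , h , u , x∊ , w∊) , refl)

      not-all-initial : (P : Path p) → (∀ {i} → Own P i → i < S) → (∀ {i} → Own P i → ∀ {w} → w ∊ e P i → Initial S P w) → ⊥
      not-all-initial P below init = <⇒≱ (deg (v P 0))
        (≤-trans (edges-at≤ (v P 0 ∊?_) (λ i → i <? S) S (λ i → v P (suc i)) (suc ρ) r≡ (v P 0) (λ h → h) inside)
                 (C-mono (suc ρ) (cnt-upTo≤ (λ i → i <? S) S)))
        where
        conv : ∀ {w} → Initial S P w → w ≡ v P 0 ⊎ ∃ λ i → i < S × i < S × w ≡ v P (suc i)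
        conv (zero , _ , _ , eq) = inj₁ eq
        conv (suc i , i≤ , _ , eq) = inj₂ (i , i≤ , i≤ , eq)
        inside : ∀ {h w} → v P 0 ∊ h → w ∊ h → w ≡ v P 0 ⊎ ∃ λ i → i < S × i < S × w ≡ v P (suc i)
        inside {h} x∊ w∊ with anyUpTo? (λ k → h ≟ᶠ e P k) p
        ... | no u = conv (unused-initial noCycle longest P u x∊ w∊)
        ... | yes (k , k< , refl) = conv (init (k< , x∊) w∊)

      next-initial : (P : Path p) → ∀ {i} → Next P i → ∀ {w} → w ∊ e P i → Initial S P w
      next-initial P {i} (i< , f , u , x∊ , s∊) {w} w∊ = conv (unused-initial noCycle longest P′
          (rotate-unused-mid P i< f x∊ s∊ fr ne)
          (subst (_∊ e P i) (sym (rotate-v-start P i< f x∊ s∊ fr)) (inl P i<)) w∊)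
        where
        fr = unused⇒free P {i} u
        ne : e P i ≢ f
        ne eq = u (i , i< , sym eq)
        P′ = rotate P i< f x∊ s∊ fr
        i≤S : i ≤ S
        i≤S with unused-initial noCycle longest P u x∊ s∊
        ... | j , j≤ , j≤p , eq = ≤-trans (n≤1+n i) (subst (_≤ S) (sym (v-inj P i< j≤p eq)) j≤)
        conv : ∀ {w} → Initial S P′ w → Initial S P w
        conv (j , j≤ , j≤p , eq) = flip i j , flip-≤ i≤S j≤ , flip-≤ (<⇒≤ i<) j≤p , eq

      next< : (P : Path p) → ∀ {i} → Next P i → i < S
      next< P (i< , f , u , x∊ , s∊) with unused-initial noCycle longest P u x∊ s∊
      ... | j , j≤ , j≤p , eq = subst (_≤ S) (sym (v-inj P i< j≤p eq)) j≤

      own-count : (P : Path p) {q : ℕ} → (∀ {i} → Own P i → i < q) →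
        suc (suc s choose suc ρ) ≤ cnt (next? P) (upTo S) choose suc ρ + cnt (own? P) (upTo q)
      own-count P {q} below = ≤-trans (deg (v P 0)) (≤-trans (degree-split P (v P 0)) (+-mono-≤ (unused≤ P)
        (cnt-injection (λ i → v P 0 ∊? e P i) (own? P) _≡_ (λ { refl refl → refl }) (upTo⁺ p)
          λ {i} m x∊ → i , ∈-upTo⁺ (below (∈-upTo⁻ m , x∊)) , (∈-upTo⁻ m , x∊) , refl)))

      few-next : ∀ {a d} → a ≤ s → suc (suc s choose suc ρ) ≤ a choose suc ρ + d → suc (s choose ρ) ≤ d
      few-next {a} {d} a≤ le = lia (s choose ρ ∷ s choose suc ρ ∷ a choose suc ρ ∷ d ∷ [])
        (λ x y z d → σ (x ⊕ y) ≼ z ⊕ d ⇒ z ≼ y ⇒ σ x ≼ d) refl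
        (subst (λ c → suc c ≤ a choose suc ρ + d) (pascal s ρ) le) (C-mono (suc ρ) a≤)

      s≤ : s ≤ s choose ρ
      s≤ = C≥n s ρ 1≤ρ r≤s

    -- Links at v_0 now have index below S, and `next-initial` confines those with index in `Next`.
    -- The count leaves at most one other index, and in that case v_0 is on all of e_0, ..., e_s;
    -- the exceptional link is then freed after one more change of the path. So every edge at v_0 is
    -- confined, which contradicts the degree.
    outside-absurd : (P : Path p) → (Own P S → ⊥) → ⊥
    outside-absurd P off = not-all-initial P below init
      where
      below : ∀ {i} → Own P i → i < S
      below (i< , x∊) with m≤n⇒m<n∨m≡n (own-link≤ noCycle longest P i< x∊)
      ... | inj₁ lt = lt
      ... | inj₂ refl = ⊥-elim (off (i< , x∊))
      a = cnt (next? P) (upTo S)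
      d = cnt (own? P) (upTo S)
      total : suc (suc s choose suc ρ) ≤ a choose suc ρ + d
      total = own-count P below
      own-all : a ≤ s → ∀ {i} → i < S → Own P i
      own-all a≤ = cnt-upTo-full (own? P) S (≤-trans (s≤s s≤) (few-next a≤ total))
      a≥s : s ≤ a
      a≥s = ≮⇒≥ (λ a<s → few a<s)
        where
        few : a < s → ⊥
        few a<s with <-split r≤s
        ... | b , eqs′ = lia (suc s′ choose ρ ∷ s′ choose ρ ∷ s′ choose suc ρ ∷ a choose suc ρ ∷ d ∷ s′ ∷ [])
          (λ x y z w d s → σ (x ⊕ (y ⊕ z)) ≼ w ⊕ d ⇒ w ≼ z ⇒ σ s ≼ x ⇒ con 1 ≼ y ⇒ d ≼ σ (σ s) ⇒ absurd) refl
          (subst (λ c → suc c ≤ a choose suc ρ + d) (trans (pascal (suc s′) ρ) (cong (suc s′ choose ρ +_) (pascal s′ ρ)))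
            (subst (λ s → suc (suc s choose suc ρ) ≤ a choose suc ρ + d) eqs total))
          (C-mono (suc ρ) (s≤s⁻¹ (subst (a <_) eqs a<s))) (subst (λ s → s ≤ s choose ρ) eqs s≤)
          (C-pos s′ ρ (s≤s⁻¹ (subst (suc ρ ≤_) eqs r≤s)))
          (subst (λ s → d ≤ suc s) eqs (cnt-upTo≤ (own? P) S))
          where
          s′ = ρ + b
          eqs : s ≡ suc s′
          eqs = sym eqs′
      init : ∀ {i} → Own P i → ∀ {w} → w ∊ e P i → Initial S P w
      init {i} own with next? P i
      ... | yes nx = next-initial P nx
      ... | no ¬nx = exceptional (m≤n⇒m<n∨m≡n (cnt-upTo≤ (next? P) S))
        where
        i< : i < S
        i< = below own
        exceptional : a < S ⊎ a ≡ S → ∀ {w} → w ∊ e P i → Initial S P w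
        exceptional (inj₂ eq) = ⊥-elim (¬nx (cnt-upTo-full (next? P) S (≤-reflexive (sym eq)) i<))
        exceptional (inj₁ (s≤s a≤)) {w} w∊ = by-case i refl
          where
          others : ∀ {j} → j < S → j ≢ i → Next P j
          others {j} j< j≢ = cnt-full (next? P) (λ k → ¬? (k ≟ i)) (upTo S) (λ { _ nx refl → ¬nx nx })
            (≤-trans (s≤s⁻¹ (cnt-≢ i<)) a≥s) (∈-upTo⁺ j<) j≢
          1<S : 1 < S
          1<S = s≤s (≤-trans (s≤s z≤n) r≤s)
          by-case : ∀ k → i ≡ k → Initial S P w
          -- Rotate at 1. The freed e_1 contains v_1 and v_0, the first two vertices of the new
          -- path, so 0 becomes an index in `Next`.
          by-case zero refl with others 1<S (λ ())
          ... | 1< , f , u , x∊ , s∊ = conv (next-initial P′ nx w∊)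
            where
            fr = unused⇒free P {1} u
            P′ = rotate P 1< f x∊ s∊ fr
            own₁ = own-all a≤ 1<S
            nx : Next P′ 0
            nx = <-trans (s≤s z≤n) 1< , e P 1 , rotate-unused-mid P 1< f x∊ s∊ fr (λ eq → u (1 , 1< , sym eq)) ,
                 subst (λ k → v P k ∊ e P 1) (sym (flip-lo {1} {0} refl)) (inl P 1<) ,
                 subst (λ k → v P k ∊ e P 1) (sym (flip-lo {1} {1} refl)) (proj₂ own₁)
            conv : ∀ {w} → Initial S P′ w → Initial S P w
            conv (j , j≤ , j≤p , eq) = flip 1 j , flip-≤ (<⇒≤ 1<S) j≤ , flip-≤ (<⇒≤ 1<) j≤p , eq
          by-case (suc k) refl with others (s≤s z≤n) (λ ())
          ... | 0< , f , u , x∊ , s∊ = next-initial P′ nx (subst (w ∊_) (sym (replace-e P x∊ s∊ fr (λ ()))) w∊)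
            where
            fr = unused⇒free P {0} u
            P′ = replace P 0 f x∊ s∊ fr
            un : Unused P′ (e P 0)
            un = replace-unused-mid P x∊ s∊ fr 0< (λ eq → u (0 , 0< , sym eq))
            -- Otherwise e₀ would be one more edge inside the neighbourhood of the unused edges.
            e₀∋ : v P (suc i) ∊ e P 0
            e₀∋ with v P (suc i) ∊? e P 0
            ... | yes h = h
            ... | no h = ⊥-elim (<⇒≱ more (≤-trans bound (C-mono (suc ρ) a≤)))
              where
              Q? = λ h → (unused? P h ×-dec (v P 0 ∊? h)) ⊎-dec (h ≟ᶠ e P 0)
              bound : cnt Q? (allFin M) ≤ a choose suc ρ
              bound = edges-at≤ Q? (next? P) S (λ i → v P (suc i)) (suc ρ) r≡ (v P 0)
                        (λ { (inj₁ (_ , x∊)) → x∊ ; (inj₂ refl) → inl P 0< }) inside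
                where
                conv : ∀ {w} → w ∊ e P 0 → Initial S P w → w ≡ v P 0 ⊎ ∃ λ i → i < S × Next P i × w ≡ v P (suc i)
                conv w∊ (zero , _ , _ , eq) = inj₁ eq
                conv w∊ (suc j , j≤ , _ , refl) = inj₂ (j , j≤ , others j≤ (λ { refl → h w∊ }) , refl)
                inside : ∀ {h w} → (Unused P h × v P 0 ∊ h) ⊎ h ≡ e P 0 → w ∊ h →
                  w ≡ v P 0 ⊎ ∃ λ i → i < S × Next P i × w ≡ v P (suc i)
                inside {h} (inj₁ (u , x∊)) w∊ with unused-initial noCycle longest P u x∊ w∊
                ... | zero , _ , _ , eq = inj₁ eq
                ... | suc i , i≤ , i< , refl = inj₂ (i , i≤ , (i< , h , u , x∊ , w∊) , refl)
                inside (inj₂ refl) w∊ = conv w∊ (next-initial P (others (s≤s z≤n) (λ ())) w∊)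
              cF = cnt (λ h → unused? P h ×-dec (v P 0 ∊? h)) (allFin M)
              cF+1 : cF + cnt (λ h → h ≟ᶠ e P 0) (allFin M) ≤ cnt Q? (allFin M)
              cF+1 = cnt-disjoint (λ h → unused? P h ×-dec (v P 0 ∊? h)) (λ h → h ≟ᶠ e P 0) Q? (allFin M)
                       (λ _ → inj₁) (λ _ → inj₂) (λ { _ (u , _) refl → u (0 , 0< , refl) })
              enough : suc (suc s choose suc ρ) ≤ cF + d
              enough = ≤-trans (deg (v P 0)) (≤-trans (degree-split P (v P 0)) (+-monoʳ-≤ cF
                (cnt-injection (λ i → v P 0 ∊? e P i) (own? P) _≡_ (λ { refl refl → refl }) (upTo⁺ p)
                  λ {i} m x∊ → i , ∈-upTo⁺ (below (∈-upTo⁻ m , x∊)) , (∈-upTo⁻ m , x∊) , refl)))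
              more : s choose suc ρ < cnt Q? (allFin M)
              more = lia (s choose ρ ∷ s choose suc ρ ∷ cF ∷ cnt (λ h → h ≟ᶠ e P 0) (allFin M) ∷ cnt Q? (allFin M) ∷ d ∷ s ∷ [])
                (λ x y f o q d s → σ (x ⊕ y) ≼ f ⊕ d ⇒ s ≼ x ⇒ d ≼ σ s ⇒ con 1 ≼ o ⇒ f ⊕ o ≼ q ⇒ y ≺ q) refl
                (subst (λ c → suc c ≤ cF + d) (pascal s ρ) enough) s≤ (cnt-upTo≤ (own? P) S)
                (cnt≥1 (λ h → h ≟ᶠ e P 0) (∈-allFin (e P 0)) refl) cF+1
            nx : Next P′ (suc k)
            nx = proj₁ own , e P 0 , un , inl P 0< , e₀∋

    -- By `outside-absurd` every longest path has its start on its link S, and rotations up to S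
    -- keep e_S as that link. So e_S contains v_i for at least S indices i ≤ S, and v_{S+1} besides,
    -- which is more than r vertices.
    path-absurd : Path p → ⊥
    path-absurd P = outside-absurd P on-link
      where
      on-link : Own P S → ⊥
      on-link (S< , x∊S) = too-many
        where
        start∊ : ∀ {i ε} (i< : i < p) (x∊ : v P 0 ∊ ε) (s∊ : v P (suc i) ∊ ε) (fr : Free P i ε) →
          i ≤ S → (i ≡ S → ε ≡ e P S) → v P i ∊ e P S
        start∊ {i} {ε} i< x∊ s∊ fr i≤ mid with v P i ∊? e P S
        ... | yes h = h
        ... | no h = ⊥-elim (outside-absurd (rotate P i< ε x∊ s∊ fr) λ (_ , x∊′) →
                       h (subst₂ _∊_ (rotate-v-start P i< ε x∊ s∊ fr) (at-S (m≤n⇒m<n∨m≡n i≤)) x∊′))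
          where
          at-S : i < S ⊎ i ≡ S → re P i ε S ≡ e P S
          at-S (inj₁ lt) = re-hi P lt
          at-S (inj₂ refl) = trans (re-mid P {i}) (mid refl)
        crowd : {I : ℕ → Set} (I? : ∀ i → Dec (I i)) → (∀ {i} → i ≤ S → I i → v P i ∊ e P S) → suc s ≤ cnt I? (upTo (suc S)) → ⊥
        crowd {I} I? f many = <⇒≱ (s≤s (s≤s r≤s)) (≤-trans (≤-trans (s≤s many) extra) (≤-trans
            (indexed≤ (e P S) I⁺? (suc (suc S)) (v P) (λ i< j< _ _ → v-inj P (≤-trans (s≤s⁻¹ i<) S<) (≤-trans (s≤s⁻¹ j<) S<)) f′)
            (≤-reflexive r≡)))
          where
          I⁺ : ℕ → Set
          I⁺ i = (i < suc S × I i) ⊎ i ≡ suc S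
          I⁺? : ∀ i → Dec (I⁺ i)
          I⁺? i = ((i <? suc S) ×-dec I? i) ⊎-dec (i ≟ suc S)
          f′ : ∀ {i} → i < suc (suc S) → I⁺ i → v P i ∊ e P S
          f′ _ (inj₁ (i< , h)) = f (s≤s⁻¹ i<) h
          f′ _ (inj₂ refl) = inr P S<
          extra : suc (cnt I? (upTo (suc S))) ≤ cnt I⁺? (upTo (suc (suc S)))
          extra = ≤-trans (≤-reflexive (+-comm 1 _)) (≤-trans (+-mono-≤
            (cnt-injection I? (λ i → (i <? suc S) ×-dec I? i) _≡_ (λ { refl refl → refl }) (upTo⁺ (suc S))
              λ {i} m h → i , ∈-upTo⁺ (≤-trans (∈-upTo⁻ m) (n≤1+n _)) , (∈-upTo⁻ m , h) , refl)
            (cnt≥1 (λ i → i ≟ suc S) {upTo (suc (suc S))} (∈-upTo⁺ ≤-refl) refl))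
            (cnt-disjoint (λ i → (i <? suc S) ×-dec I? i) (λ i → i ≟ suc S) I⁺? (upTo (suc (suc S)))
              (λ _ → inj₁) (λ _ → inj₂) λ { _ (lt , _) refl → <-irrefl refl lt }))
        a = cnt (next? P) (upTo S)
        too-many : ⊥
        too-many with a ≤? s
        ... | yes a≤ = crowd (own? P) (λ i≤ (i< , x∊) → start∊ i< x∊ (inr P i<) (own-free P i<) i≤ (λ { refl → refl }))
                 (≤-trans (s≤s s≤) (few-next a≤ (own-count P (λ (i< , x∊) → s≤s (own-link≤ noCycle longest P i< x∊)))))
        ... | no a≰ = crowd (next? P) (λ {i} i≤ nx@(i< , f , u , x∊ , s∊) →
                   start∊ i< x∊ s∊ (unused⇒free P u) i≤ (λ { refl → ⊥-elim (<-irrefl refl (next< P nx)) }))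
                 (≤-trans (≰⇒> a≰) (cnt-injection (next? P) (next? P) _≡_ (λ { refl refl → refl }) (upTo⁺ S)
                    λ {i} m h → i , ∈-upTo⁺ (≤-trans (∈-upTo⁻ m) (n≤1+n _)) , h , refl))

  -- Longest paths whose vertices carry no cycle

  Nb : ∀ {p} → Path p → V → V → Set
  Nb P u w = ∃ λ h → Unused P h × u ∊ h × w ∊ h

  nb? : ∀ {p} (P : Path p) u w → Dec (Nb P u w)
  nb? P u w = any? (λ h → unused? P h ×-dec ((u ∊? h) ×-dec (w ∊? h)))

  module Closed {p : ℕ}
    (longest : Path (suc p) → ⊥)
    (noCycle : (P : Path p) (h : E) → Unused P h → v P 0 ∊ h → v P p ∊ h → ⊥) where

    -- Note the shift: A refers to v_{i+1} and A′ to v_i, so that i in both closes a cycle.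
    A A′ D D′ : Path p → ℕ → Set
    A P i = Nb P (v P 0) (v P (suc i))
    A′ P i = Nb P (v P p) (v P i)
    D P i = v P 0 ∊ e P i
    D′ P i = v P p ∊ e P i

    A? : ∀ P i → Dec (A P i)
    A? P i = nb? P (v P 0) (v P (suc i))
    A′? : ∀ P i → Dec (A′ P i)
    A′? P i = nb? P (v P p) (v P i)
    N? : ∀ P i → Dec (¬ A′ P i)
    N? P i = ¬? (A′? P i)
    D? : ∀ P i → Dec (D P i)
    D? P i = v P 0 ∊? e P i
    F? : ∀ (P : Path p) h → Dec (Unused P h × v P 0 ∊ h)
    F? P h = unused? P h ×-dec (v P 0 ∊? h)

    #A #A′ #N #D #F : Path p → ℕ
    #A P = cnt (A? P) (upTo p)
    #A′ P = cnt (A′? P) (upTo p)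
    #N P = cnt (N? P) (upTo p)
    #D P = cnt (D? P) (upTo p)
    #F P = cnt (F? P) (allFin M)

    -- The crossing of Dirac's argument, with the cycle v_i ... v_0 φ v_{i+1} ... v_p γ. Free edges
    -- are allowed, so that e_i can play the role of φ or of γ.
    close : (P : Path p) → ∀ {i φ γ} → i < p → v P 0 ∊ φ → v P (suc i) ∊ φ → Free P i φ →
      v P p ∊ γ → v P i ∊ γ → Free P i γ → φ ≢ γ → ⊥
    close P {i} {φ} {γ} i< x∊ s∊ frφ y∊ i∊ frγ ne = noCycle (rotate P i< φ x∊ s∊ frφ) γ
      (rotate-unused-free P i< φ x∊ s∊ frφ frγ (λ eq → ne (sym eq)))
      (subst (_∊ γ) (sym (rotate-v-start P i< φ x∊ s∊ frφ)) i∊)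
      (subst (_∊ γ) (sym (rotate-v-end P i< φ x∊ s∊ frφ)) y∊)

    A∩A′ : (P : Path p) → ∀ {i} → i < p → A P i → A′ P i → ⊥
    A∩A′ P i< (f , u , x∊ , s∊) (g , u′ , y∊ , i∊) =
      close P i< x∊ s∊ (unused⇒free P u) y∊ i∊ (unused⇒free P u′) λ { refl → noCycle P f u x∊ y∊ }

    D∩A′ : (P : Path p) → ∀ {i} → i < p → D P i → A′ P i → ⊥
    D∩A′ P i< x∊ (g , u , y∊ , i∊) =
      close P i< x∊ (inr P i<) (own-free P i<) y∊ i∊ (unused⇒free P u) λ eq → u (_ , i< , sym eq)

    A∩D′ : (P : Path p) → ∀ {i} → i < p → A P i → D′ P i → ⊥
    A∩D′ P i< (f , u , x∊ , s∊) y∊ =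
      close P i< x∊ s∊ (unused⇒free P u) y∊ (inl P i<) (own-free P i<) λ eq → u (_ , i< , eq)

    on-path : (P : Path p) {h : E} → Unused P h → v P 0 ∊ h → ∀ {w} → w ∊ h → ∃ λ j → j ≤ p × w ≡ v P j
    on-path P {h} u x∊ {w} w∊ with on-path? P w
    ... | no off = ⊥-elim (longest (cons P w h (λ k≤ eq → off (_ , s≤s k≤ , eq)) u w∊ x∊))
    ... | yes (j , s≤s j≤ , eq) = j , j≤ , eq

    #A≤#N : (P : Path p) → #A P ≤ #N P
    #A≤#N P = cnt-mono (A? P) (N? P) (upTo p) λ m a a′ → A∩A′ P (∈-upTo⁻ m) a a′

    #D≤#N : (P : Path p) → #D P ≤ #N P
    #D≤#N P = cnt-mono (D? P) (N? P) (upTo p) λ m a a′ → D∩A′ P (∈-upTo⁻ m) a a′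

    #N+#A′ : (P : Path p) → #A′ P + #N P ≡ p
    #N+#A′ P = trans (cnt-¬ (A′? P) (upTo p)) (length-upTo p)

    module _ (P : Path p) {i ε} (i< : i < p) (x∊ : v P 0 ∊ ε) (s∊ : v P (suc i) ∊ ε) (fr : Free P i ε)
             (keep : ∀ {g} → Unused P g → v P p ∊ g → g ≢ ε) where

      private P′ = rotate P i< ε x∊ s∊ fr

      A′-rotate : ∀ {b} → A′ P b → A′ P′ (flip i b)
      A′-rotate {b} (g , u , y∊ , b∊) = g , rotate-unused P i< ε x∊ s∊ fr u (keep u y∊) ,
        subst (_∊ g) (sym (rotate-v-end P i< ε x∊ s∊ fr)) y∊ ,
        subst (_∊ g) (sym (cong (v P) (flip-flip i b))) b∊

      #A′-rotate : #A′ P ≤ #A′ P′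
      #A′-rotate = cnt-injection (A′? P) (A′? P′) (λ b k → k ≡ flip i b) (λ { refl eq → flip-inj i eq }) (upTo⁺ p)
        λ {b} m h → flip i b , ∈-upTo⁺ (flip-< i< (∈-upTo⁻ m)) , A′-rotate h , refl

    rotateD : (P : Path p) → ∀ {i} → i < p → D P i → Path p
    rotateD P {i} i< x∊ = rotate P i< (e P i) x∊ (inr P i<) (own-free P i<)

    module _ (P : Path p) {i} (i< : i < p) (x∊ : D P i) where

      private P′ = rotateD P i< x∊

      rotateD-unused : ∀ {h} → Unused P h → Unused P′ h
      rotateD-unused {h} u = rotate-unused P i< (e P i) x∊ (inr P i<) (own-free P i<) u (λ eq → u (_ , i< , eq))

      unused-rotateD : ∀ {h} → Unused P′ h → Unused P h
      unused-rotateD {h} u = unused-rotate P i< (e P i) x∊ (inr P i<) (own-free P i<) u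
        (unused-rotate≢ P i< (e P i) x∊ (inr P i<) (own-free P i<) u)

      rotateD-A′ : ∀ {b} → A′ P b → A′ P′ (flip i b)
      rotateD-A′ = A′-rotate P i< x∊ (inr P i<) (own-free P i<) λ { u _ refl → u (_ , i< , refl) }

      A′-rotateD : ∀ {k} → A′ P′ k → A′ P (flip i k)
      A′-rotateD (g , u , y∊ , k∊) = g , unused-rotateD u ,
        subst (_∊ g) (rotate-v-end P i< (e P i) x∊ (inr P i<) (own-free P i<)) y∊ , k∊

      #A′-rotateD : #A′ P ≤ #A′ P′
      #A′-rotateD = #A′-rotate P i< x∊ (inr P i<) (own-free P i<) λ { u _ refl → u (_ , i< , refl) }

      rotateD-start : v P′ 0 ≡ v P i
      rotateD-start = rotate-v-start P i< (e P i) x∊ (inr P i<) (own-free P i<)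

      rotateD-e-≥ : ∀ {k} → i ≤ k → e P′ k ≡ e P k
      rotateD-e-≥ {k} i≤ with m≤n⇒m<n∨m≡n i≤
      ... | inj₁ lt = re-hi P lt
      ... | inj₂ refl = re-mid P {i}

    module _ (P : Path p) {i} (i< : i < p) (Ai : A P i) where

      private
        f = proj₁ Ai
        u = proj₁ (proj₂ Ai)
        x∊ = proj₁ (proj₂ (proj₂ Ai))
        s∊ = proj₂ (proj₂ (proj₂ Ai))
        fr = unused⇒free P {i} u

      rotateA : Path p
      rotateA = rotate P i< f x∊ s∊ fr

      rotateA-free : Unused rotateA (e P i)
      rotateA-free = rotate-unused-mid P i< f x∊ s∊ fr (λ eq → u (i , i< , sym eq))

      rotateA-start : v rotateA 0 ≡ v P i
      rotateA-start = rotate-v-start P i< f x∊ s∊ fr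

      rotateA-end : v rotateA p ≡ v P p
      rotateA-end = rotate-v-end P i< f x∊ s∊ fr

      rotateA-unused : ∀ {h} → Unused P h → h ≢ f → Unused rotateA h
      rotateA-unused = rotate-unused P i< f x∊ s∊ fr

      private
        keep : ∀ {g} → Unused P g → v P p ∊ g → g ≢ f
        keep _ y∊ refl = noCycle P f u x∊ y∊

      rotateA-A′ : ∀ {b} → A′ P b → A′ rotateA (flip i b)
      rotateA-A′ = A′-rotate P i< x∊ s∊ fr keep

      #A′-rotateA : #A′ P ≤ #A′ rotateA
      #A′-rotateA = #A′-rotate P i< x∊ s∊ fr keep

      start∊link : v rotateA 0 ∊ e P i
      start∊link = subst (_∊ e P i) (sym rotateA-start) (inl P i<)

      link-on-path : ∀ {w} → w ∊ e P i → ∃ λ j → j ≤ p × w ≡ v P j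
      link-on-path w∊ with on-path rotateA rotateA-free start∊link w∊
      ... | j , j≤ , eq = flip i j , flip-≤ (<⇒≤ i<) j≤ , eq

      link-above : ∀ {l} → suc i ≤ l → l < p → v P (suc l) ∊ e P i → A′ P l → ⊥
      link-above {l} i<l l< w∊ a′ = A∩A′ rotateA l<
        (e P i , rotateA-free , start∊link , subst (_∊ e P i) (sym (rotate-v-hi P i< f x∊ s∊ fr (s≤s (<⇒≤ i<l)))) w∊)
        (subst (A′ rotateA) (flip-hi i<l) (rotateA-A′ a′))

      link-below : ∀ {l} → l < i → v P l ∊ e P i → A′ P (suc l) → ⊥
      link-below {l} l<i w∊ a′ with <-split l<i
      ... | b , eq = A∩A′ rotateA (<-trans (subst (b <_) eq (s≤s (m≤n+m b l))) i<)
        (e P i , rotateA-free , start∊link ,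
          subst (_∊ e P i) (sym (rotate-v-lo P i< f x∊ s∊ fr (trans (cong suc (+-comm b l)) eq))) w∊)
        (subst (A′ rotateA) (flip-lo eq) (rotateA-A′ a′))

    -- The cycle v_0 … v_j g v_p … v_{i+2} e_{i+1} v_{j+1} … v_{i+1} f.
    link-inside : (P : Path p) → ∀ {i j} → suc i < p → A P i → j < i → v P (suc j) ∊ e P (suc i) → A′ P j → ⊥
    link-inside P {i} {j} i< (f , u , x∊ , s∊) j<i w∊ (g , u′ , y∊ , j∊) with <-split j<i
    ... | k , refl = D∩A′ (turn P j< g y∊ j∊ fr) k<
        (subst₂ _∊_ (sym (turn-start P j< g y∊ j∊ fr)) (sym (turn-e P j< g y∊ j∊ fr {suc k} (subst (λ m → suc (suc m) ≤ p) (sym (+-suc j k)) i<)))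
          (subst (λ m → v P (suc j) ∊ e P (suc m)) (sym (+-suc j k)) w∊))
        (f , turn-unused P j< g y∊ j∊ fr u (λ { refl → noCycle P f u x∊ y∊ }) , subst (_∊ f) (sym (turn-end P j< g y∊ j∊ fr)) x∊ ,
          subst (_∊ f) (sym (trans (turn-v P j< g y∊ j∊ fr {suc k} (subst (λ m → suc m ≤ p) (sym (+-suc j k)) (<⇒≤ i<))) (cong (λ m → v P (suc m)) (+-suc j k)))) s∊)
      where
      fr = unused⇒free P {j} u′
      j< : j < p
      j< = ≤-trans (s≤s (m≤m+n j k)) (≤-trans (n≤1+n _) (≤-trans (n≤1+n _) i<))
      k< : suc k < p
      k< = ≤-trans (s≤s (s≤s (m≤n+m k j))) (≤-trans (n≤1+n _) i<)

    module Degrees {ρ τ : ℕ} (1≤ρ : 1 ≤ ρ) (r≡ : r ≡ suc (suc ρ)) (ρ<τ : suc ρ ≤ τ)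
                   (deg : ∀ u → degree≥ u (suc (suc τ choose suc ρ))) where

      Inside : Path p → V → Set
      Inside P w = w ≡ v P 0 ⊎ ∃ λ i → i < p × A P i × w ≡ v P (suc i)

      inside? : ∀ P w → Dec (Inside P w)
      inside? P w = (w ≟ᶠ v P 0) ⊎-dec anyUpTo? (λ i → A? P i ×-dec (w ≟ᶠ v P (suc i))) p

      unused-inside : (P : Path p) → ∀ {h w} → Unused P h → v P 0 ∊ h → w ∊ h → Inside P w
      unused-inside P {h} u x∊ w∊ with on-path P u x∊ w∊
      ... | zero , _ , eq = inj₁ eq
      ... | suc i , i< , refl = inj₂ (i , i< , (h , u , x∊ , w∊) , refl)

      #F≤ : (P : Path p) → #F P ≤ #A P choose suc ρ
      #F≤ P = edges-at≤ (F? P) (A? P) p (λ i → v P (suc i)) (suc ρ) r≡ (v P 0) proj₂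
                (λ (u , x∊) w∊ → unused-inside P u x∊ w∊)

      total : (P : Path p) → suc (suc τ choose suc ρ) ≤ #F P + #D P
      total P = ≤-trans (deg (v P 0)) (degree-split P (v P 0))

      τ≤ : τ ≤ τ choose ρ
      τ≤ = C≥n τ ρ 1≤ρ ρ<τ

      few : (P : Path p) → #A P ≤ τ → suc (τ choose ρ) ≤ #D P
      few P a≤ = lia (τ choose ρ ∷ τ choose suc ρ ∷ #F P ∷ #D P ∷ [])
        (λ x y f d → σ (x ⊕ y) ≼ f ⊕ d ⇒ f ≼ y ⇒ σ x ≼ d) refl
        (subst (λ c → suc c ≤ #F P + #D P) (pascal τ ρ) (total P)) (≤-trans (#F≤ P) (C-mono (suc ρ) a≤))

      few-D : (P : Path p) → #A P ≤ τ → suc τ ≤ #D P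
      few-D P a≤ = ≤-trans (s≤s τ≤) (few P a≤)

      fewer-D : (P : Path p) → #A P < τ → suc (suc τ) ≤ #D P
      fewer-D P a< with <-split (≤-trans (s≤s z≤n) ρ<τ)
      ... | τ′ , refl = lia (suc τ′ choose ρ ∷ τ′ choose ρ ∷ τ′ choose suc ρ ∷ #F P ∷ #D P ∷ τ′ ∷ [])
        (λ x y z f d s → σ (x ⊕ (y ⊕ z)) ≼ f ⊕ d ⇒ f ≼ z ⇒ σ s ≼ x ⇒ con 1 ≼ y ⇒ σ (σ (σ s)) ≼ d) refl
        (subst (λ c → suc c ≤ #F P + #D P) (trans (pascal (suc τ′) ρ) (cong (suc τ′ choose ρ +_) (pascal τ′ ρ))) (total P))
        (≤-trans (#F≤ P) (C-mono (suc ρ) (s≤s⁻¹ a<))) τ≤ (C-pos τ′ ρ (s≤s⁻¹ ρ<τ))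

      -- All edges at v_0, links included, are counted inside one set. The conclusion is absurd once
      -- #A P ≤ t, which is how it is used.
      all-inside : (P : Path p) → (∀ {i} → i < p → D P i → ∀ {w} → w ∊ e P i → Inside P w) →
        suc (suc τ choose suc ρ) ≤ #A P choose suc ρ
      all-inside P f = ≤-trans (deg (v P 0)) (edges-at≤ (v P 0 ∊?_) (A? P) p (λ i → v P (suc i)) (suc ρ) r≡ (v P 0) (λ h → h) inside)
        where
        inside : ∀ {h w} → v P 0 ∊ h → w ∊ h → Inside P w
        inside {h} x∊ w∊ with anyUpTo? (λ k → h ≟ᶠ e P k) p
        ... | no u = unused-inside P u x∊ w∊
        ... | yes (k , k< , refl) = f k< x∊ w∊

      positive : Path p → 0 < p
      positive P = ≰⇒> λ p≤0 → <⇒≱ (s≤s z≤n)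
        (≤-trans (few-D P (≤-trans (cnt-upTo≤ (A? P) p) (≤-trans p≤0 z≤n))) (≤-trans (cnt-upTo≤ (D? P) p) p≤0))

      start-N : (P : Path p) → ¬ A′ P 0
      start-N P = D∩A′ P (positive P) (inl P (positive P))

      D-full : (P : Path p) → #N P ≤ #D P → ∀ {i} → i < p → ¬ A′ P i → D P i
      D-full P le i< = cnt-full (D? P) (N? P) (upTo p) (λ m x∊ a′ → D∩A′ P (∈-upTo⁻ m) x∊ a′) le (∈-upTo⁺ i<)

      A-full : (P : Path p) → #N P ≤ #A P → ∀ {i} → i < p → ¬ A′ P i → A P i
      A-full P le i< = cnt-full (A? P) (N? P) (upTo p) (λ m a a′ → A∩A′ P (∈-upTo⁻ m) a a′) le (∈-upTo⁺ i<)

      A′-stable : (P : Path p) → ∀ {i} → ¬ ¬ A′ P i → A′ P i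
      A′-stable P {i} = decidable-stable (A′? P i)

      -- Since j is the last index outside A′, the vertex v_{j+1} of e_j is not among those counted
      -- by #N.
      last-link : (P : Path p) {j : ℕ} → j < p → (∀ {k} → j < k → k < p → ¬ ¬ A′ P k) →
        (∀ {i} → i < p → ¬ A′ P i → v P i ∊ e P j) → suc (#N P) ≤ r
      last-link P {j} j< above all = ≤-trans extra
          (indexed≤ (e P j) I? (suc p) (v P) (λ i< j< _ _ → v-inj P (s≤s⁻¹ i<) (s≤s⁻¹ j<)) f)
        where
        I : ℕ → Set
        I i = (i < p × ¬ A′ P i) ⊎ i ≡ suc j
        I? : ∀ i → Dec (I i)
        I? i = ((i <? p) ×-dec N? P i) ⊎-dec (i ≟ suc j)
        f : ∀ {i} → i < suc p → I i → v P i ∊ e P j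
        f _ (inj₁ (i< , h)) = all i< h
        f _ (inj₂ refl) = inr P j<
        extra : suc (#N P) ≤ cnt I? (upTo (suc p))
        extra = ≤-trans (≤-reflexive (+-comm 1 _)) (≤-trans (+-mono-≤
          (cnt-injection (N? P) (λ i → (i <? p) ×-dec N? P i) _≡_ (λ { refl refl → refl }) (upTo⁺ p)
            λ {i} m h → i , ∈-upTo⁺ (≤-trans (∈-upTo⁻ m) (n≤1+n _)) , (∈-upTo⁻ m , h) , refl)
          (cnt≥1 (λ i → i ≟ suc j) {upTo (suc p)} (∈-upTo⁺ (s≤s j<)) refl))
          (cnt-disjoint (λ i → (i <? p) ×-dec N? P i) (λ i → i ≟ suc j) I? (upTo (suc p))
            (λ _ → inj₁) (λ _ → inj₂) λ { _ (lt , h) refl → above ≤-refl lt h }))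

      module FewFree where

        private
          -- Here A is the complement of A′, and each link e_i at v_0 is shown to lie in `Inside`.
          -- For a vertex v_{l+1} of e_i with l in A′, crossings leave only l < i with i - 1 in A′;
          -- then a rotation along e_i shows that v_i is on e_0, and `link-above` applies to e_0.
          full-start : (P : Path p) → #N P ≤ suc τ → suc τ ≤ #A P → ⊥
          full-start P N≤ a≥ = <⇒≱ (all-inside P contained) (C-mono (suc ρ) (≤-trans (#A≤#N P) N≤))
            where
            A-all : ∀ {i} → i < p → ¬ A′ P i → A P i
            A-all = A-full P (≤-trans N≤ a≥)
            contained : ∀ {i} → i < p → D P i → ∀ {w} → w ∊ e P i → Inside P w
            contained {i} i< x∊ {w} w∊ with inside? P w
            ... | yes h = h
            ... | no out with link-on-path P i< (A-all i< (D∩A′ P i< x∊)) w∊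
            ... | zero , _ , eq = ⊥-elim (out (inj₁ eq))
            ... | suc l , l< , refl = ⊥-elim (escape i refl)
              where
              Ai : A P i
              Ai = A-all i< (D∩A′ P i< x∊)
              A′l : A′ P l
              A′l = A′-stable P λ nl → out (inj₂ (l , l< , A-all l< nl , refl))
              l≱i : l ≤ i
              l≱i = ≮⇒≥ λ i<l → link-above P i< Ai i<l l< w∊ A′l
              l≢i : l ≢ i
              l≢i refl = out (inj₂ (l , l< , Ai , refl))
              l<i : l < i
              l<i = ≤∧≢⇒< l≱i l≢i
              escape : ∀ k → i ≡ k → ⊥
              escape zero refl = <⇒≱ l<i z≤n
              escape (suc i′) refl with A′? P i′
              ... | no ni with m≤n⇒m<n∨m≡n (s≤s⁻¹ l<i)
              ... | inj₁ lt = link-inside P i< (A-all i′< ni) lt w∊ A′l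
                where i′< = <-trans (n<1+n i′) i<
              ... | inj₂ refl = ni A′l
              escape (suc i′) refl | yes A′i = link-above P 0< (A-all 0< (start-N P)) 1≤i′ i′< zi∊e₀ A′i
                where
                0< = positive P
                i′< = <-trans (n<1+n i′) i<
                P₂ = rotateD P i< x∊
                1∉ : ¬ A′ P 1
                1∉ = link-below P i< Ai (s≤s z≤n) x∊
                1≤i′ : 1 ≤ i′
                1≤i′ = ≰⇒> λ { z≤n → start-N P A′i }
                Ni : ¬ A′ P₂ i
                Ni a′ = start-N P (subst (A′ P) (flip-lo (+-identityʳ i)) (A′-rotateD P i< x∊ a′))
                ¬Ai : ¬ A P₂ i
                ¬Ai (h , u , z∊ , s∊) = A∩A′ P₃ i′<
                    (e P i , replace-unused-mid P z∊′ s∊′ fr i< (λ eq → u′ (i , i< , sym eq)) , x∊ , inl P i<)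
                    (proj₁ A′i , replace-unused P z∊′ s∊′ fr (proj₁ (proj₂ A′i)) g≢h , proj₂ (proj₂ A′i))
                  where
                  u′ = unused-rotateD P i< x∊ u
                  z∊′ = subst (_∊ h) (rotateD-start P i< x∊) z∊
                  s∊′ = subst (_∊ h) (cong (v P) (flip-hi (n<1+n i))) s∊
                  fr = unused⇒free P {i} u′
                  P₃ = replace P i h z∊′ s∊′ fr
                  g≢h : proj₁ A′i ≢ h
                  g≢h refl = D∩A′ P i< x∊ (h , u′ , proj₁ (proj₂ (proj₂ A′i)) , z∊′)
                N₂≤ : #N P₂ ≤ suc τ
                N₂≤ = lia (#A′ P ∷ #N P ∷ #A′ P₂ ∷ #N P₂ ∷ p ∷ τ ∷ [])
                  (λ a b c d p t → a ⊕ b ≈ p ⇒ c ⊕ d ≈ p ⇒ a ≼ c ⇒ b ≼ σ t ⇒ d ≼ σ t) refl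
                  (#N+#A′ P) (#N+#A′ P₂) (#A′-rotateD P i< x∊) N≤
                a₂≤ : #A P₂ ≤ τ
                a₂≤ = s≤s⁻¹ (≤-trans (≰⇒> λ le → ¬Ai (A-full P₂ le i< Ni)) N₂≤)
                zi∊e₀ : v P i ∊ e P 0
                zi∊e₀ = subst₂ _∊_ (rotateD-start P i< x∊) (re-lo P (cong suc (+-identityʳ i′)))
                  (D-full P₂ (≤-trans N₂≤ (few-D P₂ a₂≤)) i′<
                    λ a′ → 1∉ (subst (A′ P) (flip-lo (+-comm i′ 1)) (A′-rotateD P i< x∊ a′)))

        -- By `full-start` only #A ≤ τ remains, and then v_0 is on every link with index in N. So
        -- each v_i with i in N is the start of a rotated path, to which the same applies; hence all
        -- these vertices are on the last link of N, which has only r ≤ t vertices.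
        few-free-absurd : (P : Path p) → #N P ≤ suc τ → ⊥
        few-free-absurd P N≤ with suc τ ≤? #A P
        ... | yes a≥ = full-start P N≤ a≥
        ... | no a≱ = rotate-away (max (N? P) p (positive P) (start-N P))
          where
          D-all : ∀ {i} → i < p → ¬ A′ P i → D P i
          D-all = D-full P (≤-trans N≤ (few-D P (s≤s⁻¹ (≰⇒> a≱))))
          N≥ : suc τ ≤ #N P
          N≥ = ≤-trans (few-D P (s≤s⁻¹ (≰⇒> a≱))) (#D≤#N P)
          rotate-away : (∃ λ j → j < p × ¬ A′ P j × (∀ {k} → j < k → k < p → ¬ ¬ A′ P k)) → ⊥
          rotate-away (j , j< , nj , above) = <⇒≱ (s≤s ρ<τ) (s≤s⁻¹ (≤-trans (s≤s N≥) (≤-trans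
              (last-link P j< above λ {i} i< ni → on-last i< ni) (≤-reflexive r≡))))
            where
            on-last : ∀ {i} → i < p → ¬ A′ P i → v P i ∊ e P j
            on-last {i} i< ni with v P i ∊? e P j
            ... | yes h = h
            ... | no h = ⊥-elim (full-start P₂ N₂≤ (≰⇒> λ a≤ → h (start∊ a≤)))
              where
              x∊ = D-all i< ni
              P₂ = rotateD P i< x∊
              i≤j : i ≤ j
              i≤j = ≮⇒≥ λ j<i → above j<i i< ni
              N₂≤ : #N P₂ ≤ suc τ
              N₂≤ = lia (#A′ P ∷ #N P ∷ #A′ P₂ ∷ #N P₂ ∷ p ∷ τ ∷ [])
                (λ a b c d p t → a ⊕ b ≈ p ⇒ c ⊕ d ≈ p ⇒ a ≼ c ⇒ b ≼ σ t ⇒ d ≼ σ t) refl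
                (#N+#A′ P) (#N+#A′ P₂) (#A′-rotateD P i< x∊) N≤
              Nj : ¬ A′ P₂ j
              Nj a′ with m≤n⇒m<n∨m≡n i≤j
              ... | inj₁ lt = nj (subst (A′ P) (flip-hi lt) (A′-rotateD P i< x∊ a′))
              ... | inj₂ refl = h (inl P i<)
              start∊ : #A P₂ ≤ τ → v P i ∊ e P j
              start∊ a≤ = subst₂ _∊_ (rotateD-start P i< x∊) (rotateD-e-≥ P i< x∊ i≤j)
                (D-full P₂ (≤-trans N₂≤ (few-D P₂ a≤)) j< Nj)

  -- Cycles and a vertex that they miss

  record Loop (q : ℕ) : Set where
    field
      Q : Path q
      φ : E
      z : V
      z∉ : ∀ {k} → k ≤ q → z ≢ v Q k
      uφ : Unused Q φ
      x∊ : v Q 0 ∊ φ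
      y∊ : v Q q ∊ φ

  open Loop

  w : ∀ {q} → Loop q → ℕ → V
  w L = v (Q L)

  abstract
    -- The closing edge counts as link q, so that 0, ..., q index the links of the cycle uniformly.
    link : ∀ {q} → Loop q → ℕ → E
    link {q} L k with k <? q
    ... | yes _ = e (Q L) k
    ... | no _ = φ L

    link-lo : ∀ {q} (L : Loop q) {k} → k < q → link L k ≡ e (Q L) k
    link-lo {q} L {k} h with k <? q
    ... | yes _ = refl
    ... | no g = ⊥-elim (g h)

    link-hi : ∀ {q} (L : Loop q) → link L q ≡ φ L
    link-hi {q} L with q <? q
    ... | yes h = ⊥-elim (<-irrefl refl h)
    ... | no _ = refl

  Star : ∀ {q} → Loop q → E → Set
  Star L h = z L ∊ h × Unused (Q L) h × h ≢ φ L

  star? : ∀ {q} (L : Loop q) h → Dec (Star L h)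
  star? L h = (z L ∊? h) ×-dec (unused? (Q L) h ×-dec ¬? (h ≟ᶠ φ L))

  -- The same cycle, cut one step later.
  module _ {q : ℕ} (L : Loop (suc q)) where

    private
      T = tail (Q L)
      R = reverse T
      R-v : ∀ {a b} → a + b ≡ q → v R a ≡ w L (suc b)
      R-v = reverse-v T
      uR : Unused R (φ L)
      uR = reverse-unused T λ { (k , k< , eq) → uφ L (suc k , s≤s k< , eq) }
      fresh : ∀ {k} → k ≤ q → w L 0 ≢ v R k
      fresh k≤ eq with ≤-split k≤
      ... | b , eq′ with v-inj (Q L) z≤n (s≤s (subst (b ≤_) eq′ (m≤n+m b _))) (trans eq (R-v eq′))
      ... | ()
      R′ = cons R (w L 0) (φ L) fresh uR (x∊ L) (subst (_∊ φ L) (sym (R-v refl)) (y∊ L))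
      Q′ = reverse R′

      Q′-v : ∀ {k} → k ≤ q → v Q′ k ≡ w L (suc k)
      Q′-v {k} k≤ with ≤-split k≤
      ... | b , eq = trans (reverse-v R′ {k} {suc b} (trans (+-suc k b) (cong suc eq))) (R-v (trans (+-comm b k) eq))

      Q′-v-last : v Q′ (suc q) ≡ w L 0
      Q′-v-last = reverse-v R′ {suc q} {0} (+-identityʳ (suc q))

      Q′-e : ∀ {k} → k < q → e Q′ k ≡ e (Q L) (suc k)
      Q′-e {k} k< with <-split k<
      ... | b , eq = trans (reverse-e R′ {k} {suc b} (cong suc (trans (+-suc k b) eq)))
                           (reverse-e T (trans (cong suc (+-comm b k)) eq))

      Q′-e-last : e Q′ q ≡ φ L
      Q′-e-last = reverse-e R′ {q} {0} (cong suc (+-identityʳ q))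

      Q′-unused : ∀ {h} → (∀ {k} → k < q → h ≢ e (Q L) (suc k)) → h ≢ φ L → Unused Q′ h
      Q′-unused f ne (k , k< , eq) with m≤n⇒m<n∨m≡n (s≤s⁻¹ k<)
      ... | inj₁ lt = f lt (trans eq (Q′-e lt))
      ... | inj₂ refl = ne (trans eq Q′-e-last)

    shift : Loop (suc q)
    shift .Q = Q′
    shift .φ = e (Q L) 0
    shift .z = z L
    shift .z∉ {k} k≤ eq with m≤n⇒m<n∨m≡n k≤
    ... | inj₁ lt = z∉ L lt (trans eq (Q′-v (s≤s⁻¹ lt)))
    ... | inj₂ refl = z∉ L z≤n (trans eq Q′-v-last)
    shift .uφ = Q′-unused (λ k< eq → 1+n≢0 (sym (e-inj (Q L) (s≤s z≤n) (s≤s k<) eq))) (λ eq → uφ L (0 , s≤s z≤n , sym eq))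
    shift .x∊ = subst (_∊ e (Q L) 0) (sym (Q′-v z≤n)) (inr (Q L) (s≤s z≤n))
    shift .y∊ = subst (_∊ e (Q L) 0) (sym Q′-v-last) (inl (Q L) (s≤s z≤n))

    shift-star : ∀ {h} → Star L h → Star shift h
    shift-star (z∊ , u , ne) = z∊ , Q′-unused (λ k< eq → u (_ , s≤s k< , eq)) ne , λ eq → u (0 , s≤s z≤n , eq)

    shift-v : ∀ {k} → k ≤ q → w shift k ≡ w L (suc k)
    shift-v = Q′-v

    shift-v-last : w shift (suc q) ≡ w L 0
    shift-v-last = Q′-v-last

    shift-e : ∀ {k} → k < q → e (Q shift) k ≡ e (Q L) (suc k)
    shift-e = Q′-e

  -- The cycle reopened at link k, with only what is needed to put z in that place: the two ends,
  -- the closing edge, and that star edges remain star edges.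
  record CutAt {q} (L : Loop q) (k : ℕ) : Set where
    field
      loop : Loop q
      same-z : z loop ≡ z L
      closing : φ loop ≡ link L k
      at-end : w loop q ≡ w L k
      at-start : w loop 0 ≡ w L (nxt q k)
      star : ∀ {h} → Star L h → Star loop h

  cut : ∀ {q} (L : Loop q) k → k ≤ q → CutAt L k
  cut {q} L k k≤ with m≤n⇒m<n∨m≡n k≤
  ... | inj₂ refl = record
    { loop = L ; same-z = refl ; closing = sym (link-hi L) ; at-end = refl
    ; at-start = cong (w L) (sym (nxt-hi q)) ; star = λ s → s }
  cut {suc q} L zero k≤ | inj₁ lt = record
    { loop = shift L ; same-z = refl ; closing = sym (link-lo L lt) ; at-end = shift-v-last L
    ; at-start = trans (shift-v L z≤n) (cong (w L) (sym (nxt-lo lt))) ; star = shift-star L }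
  cut {suc q} L (suc k) k≤ | inj₁ lt = record
    { loop = loop c ; same-z = same-z c
    ; closing = trans (closing c) (trans (link-lo (shift L) k<) (trans (shift-e L (s≤s⁻¹ lt)) (sym (link-lo L lt))))
    ; at-end = trans (at-end c) (shift-v L (<⇒≤ (s≤s⁻¹ lt)))
    ; at-start = trans (at-start c) (trans (cong (w (shift L)) (nxt-lo k<)) (trans (shift-v L (s≤s⁻¹ lt)) (cong (w L) (sym (nxt-lo lt)))))
    ; star = λ s → star c (shift-star L s) }
    where
    open CutAt
    k< : k < suc q
    k< = <⇒≤ lt
    c = cut (shift L) k (<⇒≤ k<)

  module NoLongerCycle {q : ℕ}
    (noCycle : (P : Path (suc q)) (h : E) → Unused P h → v P 0 ∊ h → v P (suc q) ∊ h → ⊥) where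

    private
      insert-closing : (L : Loop q) → ∀ {h h′} → z L ∊ h → z L ∊ h′ → Unused (Q L) h → Unused (Q L) h′ → h ≢ h′ →
        w L q ∊ h → w L 0 ∊ h′ → ⊥
      insert-closing L {h} {h′} z∊ z∊′ u u′ ne y∊ x∊ = noCycle (cons R (z L) h fresh uR z∊ R0∊) h′
          (cons-unused R fresh uR z∊ R0∊ (reverse-unused (Q L) u′) (λ eq → ne (sym eq))) z∊′
          (subst (_∊ h′) (sym (reverse-v (Q L) (+-identityʳ q))) x∊)
        where
        R = reverse (Q L)
        uR = reverse-unused (Q L) u
        R0∊ = subst (_∊ h) (sym (reverse-v (Q L) refl)) y∊
        fresh : ∀ {k} → k ≤ q → z L ≢ v R k
        fresh {k} k≤ eq = z∉ L (m∸n≤m q k) eq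

    -- Joining z to both ends of the cycle cut at link k gives a cycle with one vertex more. The cut
    -- releases link k, which may itself be one of the two edges.
    insert : (L : Loop q) → ∀ {k h h′} → k ≤ q → z L ∊ h → z L ∊ h′ → h ≢ h′ →
      Star L h ⊎ h ≡ link L k → Star L h′ ⊎ h′ ≡ link L k → w L k ∊ h → w L (nxt q k) ∊ h′ → ⊥
    insert L {k} {h} {h′} k≤ z∊ z∊′ ne s s′ k∊ k∊′ = insert-closing loop
        (subst (_∊ h) (sym same-z) z∊) (subst (_∊ h′) (sym same-z) z∊′) (un s) (un s′) ne
        (subst (_∊ h) (sym at-end) k∊) (subst (_∊ h′) (sym at-start) k∊′)
      where
      open CutAt (cut L k k≤)
      un : ∀ {h} → Star L h ⊎ h ≡ link L k → Unused (Q loop) h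
      un (inj₁ s) = proj₁ (proj₂ (star s))
      un (inj₂ eq) = subst (Unused (Q loop)) (trans closing (sym eq)) (uφ loop)

    module Counting {ρ τ : ℕ} (1≤ρ : 1 ≤ ρ) (r≡ : r ≡ suc (suc ρ)) (ρ<τ : suc ρ ≤ τ) (q≤ : q ≤ 2 * suc τ)
             (deg : ∀ u → degree≥ u (suc (suc τ choose suc ρ))) where

     module _ (L : Loop q) (inside : ∀ {h u} → Star L h → u ∊ h → u ≡ z L ⊎ ∃ λ k → k ≤ q × u ≡ w L k) where

      private
        c = suc q
        S = cnt (star? L) (allFin M)

      B : ℕ → Set
      B k = z L ∊ link L k

      b? : ∀ k → Dec (B k)
      b? k = z L ∊? link L k

      Nbr : ℕ → Set
      Nbr k = ∃ λ h → Star L h × w L k ∊ h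

      nbr? : ∀ k → Dec (Nbr k)
      nbr? k = any? λ h → star? L h ×-dec (w L k ∊? h)

      private
        b = cnt b? (upTo c)

        apart : ∀ {k h h′} → k ≤ q → Star L h → Star L h′ → w L k ∊ h → w L (nxt q k) ∊ h′ → h ≡ h′
        apart {k} {h} {h′} k≤ s s′ k∊ k∊′ with h ≟ᶠ h′
        ... | yes eq = eq
        ... | no ne = ⊥-elim (insert L k≤ (proj₁ s) (proj₁ s′) ne (inj₁ s) (inj₁ s′) k∊ k∊′)

        link-∊ : ∀ {k} → k ≤ q → w L k ∊ link L k
        link-∊ k≤ with m≤n⇒m<n∨m≡n k≤
        ... | inj₁ lt = subst (_ ∊_) (sym (link-lo L lt)) (inl (Q L) lt)
        ... | inj₂ refl = subst (_ ∊_) (sym (link-hi L)) (y∊ L)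

        link-∊′ : ∀ {k} → k ≤ q → w L (nxt q k) ∊ link L k
        link-∊′ {k} k≤ with m≤n⇒m<n∨m≡n k≤
        ... | inj₁ lt = subst₂ _∊_ (cong (w L) (sym (nxt-lo lt))) (sym (link-lo L lt)) (inr (Q L) lt)
        ... | inj₂ refl = subst₂ _∊_ (cong (w L) (sym (nxt-hi q))) (sym (link-hi L)) (x∊ L)

        star≢link : ∀ {k h} → k ≤ q → Star L h → h ≢ link L k
        star≢link k≤ (_ , u , ne) eq with m≤n⇒m<n∨m≡n k≤
        ... | inj₁ lt = u (_ , lt , trans eq (link-lo L lt))
        ... | inj₂ refl = ne (trans eq (link-hi L))

      touched-free : ∀ {k} → k ≤ q → Touch q Nbr k → ¬ B k
      touched-free k≤ (inj₁ (h , s , k∊)) z∊ =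
        insert L k≤ (proj₁ s) z∊ (star≢link k≤ s) (inj₁ s) (inj₂ refl) k∊ (link-∊′ k≤)
      touched-free k≤ (inj₂ (h , s , k∊)) z∊ =
        insert L k≤ z∊ (proj₁ s) (λ eq → star≢link k≤ s (sym eq)) (inj₂ refl) (inj₁ s) (link-∊ k≤) k∊

      private
        degree-z : suc (suc τ choose suc ρ) ≤ S + b
        degree-z = ≤-trans (deg (z L)) (≤-trans
          (cnt-cover (z L ∊?_) (star? L) (λ h → (z L ∊? h) ×-dec isLink? h) (allFin M) λ {h} _ z∊ → split h z∊)
          (+-monoʳ-≤ S (cnt-injection (λ h → (z L ∊? h) ×-dec isLink? h) b? (λ h k → h ≡ link L k) (λ { refl refl → refl }) (allFin⁺ M)
            λ { _ (z∊ , k , k< , refl) → k , ∈-upTo⁺ k< , z∊ , refl })))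
          where
          isLink? : ∀ h → Dec (∃ λ k → k < c × h ≡ link L k)
          isLink? h = anyUpTo? (λ k → h ≟ᶠ link L k) c
          split : ∀ h → z L ∊ h → Star L h ⊎ (z L ∊ h × ∃ λ k → k < c × h ≡ link L k)
          split h z∊ with isLink? h
          ... | yes l = inj₂ (z∊ , l)
          ... | no l = inj₁ (z∊ , (λ { (k , k< , eq) → l (k , ≤-trans k< (n≤1+n q) , trans eq (sym (link-lo L k<))) }) ,
                             λ eq → l (q , ≤-refl , trans eq (sym (link-hi L))))

        -- Apart from z, split the vertices of h and h′ into common ones and those of one edge only.
        -- The common ones touch two links each, either other class touches more links than it has
        -- members, and by `apart` the classes share no touched link; links containing z are touched
        -- by none.
        two : ∀ {h h′} → Star L h → Star L h′ → h ≢ h′ → 2 * r + b ≤ c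
        two {h} {h′} s s′ ne = lia (cnt I? (upTo c) ∷ cnt J₁? (upTo c) ∷ cnt J₂? (upTo c) ∷ cnt (touch? q I?) (upTo c) ∷
              cnt (touch? q J₁?) (upTo c) ∷ cnt (touch? q J₂?) (upTo c) ∷ cnt T₁? (upTo c) ∷ cnt T₂? (upTo c) ∷ b ∷ c ∷ r ∷ [])
            (λ i j₁ j₂ ti t₁ t₂ u₁ u₂ b c r → 2 ⊛ i ≼ ti ⇒ j₁ ≺ t₁ ⇒ j₂ ≺ t₂ ⇒ ti ⊕ t₁ ≼ u₁ ⇒ u₁ ⊕ t₂ ≼ u₂ ⇒ u₂ ⊕ b ≼ c ⇒
              r ≼ σ (i ⊕ j₁) ⇒ r ≼ σ (i ⊕ j₂) ⇒ 2 ⊛ r ⊕ b ≼ c) refl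
            (touch-sparse q I? λ k≤ (a , _) (_ , d) → ne (apart k≤ s s′ a d))
            (touch-boundary q J₁? (proj₁ (proj₂ ex₁)) (proj₂ (proj₂ ex₁)) (proj₁ (proj₂ ex₂)) λ (_ , ν) → ν (proj₁ (proj₂ (proj₂ ex₂))))
            (touch-boundary q J₂? (proj₁ (proj₂ ex₂)) (proj₂ (proj₂ ex₂)) (proj₁ (proj₂ ex₁)) λ (_ , ν) → ν (proj₁ (proj₂ (proj₂ ex₁))))
            (cnt-disjoint (touch? q I?) (touch? q J₁?) T₁? (upTo c) (λ _ → inj₁) (λ _ → inj₂)
              λ m → apart-touch q I J₁ (λ k≤ → (λ (_ , a) (_ , ν) → ν a) , (λ (_ , a) (d , ν) → ne (sym (apart k≤ s′ s a d))) ,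
                                          (λ (_ , a) (d , ν) → ne (apart k≤ s s′ d a))) (s≤s⁻¹ (∈-upTo⁻ m)))
            (cnt-disjoint T₁? (touch? q J₂?) T₂? (upTo c) (λ _ → inj₁) (λ _ → inj₂)
              λ { m (inj₁ t) → apart-touch q I J₂ (λ k≤ → (λ (a , _) (_ , ν) → ν a) , (λ (a , _) (d , ν) → ne (apart k≤ s s′ a d)) ,
                                          (λ (a , _) (d , ν) → ne (sym (apart k≤ s′ s d a)))) (s≤s⁻¹ (∈-upTo⁻ m)) t
                ; m (inj₂ t) → apart-touch q J₁ J₂ (λ k≤ → (λ (a , _) (_ , ν) → ν a) , (λ (a , _) (d , _) → ne (apart k≤ s s′ a d)) ,
                                          (λ (a , _) (d , _) → ne (sym (apart k≤ s′ s d a)))) (s≤s⁻¹ (∈-upTo⁻ m)) t })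
            (≤-trans (cnt-disjoint T₂? b? (λ k → k <? c) (upTo c) (λ m _ → ∈-upTo⁻ m) (λ m _ → ∈-upTo⁻ m)
              λ m t → touched-free (s≤s⁻¹ (∈-upTo⁻ m)) (nb t)) (cnt-upTo≤ (λ k → k <? c) c))
            (covered s I? J₁? i-or-j₁) (covered s′ I? J₂? i-or-j₂)
          where
          I J₁ J₂ : ℕ → Set
          I k = w L k ∊ h × w L k ∊ h′
          J₁ k = w L k ∊ h × ¬ w L k ∊ h′
          J₂ k = w L k ∊ h′ × ¬ w L k ∊ h
          I? : ∀ k → Dec (I k)
          I? k = (w L k ∊? h) ×-dec (w L k ∊? h′)
          J₁? : ∀ k → Dec (J₁ k)
          J₁? k = (w L k ∊? h) ×-dec ¬? (w L k ∊? h′)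
          J₂? : ∀ k → Dec (J₂ k)
          J₂? k = (w L k ∊? h′) ×-dec ¬? (w L k ∊? h)
          T₁? : ∀ k → Dec (Touch q I k ⊎ Touch q J₁ k)
          T₁? k = touch? q I? k ⊎-dec touch? q J₁? k
          T₂? : ∀ k → Dec ((Touch q I k ⊎ Touch q J₁ k) ⊎ Touch q J₂ k)
          T₂? k = T₁? k ⊎-dec touch? q J₂? k
          nb : ∀ {k} → (Touch q I k ⊎ Touch q J₁ k) ⊎ Touch q J₂ k → Touch q Nbr k
          nb (inj₁ (inj₁ (inj₁ (a , _)))) = inj₁ (h , s , a)
          nb (inj₁ (inj₁ (inj₂ (a , _)))) = inj₂ (h , s , a)
          nb (inj₁ (inj₂ (inj₁ (a , _)))) = inj₁ (h , s , a)
          nb (inj₁ (inj₂ (inj₂ (a , _)))) = inj₂ (h , s , a)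
          nb (inj₂ (inj₁ (a , _))) = inj₁ (h′ , s′ , a)
          nb (inj₂ (inj₂ (a , _))) = inj₂ (h′ , s′ , a)
          covered : ∀ {g} → Star L g → {K K′ : ℕ → Set} (K? : ∀ k → Dec (K k)) (K′? : ∀ k → Dec (K′ k)) →
            (∀ k → w L k ∊ g → K k ⊎ K′ k) → r ≤ suc (cnt K? (upTo c) + cnt K′? (upTo c))
          covered {g} sg K? K′? f = ≤-trans (cover≥ g (z L ∷ map (w L) xs) cov)
              (s≤s (≤-trans (≤-reflexive (trans (length-map (w L) xs) (sym (cnt≡ (λ k → w L k ∊? g) (upTo c))))) (cnt-cover (λ k → w L k ∊? g) K? K′? (upTo c) (λ {k} _ → f k))))
            where
            xs = filter (λ k → w L k ∊? g) (upTo c)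
            cov : ∀ u → u ∊ g → u ∈ z L ∷ map (w L) xs
            cov u u∊ with inside sg u∊
            ... | inj₁ refl = here refl
            ... | inj₂ (k , k≤ , refl) = there (∈-map⁺ (w L) (∈-filter⁺ (λ k → w L k ∊? g) (∈-upTo⁺ (s≤s k≤)) u∊))
          i-or-j₁ : ∀ k → w L k ∊ h → I k ⊎ J₁ k
          i-or-j₁ k a with w L k ∊? h′
          ... | yes d = inj₁ (a , d)
          ... | no d = inj₂ (a , d)
          i-or-j₂ : ∀ k → w L k ∊ h′ → I k ⊎ J₂ k
          i-or-j₂ k a with w L k ∊? h
          ... | yes d = inj₁ (d , a)
          ... | no d = inj₂ (a , d)
          only : ∀ {g g′} → Star L g → Star L g′ → g ≢ g′ → ∃ λ k → k ≤ q × (w L k ∊ g × ¬ w L k ∊ g′)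
          only {g} {g′} sg sg′ ne with anyUpTo? (λ k → (w L k ∊? g) ×-dec ¬? (w L k ∊? g′)) c
          ... | yes (k , k< , x) = k , s≤s⁻¹ k< , x
          ... | no none = ⊥-elim (ne (ext g g′ λ u u∊ → sub u u∊ (inside sg u∊)))
            where
            sub : ∀ u → u ∊ g → u ≡ z L ⊎ (∃ λ k → k ≤ q × u ≡ w L k) → u ∊ g′
            sub u u∊ (inj₁ refl) = proj₁ sg′
            sub u u∊ (inj₂ (k , k≤ , refl)) with w L k ∊? g′
            ... | yes h = h
            ... | no h = ⊥-elim (none (k , s≤s k≤ , u∊ , h))
          ex₁ = only s s′ ne
          ex₂ = only s′ s (λ eq → ne (sym eq))

        -- Star edges are counted in two ways. One with two consecutive vertices on the cycle is
        -- determined by this pair (`pair-unique`); the others live on the sparse set `A°`, where a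
        -- binomial coefficient bounds them.
        Pair : E → ℕ → Set
        Pair h k = Star L h × w L k ∊ h × w L (nxt q k) ∊ h
        pair? : ∀ h k → Dec (Pair h k)
        pair? h k = star? L h ×-dec ((w L k ∊? h) ×-dec (w L (nxt q k) ∊? h))
        Dbl : E → Set
        Dbl h = ∃ λ k → k < c × Pair h k
        dbl? : ∀ h → Dec (Dbl h)
        dbl? h = anyUpTo? (pair? h) c
        Sgl : E → Set
        Sgl h = Star L h × ¬ Dbl h
        sgl? : ∀ h → Dec (Sgl h)
        sgl? h = star? L h ×-dec ¬? (dbl? h)
        A° : ℕ → Set
        A° k = ∃ λ h → Sgl h × w L k ∊ h
        a°? : ∀ k → Dec (A° k)
        a°? k = any? λ h → sgl? h ×-dec (w L k ∊? h)
        Priv : ℕ → Set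
        Priv k = Nbr k × ¬ A° k
        priv? : ∀ k → Dec (Priv k)
        priv? k = nbr? k ×-dec ¬? (a°? k)
        a° = cnt a°? (upTo c)
        #Sgl = cnt sgl? (allFin M)
        #Dbl = cnt dbl? (allFin M)

        A°-apart : ∀ {k} → k ≤ q → A° k → Nbr (nxt q k) → ⊥
        A°-apart k≤ (h , (s , nd) , k∊) (h′ , s′ , k∊′) with apart k≤ s s′ k∊ k∊′
        ... | refl = nd (_ , s≤s k≤ , s , k∊ , k∊′)

        A°-apart′ : ∀ {k} → k ≤ q → A° (nxt q k) → Nbr k → ⊥
        A°-apart′ k≤ (h , (s , nd) , k∊) (h′ , s′ , k∊′) with apart k≤ s′ s k∊′ k∊
        ... | refl = nd (_ , s≤s k≤ , s , k∊′ , k∊)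

        A°⇒Nbr : ∀ {k} → A° k → Nbr k
        A°⇒Nbr (h , (s , _) , k∊) = h , s , k∊

        pair-priv : ∀ {h k} → k ≤ q → Pair h k → Priv k
        pair-priv k≤ (s , k∊ , k∊′) = (_ , s , k∊) , λ a → A°-apart k≤ a (_ , s , k∊′)

        #Sgl≤ : #Sgl ≤ a° choose suc ρ
        #Sgl≤ = edges-at≤ sgl? a°? c (w L) (suc ρ) r≡ (z L) (λ (s , _) → proj₁ s) λ {h} sg u∊ → conv sg u∊ (inside (proj₁ sg) u∊)
          where
          conv : ∀ {h u} → Sgl h → u ∊ h → u ≡ z L ⊎ (∃ λ k → k ≤ q × u ≡ w L k) → u ≡ z L ⊎ ∃ λ k → k < c × A° k × u ≡ w L k
          conv sg u∊ (inj₁ eq) = inj₁ eq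
          conv sg u∊ (inj₂ (k , k≤ , refl)) = inj₂ (k , s≤s k≤ , (_ , sg , u∊) , refl)

        S≤ : S ≤ #Sgl + #Dbl
        S≤ = cnt-cover (star? L) sgl? dbl? (allFin M) λ {h} _ s → split h s
          where
          split : ∀ h → Star L h → Sgl h ⊎ Dbl h
          split h s with dbl? h
          ... | yes d = inj₂ d
          ... | no d = inj₁ (s , d)

        pair-unique : ∀ {h h′ k} → k ≤ q → Pair h k → Pair h′ k → h ≡ h′
        pair-unique k≤ (s , k∊ , _) (s′ , _ , k∊′) = apart k≤ s s′ k∊ k∊′

        sparse° : 2 * a° ≤ cnt (touch? q a°?) (upTo c)
        sparse° = touch-sparse q a°? λ k≤ a a′ → A°-apart k≤ a (A°⇒Nbr a′)

        links : cnt (touch? q a°?) (upTo c) + cnt (touch? q priv?) (upTo c) + b ≤ c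
        links = ≤-trans (+-monoˡ-≤ b (cnt-disjoint (touch? q a°?) (touch? q priv?) T? (upTo c) (λ _ → inj₁) (λ _ → inj₂)
              λ m → apart-touch q A° Priv (λ k≤ → (λ a (_ , na) → na a) , (λ a (nb , _) → A°-apart k≤ a nb) , (λ a (nb , _) → A°-apart′ k≤ a nb)) (s≤s⁻¹ (∈-upTo⁻ m))))
            (≤-trans (cnt-disjoint T? b? (λ k → k <? c) (upTo c) (λ m _ → ∈-upTo⁻ m) (λ m _ → ∈-upTo⁻ m)
              λ m t → touched-free (s≤s⁻¹ (∈-upTo⁻ m)) (nb t)) (cnt-upTo≤ (λ k → k <? c) c))
          where
          T? : ∀ k → Dec (Touch q A° k ⊎ Touch q Priv k)
          T? k = touch? q a°? k ⊎-dec touch? q priv? k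
          nb : ∀ {k} → Touch q A° k ⊎ Touch q Priv k → Touch q Nbr k
          nb (inj₁ (inj₁ a)) = inj₁ (A°⇒Nbr a)
          nb (inj₁ (inj₂ a)) = inj₂ (A°⇒Nbr a)
          nb (inj₂ (inj₁ (a , _))) = inj₁ a
          nb (inj₂ (inj₂ (a , _))) = inj₂ a

      -- The extremal configuration: the neighbours of z occupy every second place of the cycle,
      -- except around one link, which contains z.
      record Tight : Set where
        field
          length≡ : q ≡ 2 * suc τ
          cover : ∀ {k} → k ≤ q → Touch q Nbr k ⊎ B k
          unique : ∀ {k l} → k ≤ q → l ≤ q → B k → B l → k ≡ l
          exists : ∃ λ k → k ≤ q × B k
          sparse : ∀ {k} → k ≤ q → Nbr k → Nbr (nxt q k) → ⊥
          twice : ∀ {k} → k ≤ q → Nbr k → ∀ h → ∃ λ h′ → Star L h′ × w L k ∊ h′ × h′ ≢ h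

      private
        t = suc τ

        -- Neighbours touch two links each, out of at most 2 t + 1. Each neighbour short of t costs
        -- three edges and frees only two links (`C-grow₃`). With t neighbours, at most one link is
        -- left to contain z, and the degree requires it.
        no-double : #Dbl ≡ 0 → 2 ≤ S → Tight
        no-double d0 2≤S = record
          { length≡ = ≤-antisym q≤ (lia (a° ∷ T ∷ U ∷ b ∷ q ∷ τ ∷ [])
              (λ a x u b q t → 2 ⊛ a ≼ x ⇒ x ⊕ u ⊕ b ≼ σ q ⇒ σ t ≼ a ⇒ con 1 ≼ b ⇒ 2 ⊛ σ t ≼ q) refl sparse° links a≥ b≥)
          ; cover = λ {k} k≤ → cnt-upTo-full all? c full (s≤s k≤)
          ; unique = λ {k} {l} k≤ l≤ bk bl → one k≤ l≤ bk bl
          ; exists = let (k , m , h) = cnt-∃ b? (upTo c) b≥ in k , s≤s⁻¹ (∈-upTo⁻ m) , h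
          ; sparse = λ { k≤ (h , s , k∊) nb′ → A°-apart k≤ (h , (s , cnt-0 dbl? (allFin M) d0 (∈-allFin h)) , k∊) nb′ }
          ; twice = λ {k} k≤ nb h → again k≤ nb h }
          where
          T = cnt (touch? q a°?) (upTo c)
          U = cnt (touch? q priv?) (upTo c)
          S≤C : S ≤ a° choose suc ρ
          S≤C = ≤-trans S≤ (≤-trans (≤-reflexive (trans (cong (#Sgl +_) d0) (+-identityʳ #Sgl))) #Sgl≤)
          a>ρ : suc (suc ρ) ≤ a°
          a>ρ = ≰⇒> λ le → <⇒≱ 2≤S (≤-trans S≤C (C≤1 le))
          a≥ : t ≤ a°
          a≥ = ≮⇒≥ λ a<t → small a<t
            where
            small : a° < t → ⊥
            small a<t with <-split a<t
            ... | j , eq = lia (a° ∷ j ∷ T ∷ U ∷ b ∷ q ∷ τ ∷ S ∷ a° choose suc ρ ∷ t choose suc ρ ∷ [])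
              (λ a j x u b q t s y d → 2 ⊛ a ≼ x ⇒ x ⊕ u ⊕ b ≼ σ q ⇒ q ≼ 2 ⊛ σ t ⇒ σ (a ⊕ j) ≈ σ t ⇒ σ d ≼ s ⊕ b ⇒ s ≼ y ⇒ 3 ⊛ σ j ⊕ y ≼ d ⇒ absurd) refl
              sparse° links q≤ eq degree-z S≤C
              (subst (λ m → 3 * suc j + a° choose suc ρ ≤ m choose suc ρ) (trans (cong suc (+-comm j a°)) eq) (C-grow₃ 1≤ρ a>ρ (suc j)))
          a≤ : a° ≤ t
          a≤ = lia (a° ∷ T ∷ U ∷ b ∷ q ∷ τ ∷ []) (λ a x u b q t → 2 ⊛ a ≼ x ⇒ x ⊕ u ⊕ b ≼ σ q ⇒ q ≼ 2 ⊛ σ t ⇒ a ≼ σ t) refl sparse° links q≤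
          S≤t : S ≤ t choose suc ρ
          S≤t = ≤-trans S≤C (C-mono (suc ρ) a≤)
          b≥ : 1 ≤ b
          b≥ = lia (S ∷ b ∷ t choose suc ρ ∷ []) (λ s b d → σ d ≼ s ⊕ b ⇒ s ≼ d ⇒ con 1 ≼ b) refl degree-z S≤t
          b≤ : b ≤ 1
          b≤ = lia (a° ∷ T ∷ U ∷ b ∷ q ∷ τ ∷ []) (λ a x u b q t → 2 ⊛ a ≼ x ⇒ x ⊕ u ⊕ b ≼ σ q ⇒ q ≼ 2 ⊛ σ t ⇒ σ t ≼ a ⇒ b ≼ con 1) refl sparse° links q≤ a≥
          S≥ : t choose suc ρ ≤ S
          S≥ = lia (S ∷ b ∷ t choose suc ρ ∷ []) (λ s b d → σ d ≼ s ⊕ b ⇒ b ≼ con 1 ⇒ d ≼ s) refl degree-z b≤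
          all? : ∀ k → Dec (Touch q Nbr k ⊎ B k)
          all? k = touch? q nbr? k ⊎-dec b? k
          full : c ≤ cnt all? (upTo c)
          full = ≤-trans (lia (a° ∷ T ∷ b ∷ q ∷ τ ∷ []) (λ a x b q t → 2 ⊛ a ≼ x ⇒ σ t ≼ a ⇒ con 1 ≼ b ⇒ q ≼ 2 ⊛ σ t ⇒ σ q ≼ x ⊕ b) refl sparse° a≥ b≥ q≤)
            (cnt-disjoint (touch? q a°?) b? all? (upTo c) (λ _ t → inj₁ (nb t)) (λ _ → inj₂) λ m t → touched-free (s≤s⁻¹ (∈-upTo⁻ m)) (nb t))
            where
            nb : ∀ {k} → Touch q A° k → Touch q Nbr k
            nb (inj₁ a) = inj₁ (A°⇒Nbr a)
            nb (inj₂ a) = inj₂ (A°⇒Nbr a)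
          one : ∀ {k l} → k ≤ q → l ≤ q → B k → B l → k ≡ l
          one {k} {l} k≤ l≤ bk bl with k ≟ l
          ... | yes eq = eq
          ... | no ne = ⊥-elim (<⇒≱ (≤-trans (+-mono-≤ (cnt≥1 (λ i → i ≟ k) {upTo c} (∈-upTo⁺ (s≤s k≤)) refl) (cnt≥1 (λ i → i ≟ l) {upTo c} (∈-upTo⁺ (s≤s l≤)) refl))
                  (cnt-disjoint (λ i → i ≟ k) (λ i → i ≟ l) b? (upTo c) (λ { _ refl → bk }) (λ { _ refl → bl }) λ { _ refl refl → ne refl })) b≤)
          -- Otherwise all star edges but one live on τ neighbours, although C(t, ρ + 1) exceeds
          -- C(τ, ρ + 1) by C(τ, ρ) ≥ 2.
          again : ∀ {k} → k ≤ q → Nbr k → ∀ h → ∃ λ h′ → Star L h′ × w L k ∊ h′ × h′ ≢ h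
          again {k} k≤ nb h with any? (λ h′ → star? L h′ ×-dec ((w L k ∊? h′) ×-dec ¬? (h′ ≟ᶠ h)))
          ... | yes x = x
          ... | no none = ⊥-elim (lia (S ∷ O ∷ 1′ ∷ τ choose ρ ∷ τ choose suc ρ ∷ τ ∷ [])
              (λ s o i x y t → x ⊕ y ≼ s ⇒ s ≼ o ⊕ i ⇒ i ≼ con 1 ⇒ o ≼ y ⇒ t ≼ x ⇒ con 2 ≼ t ⇒ absurd) refl
              (subst (_≤ S) (pascal τ ρ) S≥)
              (cnt-cover (star? L) other? (λ h′ → h′ ≟ᶠ h) (allFin M) λ {h′} _ s → split h′ s)
              (cnt≤1 (λ h′ → h′ ≟ᶠ h) (allFin M) (allFin⁺ M) λ { _ _ refl refl → refl })
              (≤-trans (edges-at≤ other? rest? c (w L) (suc ρ) r≡ (z L) (λ (s , _) → proj₁ s) λ o u∊ → conv o u∊ (inside (proj₁ o) u∊))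
                       (C-mono (suc ρ) rest≤))
              (C≥n τ ρ 1≤ρ ρ<τ) (≤-trans (s≤s 1≤ρ) ρ<τ))
            where
            other? : ∀ h′ → Dec (Star L h′ × h′ ≢ h)
            other? h′ = star? L h′ ×-dec ¬? (h′ ≟ᶠ h)
            O = cnt other? (allFin M)
            1′ = cnt (λ h′ → h′ ≟ᶠ h) (allFin M)
            split : ∀ h′ → Star L h′ → (Star L h′ × h′ ≢ h) ⊎ h′ ≡ h
            split h′ s with h′ ≟ᶠ h
            ... | yes eq = inj₂ eq
            ... | no n≡ = inj₁ (s , n≡)
            rest? : ∀ l → Dec (Nbr l × l ≢ k)
            rest? l = nbr? l ×-dec ¬? (l ≟ k)
            conv : ∀ {h′ u} → Star L h′ × h′ ≢ h → u ∊ h′ → u ≡ z L ⊎ (∃ λ l → l ≤ q × u ≡ w L l) →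
              u ≡ z L ⊎ ∃ λ l → l < c × (Nbr l × l ≢ k) × u ≡ w L l
            conv o u∊ (inj₁ eq) = inj₁ eq
            conv (s , ne) u∊ (inj₂ (l , l≤ , refl)) = inj₂ (l , s≤s l≤ , ((_ , s , u∊) , λ { refl → none (_ , s , u∊ , ne) }) , refl)
            nbr≤ : cnt nbr? (upTo c) ≤ a°
            nbr≤ = cnt-mono nbr? a°? (upTo c) λ { m (h′ , s , l∊) → h′ , (s , cnt-0 dbl? (allFin M) d0 (∈-allFin h′)) , l∊ }
            rest≤ : cnt rest? (upTo c) ≤ τ
            rest≤ = s≤s⁻¹ (≤-trans (≤-trans (≤-trans (≤-reflexive (+-comm 1 _)) (+-monoʳ-≤ (cnt rest? (upTo c))
                      (cnt≥1 (λ l → l ≟ k) {upTo c} (∈-upTo⁺ (s≤s k≤)) refl)))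
                      (cnt-disjoint rest? (λ l → l ≟ k) nbr? (upTo c) (λ _ → proj₁) (λ { _ refl → nb }) λ { _ (_ , ne) refl → ne refl }))
                      (≤-trans nbr≤ a≤))

        -- Each double edge gets two positions of its own, the two members of its last pair. A
        -- position that is first for one edge and second for another would identify the edges by
        -- `apart`, and an edge has only one last pair.
        First Second : ℕ → Set
        First k = ∃ λ h → Pair h k × (∀ {l} → l < c → k < l → ¬ Pair h l)
        Second k = ∃ λ l → l < c × First l × nxt q l ≡ k

        first? : ∀ k → Dec (First k)
        first? k = any? (λ h → pair? h k ×-dec allUpTo? (λ l → (k <? l) →-dec ¬? (pair? h l)) c)

        second? : ∀ k → Dec (Second k)
        second? k = anyUpTo? (λ l → first? l ×-dec (nxt q l ≟ k)) c

        no-loop : 1 < c → ∀ {l} → l ≤ q → l ≢ nxt q l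
        no-loop 1<c l≤ eq with m≤n⇒m<n∨m≡n l≤
        ... | inj₁ lt = 1+n≢n (sym (trans eq (nxt-lo lt)))
        ... | inj₂ refl = <⇒≱ 1<c (s≤s (≤-reflexive (trans eq (nxt-hi q))))

        First∩Second : 1 < c → ∀ {k} → k ≤ q → First k → Second k → ⊥
        First∩Second 1<c {k} k≤ (h , (s , k∊ , k∊′) , top) (l , l< , (h′ , (s′ , l∊ , l∊′) , top′) , nxt≡)
          with apart k≤ s′ s (subst (λ k → w L k ∊ h′) nxt≡ l∊′) k∊′ | <-cmp l k
        ... | refl | tri< lt _ _ = top′ (s≤s k≤) lt (s , k∊ , k∊′)
        ... | refl | tri> _ _ gt = top l< gt (s′ , l∊ , l∊′)
        ... | refl | tri≈ _ refl _ = no-loop 1<c k≤ (sym nxt≡)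

        2#Dbl≤ : 1 < c → #Sgl ≡ 0 → 2 * #Dbl ≤ cnt priv? (upTo c)
        2#Dbl≤ 1<c s0 = lia (#Dbl ∷ cnt first? (upTo c) ∷ cnt second? (upTo c) ∷ cnt priv? (upTo c) ∷ [])
          (λ d f s p → d ≼ f ⇒ f ≼ s ⇒ f ⊕ s ≼ p ⇒ 2 ⊛ d ≼ p) refl dbl≤first first≤second both
          where
          nobody : ∀ {k} → ¬ A° k
          nobody (h , sg , _) = cnt-0 sgl? (allFin M) s0 (∈-allFin h) sg
          last-pair : ∀ {h} → Dbl h → ∃ λ k → k ∈ upTo c × First k × k ≤ q × Pair h k
          last-pair {h} (k , k< , pr) with max (pair? h) c k< pr
          ... | j , j< , pj , top = j , ∈-upTo⁺ j< , (h , pj , λ l< j<l → top j<l l<) , s≤s⁻¹ j< , pj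
          dbl≤first : #Dbl ≤ cnt first? (upTo c)
          dbl≤first = cnt-injection dbl? first? (λ h k → k ≤ q × Pair h k) (λ (k≤ , a) (_ , d) → pair-unique k≤ a d) (allFin⁺ M)
            λ _ d → last-pair d
          first≤second : cnt first? (upTo c) ≤ cnt second? (upTo c)
          first≤second = cnt-injection first? second? (λ l k → l ≤ q × nxt q l ≡ k)
            (λ (l≤ , eq) (l≤′ , eq′) → nxt-inj l≤ l≤′ (trans eq (sym eq′))) (upTo⁺ c)
            λ {l} m f → nxt q l , ∈-upTo⁺ (s≤s (nxt-≤ q l)) , (l , ∈-upTo⁻ m , f , refl) , s≤s⁻¹ (∈-upTo⁻ m) , refl
          both : cnt first? (upTo c) + cnt second? (upTo c) ≤ cnt priv? (upTo c)
          both = cnt-disjoint first? second? priv? (upTo c) (λ { _ (h , (s , k∊ , _) , _) → (h , s , k∊) , nobody })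
            (λ { _ (l , _ , (h , (s , _ , k∊) , _) , refl) → (h , s , k∊) , nobody }) λ m → First∩Second 1<c (s≤s⁻¹ (∈-upTo⁻ m))

        -- If every vertex of the cycle were a neighbour of z, one edge would contain them all.
        non-neighbour : r < c → ∃ λ k → k ≤ q × ¬ Nbr k
        non-neighbour r<c with anyUpTo? (λ k → ¬? (nbr? k)) c
        ... | yes (k , k< , h) = k , s≤s⁻¹ k< , h
        ... | no none = ⊥-elim (<⇒≱ r<c (≤-trans (≤-reflexive (sym (trans (cnt-all (λ k → k <? c) (upTo c) ∈-upTo⁻) (length-upTo c))))
              (indexed≤ g (λ k → k <? c) c (w L) (λ i< j< _ _ → v-inj (Q L) (s≤s⁻¹ i<) (s≤s⁻¹ j<)) (λ k< _ → contains (s≤s⁻¹ k<)))))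
          where
          all : ∀ k → k ≤ q → Nbr k
          all k k≤ with nbr? k
          ... | yes h = h
          ... | no h = ⊥-elim (none (k , s≤s k≤ , h))
          g = proj₁ (all 0 z≤n)
          sg : Star L g
          sg = proj₁ (proj₂ (all 0 z≤n))
          contains : ∀ {k} → k ≤ q → w L k ∊ g
          contains {zero} _ = proj₂ (proj₂ (all 0 z≤n))
          contains {suc k} k< with all (suc k) k<
          ... | g′ , s′ , k∊ = subst (w L (suc k) ∊_) (sym (apart (<⇒≤ k<) sg s′ (contains (<⇒≤ k<))
                                 (subst (λ l → w L l ∊ g′) (sym (nxt-lo k<)) k∊))) k∊

        some-double : ∀ {h h′} → Star L h → Star L h′ → h ≢ h′ → 1 ≤ #Dbl → ⊥
        some-double {h₁} {h₂} s₁ s₂ ne d≥ = by-singles (#Sgl ≟ 0)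
          where
          T = cnt (touch? q a°?) (upTo c)
          U = cnt (touch? q priv?) (upTo c)
          p° = cnt priv? (upTo c)
          2r≤c : 2 * r + b ≤ c
          2r≤c = two s₁ s₂ ne
          r<c : r < c
          r<c = lia (r ∷ ρ ∷ b ∷ c ∷ []) (λ r s b c → r ≈ σ (σ s) ⇒ 2 ⊛ r ⊕ b ≼ c ⇒ r ≺ c) refl r≡ 2r≤c
          1<c : 1 < c
          1<c = lia (r ∷ ρ ∷ c ∷ []) (λ r s c → r ≈ σ (σ s) ⇒ r ≺ c ⇒ con 1 ≺ c) refl r≡ r<c
          U> : p° < U
          U> = boundary (cnt-∃ dbl? (allFin M) d≥) (non-neighbour r<c)
            where
            boundary : (∃ λ h → h ∈ allFin M × Dbl h) → (∃ λ k → k ≤ q × ¬ Nbr k) → p° < U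
            boundary (h₀ , _ , k₀ , k₀< , pr₀) (k₁ , k₁≤ , nb) =
              touch-boundary q priv? (s≤s⁻¹ k₀<) (pair-priv (s≤s⁻¹ k₀<) pr₀) k₁≤ λ (nb′ , _) → nb nb′
          #Dbl≤ : #Dbl ≤ p°
          #Dbl≤ = cnt-injection dbl? priv? (λ h k → k ≤ q × Pair h k) (λ (k≤ , a) (_ , d) → pair-unique k≤ a d) (allFin⁺ M)
            λ { _ (k , k< , pr) → k , ∈-upTo⁺ k< , pair-priv (s≤s⁻¹ k<) pr , s≤s⁻¹ k< , pr }
          a≤ : a° ≤ t
          a≤ = lia (a° ∷ T ∷ U ∷ b ∷ q ∷ τ ∷ []) (λ a x u b q t → 2 ⊛ a ≼ x ⇒ x ⊕ u ⊕ b ≼ σ q ⇒ q ≼ 2 ⊛ σ t ⇒ a ≼ σ t) refl sparse° links q≤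
          by-singles : Dec (#Sgl ≡ 0) → ⊥
          by-singles (no s≢0) with ≤-split a≤
          ... | j , eq = singles-bound {a°} {j} {T} {U} {b} {q} {τ} {S} {#Sgl} {#Dbl} {p°} {a° choose suc ρ} {t choose suc ρ} sparse° links q≤ eq degree-z S≤ #Sgl≤ #Dbl≤ U>
            (subst (λ m → 2 * j + a° choose suc ρ ≤ m choose suc ρ) (trans (+-comm j a°) eq) (C-grow₂ 1≤ρ a≥ j))
            where
            a≥ : suc ρ ≤ a°
            a≥ = ≮⇒≥ λ lt → s≢0 (n≤0⇒n≡0 (≤-trans #Sgl≤ (≤-reflexive (C≡0 lt))))
          by-singles (yes s0) = doubles-bound {#Dbl} {p°} {U} {T} {b} {q} {τ} {S} {#Sgl} {ρ} {r} {t choose suc ρ} (2#Dbl≤ 1<c s0) U> links q≤ degree-z S≤ s0 r≡ 2r≤c (C≥2t∸K (s≤s 1≤ρ) (s≤s ρ<τ))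

      abstract
        tight : ∀ {h h′} → Star L h → Star L h′ → h ≢ h′ → Tight
        tight {h} {h′} s s′ ne with #Dbl ≟ 0
        ... | no d≢0 = ⊥-elim (some-double s s′ ne (n≢0⇒n>0 d≢0))
        ... | yes d0 = no-double d0 (≤-trans
            (+-mono-≤ (cnt≥1 (λ g → g ≟ᶠ h) (∈-allFin h) refl) (cnt≥1 (λ g → g ≟ᶠ h′) (∈-allFin h′) refl))
            (cnt-disjoint (λ g → g ≟ᶠ h) (λ g → g ≟ᶠ h′) (star? L) (allFin M) (λ { _ refl → s }) (λ { _ refl → s′ }) λ { _ refl refl → ne refl }))

     -- In the tight case the link φ containing z contains every second vertex of the cycle, which is too many.
     module Spanning (n≤ : n ≤ 2 + 2 * suc τ) where

      private
        t = suc τ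

        abstract
          too-many : ∀ {n q t a b c d} → n ≤ 2 + 2 * suc t → q ≡ 2 * suc t → suc q ≤ a → 1 ≤ b → 1 ≤ c → a + b ≤ d → d + c ≤ n → ⊥
          too-many {n} {q} {t} {a} {b} {c} {d} = lia (n ∷ q ∷ t ∷ a ∷ b ∷ c ∷ d ∷ [])
            (λ n q t a b c d → n ≼ con 2 ⊕ 2 ⊛ σ t ⇒ q ≈ 2 ⊛ σ t ⇒ σ q ≼ a ⇒ con 1 ≼ b ⇒ con 1 ≼ c ⇒ a ⊕ b ≼ d ⇒ d ⊕ c ≼ n ⇒ absurd) refl

          module _ (L : Loop q) where
            On : V → Set
            On x = ∃ λ k → k < suc q × x ≡ w L k
            on? : ∀ x → Dec (On x)
            on? = on-path? (Q L)
            On₁ : V → Set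
            On₁ x = On x ⊎ x ≡ z L
            on₁? : ∀ x → Dec (On₁ x)
            on₁? x = on? x ⊎-dec (x ≟ᶠ z L)
            #On≥ : suc q ≤ cnt on? (allFin n)
            #On≥ = ≤-trans (≤-reflexive (sym (trans (cnt-all (λ k → k <? suc q) (upTo (suc q)) ∈-upTo⁻) (length-upTo (suc q)))))
              (cnt-injection (λ k → k <? suc q) on? (λ k x → k ≤ q × x ≡ w L k)
                (λ { (k≤ , refl) (l≤ , eq) → v-inj (Q L) k≤ l≤ eq }) (upTo⁺ (suc q))
                λ {k} m k< → w L k , ∈-allFin (w L k) , (k , k< , refl) , s≤s⁻¹ k< , refl)
            #On₁≥ : cnt on? (allFin n) + cnt (λ x → x ≟ᶠ z L) (allFin n) ≤ cnt on₁? (allFin n)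
            #On₁≥ = cnt-disjoint on? (λ x → x ≟ᶠ z L) on₁? (allFin n) (λ _ → inj₁) (λ _ → inj₂)
                      λ { _ (k , k< , eq) refl → z∉ L (s≤s⁻¹ k<) eq }
            outside : q ≡ 2 * t → ∀ {u} → ¬ On₁ u → ⊥
            outside q≡ {u} off = too-many {n} {q} {τ} {cnt on? (allFin n)} {cnt (λ x → x ≟ᶠ z L) (allFin n)} {cnt (λ x → x ≟ᶠ u) (allFin n)} {cnt on₁? (allFin n)}
                n≤ q≡ #On≥ (cnt≥1 (λ x → x ≟ᶠ z L) (∈-allFin (z L)) refl) (cnt≥1 (λ x → x ≟ᶠ u) (∈-allFin u) refl) #On₁≥
                (subst (cnt on₁? (allFin n) + cnt (λ x → x ≟ᶠ u) (allFin n) ≤_) (length-tabulate (λ x → x))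
                  (≤-trans (cnt-disjoint on₁? (λ x → x ≟ᶠ u) (λ x → x ≟ᶠ x) (allFin n) (λ _ _ → refl) (λ _ _ → refl) λ { _ o refl → off o })
                    (cnt≤length (λ x → x ≟ᶠ x) (allFin n))))

          everything : (L : Loop q) → q ≡ 2 * t → ∀ u → u ≡ z L ⊎ ∃ λ k → k ≤ q × u ≡ w L k
          everything L q≡ u with on₁? L u
          ... | yes (inj₁ (k , k< , eq)) = inj₂ (k , s≤s⁻¹ k< , eq)
          ... | yes (inj₂ eq) = inj₁ eq
          ... | no off = ⊥-elim (outside L q≡ off)

          inside : (L : Loop q) → q ≡ 2 * t → ∀ {h u} → Star L h → u ∊ h → u ≡ z L ⊎ ∃ λ k → k ≤ q × u ≡ w L k
          inside L q≡ {u = u} _ _ = everything L q≡ u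

        module Gap (L : Loop q) (q≡ : q ≡ 2 * t) (z∊φ : z L ∊ φ L) {g g′ : E} (sg : Star L g) (sg′ : Star L g′) (g≢ : g ≢ g′) where

          open Tight (tight L (inside L q≡) sg sg′ g≢)

          private
            Near : ℕ → Set
            Near = Nbr L (inside L q≡)

            Bq : B L (inside L q≡) q
            Bq = subst (z L ∊_) (sym (link-hi L)) z∊φ

            no-end : ¬ Touch q Near q
            no-end tq = touched-free L (inside L q≡) ≤-refl tq Bq

            step : ∀ {k} → k < q → ¬ Near k → Near (suc k)
            step {k} k< ¬nb with cover (<⇒≤ k<)
            ... | inj₁ (inj₁ nb) = ⊥-elim (¬nb nb)
            ... | inj₁ (inj₂ nb) = subst Near (nxt-lo k<) nb
            ... | inj₂ bk = ⊥-elim (<⇒≢ k< (unique (<⇒≤ k<) ≤-refl bk Bq))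

            even : ∀ j → j + j ≤ q → ¬ Near (j + j)
            even zero _ nb = no-end (inj₂ (subst Near (sym (nxt-hi q)) nb))
            even (suc j) j≤ nb = sparse (<⇒≤ j≤′) (step (<⇒≤ j≤′) (even j (<⇒≤ (<⇒≤ j≤′))))
                (subst Near (sym (nxt-lo j≤′)) (subst Near (cong suc (+-suc j j)) nb))
              where
              j≤′ : suc (suc (j + j)) ≤ q
              j≤′ = subst (_≤ q) (cong suc (+-suc j j)) j≤

            -- Exchange z for w_{k+1}, with different edges h and h′ by `twice`. The new missed
            -- vertex has the star edges e_k and e_{k+1}, so the configuration is tight again.
            -- Either φ is the link containing the missed vertex, or an end of φ is one of its
            -- neighbours, and then a cycle through z and all of the old cycle appears.
            exchanged : ∀ {k} → suc (suc k) ≤ q → suc k < q → Near k → Near (suc (suc k)) → w L (suc k) ∊ φ L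
            exchanged {k} k<q sk< (h , s , k∊) nb′ with twice k<q nb′ h
            ... | h′ , s′ , k∊′ , h′≢h = at-gap (cover″ ≤-refl)
              where
              h≢h′ : h ≢ h′
              h≢h′ eq = h′≢h (sym eq)
              k≢sk : k ≢ suc k
              k≢sk = <⇒≢ (n<1+n k)
              Rv = revertex (Q L) sk< (z L) (z∉ L) (proj₁ (proj₂ s)) (proj₁ (proj₂ s′)) h≢h′ (proj₁ s) (proj₁ s′) k∊ k∊′
              rv-v : ∀ {l} → l ≢ suc k → v Rv l ≡ w L l
              rv-v = revertex-v (Q L) sk< (z L) (z∉ L) (proj₁ (proj₂ s)) (proj₁ (proj₂ s′)) h≢h′ (proj₁ s) (proj₁ s′) k∊ k∊′
              rv-mid : v Rv (suc k) ≡ z L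
              rv-mid = revertex-v-mid (Q L) sk< (z L) (z∉ L) (proj₁ (proj₂ s)) (proj₁ (proj₂ s′)) h≢h′ (proj₁ s) (proj₁ s′) k∊ k∊′
              rv-unused : ∀ {g} → (∀ {l} → l < q → l ≢ k → l ≢ suc k → g ≢ e (Q L) l) → g ≢ h → g ≢ h′ → Unused Rv g
              rv-unused = revertex-unused (Q L) sk< (z L) (z∉ L) (proj₁ (proj₂ s)) (proj₁ (proj₂ s′)) h≢h′ (proj₁ s) (proj₁ s′) k∊ k∊′
              unused-rv : ∀ {g} → Unused Rv g → g ≢ h × g ≢ h′ × (∀ {l} → l < q → l ≢ k → l ≢ suc k → g ≢ e (Q L) l)
              unused-rv = unused-revertex (Q L) sk< (z L) (z∉ L) (proj₁ (proj₂ s)) (proj₁ (proj₂ s′)) h≢h′ (proj₁ s) (proj₁ s′) k∊ k∊′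
              k<q′ : k < q
              k<q′ = <-trans (n<1+n k) sk<
              u∉ : ∀ {l} → l ≤ q → Dec (l ≡ suc k) → w L (suc k) ≢ v Rv l
              u∉ l≤ (yes refl) eq = z∉ L l≤ (sym (trans eq rv-mid))
              u∉ l≤ (no ne) eq = ne (sym (v-inj (Q L) (<⇒≤ sk<) l≤ (trans eq (rv-v ne))))
              L″ : Loop q
              L″ .Q = Rv
              L″ .φ = φ L
              L″ .z = w L (suc k)
              L″ .z∉ {l} l≤ = u∉ l≤ (l ≟ suc k)
              L″ .uφ = rv-unused (λ l< _ _ eq → uφ L (_ , l< , eq)) (λ eq → proj₂ (proj₂ s) (sym eq)) (λ eq → proj₂ (proj₂ s′) (sym eq))
              L″ .x∊ = subst (_∊ φ L) (sym (rv-v (λ ()))) (x∊ L)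
              L″ .y∊ = subst (_∊ φ L) (sym (rv-v (λ eq → <⇒≢ sk< (sym eq)))) (y∊ L)
              own-star : ∀ {i} → i < q → i ≡ k ⊎ i ≡ suc k → w L (suc k) ∊ e (Q L) i → Star L″ (e (Q L) i)
              own-star {i} i< which u∊ = u∊ , rv-unused differ (λ eq → proj₁ (proj₂ s) (i , i< , sym eq)) (λ eq → proj₁ (proj₂ s′) (i , i< , sym eq)) ,
                  λ eq → uφ L (i , i< , sym eq)
                where
                differ : ∀ {l} → l < q → l ≢ k → l ≢ suc k → e (Q L) i ≢ e (Q L) l
                differ l< a b eq = split which (e-inj (Q L) i< l< eq)
                  where
                  split : i ≡ k ⊎ i ≡ suc k → i ≡ _ → ⊥
                  split (inj₁ i≡) i≡l = a (trans (sym i≡l) i≡)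
                  split (inj₂ i≡) i≡l = b (trans (sym i≡l) i≡)
              in″ : ∀ {h u} → Star L″ h → u ∊ h → u ≡ z L″ ⊎ ∃ λ k → k ≤ q × u ≡ w L″ k
              in″ = inside L″ q≡
              T″ : Tight L″ in″
              T″ = tight L″ in″ (own-star k<q′ (inj₁ refl) (inr (Q L) k<q′)) (own-star sk< (inj₂ refl) (inl (Q L) sk<))
                     (λ eq → k≢sk (e-inj (Q L) k<q′ sk< eq))
              cover″ = Tight.cover T″
              -- The cycle z h′ v_{k+2} ... v_q g v_{k+1} ... v_0 φ.
              via-end : ∀ {g} → Star L″ g → w L q ∊ g → g ≢ e (Q L) k → ⊥
              via-end {g} (u∊ , ug , g≢φ) y∊g g≢ = noCycle (cons Tn (z L) h′ fresh uh′ (proj₁ s′) start) (φ L)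
                  (cons-unused Tn fresh uh′ (proj₁ s′) start (turn-unused (Q L) sk< g y∊g u∊ fr (uφ L) (λ eq → g≢φ (sym eq)))
                    (λ eq → proj₂ (proj₂ s′) (sym eq))) z∊φ (subst (_∊ φ L) (sym (turn-end (Q L) sk< g y∊g u∊ fr)) (x∊ L))
                where
                fr : Free (Q L) (suc k) g
                fr {l} l< l≢ eq with l ≟ k
                ... | yes refl = g≢ eq
                ... | no l≢k = proj₂ (proj₂ (unused-rv ug)) l< l≢k l≢ eq
                Tn = turn (Q L) sk< g y∊g u∊ fr
                fresh : ∀ {l} → l ≤ q → z L ≢ v Tn l
                fresh l≤ eq = let (m , m≤ , eq′) = turn-on (Q L) sk< g y∊g u∊ fr l≤ eq in z∉ L m≤ eq′
                uh′ : Unused Tn h′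
                uh′ = turn-unused (Q L) sk< g y∊g u∊ fr (proj₁ (proj₂ s′)) (λ eq → proj₁ (proj₂ (unused-rv ug)) (sym eq))
                start : v Tn 0 ∊ h′
                start = subst (_∊ h′) (sym (turn-start (Q L) sk< g y∊g u∊ fr)) k∊′
              -- The cycle z h v_k ... v_0 g v_{k+1} ... v_q φ.
              via-start : ∀ {g} → Star L″ g → w L 0 ∊ g → g ≢ e (Q L) (suc k) → ⊥
              via-start {g} (u∊ , ug , g≢φ) x∊g g≢ = noCycle (cons Rt (z L) h fresh uh (proj₁ s) start) (φ L)
                  (cons-unused Rt fresh uh (proj₁ s) start (rotate-unused (Q L) k<q′ g x∊g u∊ fr (uφ L) (λ eq → g≢φ (sym eq)))
                    (λ eq → proj₂ (proj₂ s) (sym eq))) z∊φ (subst (_∊ φ L) (sym (rotate-v-end (Q L) k<q′ g x∊g u∊ fr)) (y∊ L))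
                where
                fr : Free (Q L) k g
                fr {l} l< l≢ eq with l ≟ suc k
                ... | yes refl = g≢ eq
                ... | no l≢k = proj₂ (proj₂ (unused-rv ug)) l< l≢ l≢k eq
                Rt = rotate (Q L) k<q′ g x∊g u∊ fr
                fresh : ∀ {l} → l ≤ q → z L ≢ v Rt l
                fresh l≤ eq = z∉ L (flip-≤ (<⇒≤ k<q′) l≤) eq
                uh : Unused Rt h
                uh = rotate-unused (Q L) k<q′ g x∊g u∊ fr (proj₁ (proj₂ s)) (λ eq → proj₁ (unused-rv ug) (sym eq))
                start : v Rt 0 ∊ h
                start = subst (_∊ h) (sym (rotate-v-start (Q L) k<q′ g x∊g u∊ fr)) k∊
              at-gap : Touch q (Nbr L″ in″) q ⊎ B L″ in″ q → w L (suc k) ∊ φ L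
              at-gap (inj₂ b) = subst (w L (suc k) ∊_) (link-hi L″) b
              at-gap (inj₁ (inj₁ nb)) with Tight.twice T″ ≤-refl nb (e (Q L) k)
              ... | g , sg , y∊g , ne = ⊥-elim (via-end sg (subst (_∊ g) (rv-v (λ eq → <⇒≢ sk< (sym eq))) y∊g) ne)
              at-gap (inj₁ (inj₂ nb)) with Tight.twice T″ z≤n (subst (Nbr L″ in″) (nxt-hi q) nb) (e (Q L) (suc k))
              ... | g , sg , x∊g , ne = ⊥-elim (via-start sg (subst (_∊ g) (rv-v (λ ())) x∊g) ne)

            every-second : ∀ j → j ≤ t → w L (j + j) ∊ φ L
            every-second zero _ = x∊ L
            every-second (suc j) j≤ with m≤n⇒m<n∨m≡n j≤
            ... | inj₂ refl = subst (λ k → w L k ∊ φ L) (trans q≡ (cong (suc j +_) (+-identityʳ (suc j)))) (y∊ L)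
            ... | inj₁ lt = subst (λ k → w L k ∊ φ L) (cong suc (sym (+-suc j j)))
                (exchanged (<⇒≤ k<) (<⇒≤ k<) (step (<⇒≤ (<⇒≤ (<⇒≤ k<))) (even j (<⇒≤ (<⇒≤ (<⇒≤ (<⇒≤ k<))))))
                  (step (<⇒≤ k<) (λ nb → even (suc j) (subst (_≤ q) (cong suc (sym (+-suc j j))) (<⇒≤ (<⇒≤ k<))) (subst Near (cong suc (sym (+-suc j j))) nb))))
              where
              k< : suc (suc (suc (j + j))) < q
              k< = lia (j ∷ q ∷ τ ∷ []) (λ j q t → σ j ≺ σ t ⇒ q ≈ 2 ⊛ σ t ⇒ σ (σ (σ (j ⊕ j))) ≺ q) refl lt q≡

          gap-absurd : ⊥
          gap-absurd = <⇒≱ (s≤s ρ<τ) (s≤s⁻¹ (≤-trans (≤-trans (≤-reflexive (sym (trans (cnt-all (λ j → j <? suc t) (upTo (suc t)) ∈-upTo⁻) (length-upTo (suc t)))))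
              (indexed≤ (φ L) (λ j → j <? suc t) (suc t) (λ j → w L (j + j)) injective (λ j< _ → every-second _ (s≤s⁻¹ j<)))) (≤-reflexive r≡)))
            where
            j+j≤ : ∀ {j} → j < suc t → j + j ≤ q
            j+j≤ {j} j< = lia (j ∷ q ∷ τ ∷ []) (λ j q t → j ≺ σ (σ t) ⇒ q ≈ 2 ⊛ σ t ⇒ j ⊕ j ≼ q) refl j< q≡
            injective : ∀ {i j} → i < suc t → j < suc t → i < suc t → j < suc t → w L (i + i) ≡ w L (j + j) → i ≡ j
            injective {i} {j} i< j< _ _ eq = lia (i ∷ j ∷ []) (λ i j → i ⊕ i ≈ j ⊕ j ⇒ i ≈ j) refl (v-inj (Q L) (j+j≤ i<) (j+j≤ j<) eq)

      -- Two star edges force the tight configuration. Cutting at its one link through z makes this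
      -- link the closing edge, as `Gap` expects.
      missing-absurd : (L : Loop q) → (∀ {h u} → Star L h → u ∊ h → u ≡ z L ⊎ ∃ λ k → k ≤ q × u ≡ w L k) →
        ∀ {h h′} → Star L h → Star L h′ → h ≢ h′ → ⊥
      missing-absurd L ins {h} {h′} s s′ ne with tight L ins s s′ ne
      ... | T with Tight.exists T
      ... | k , k≤ , bk = Gap.gap-absurd loop (Tight.length≡ T) (subst₂ _∊_ (sym same-z) (sym closing) bk) (star s) (star s′) ne
        where open CutAt (cut L k k≤)

  -- Condition (c): what the missed-vertex argument says about a path

  module Context {ρ τ q : ℕ} (1≤ρ : 1 ≤ ρ) (r≡ : r ≡ suc (suc ρ)) (ρ<τ : suc ρ ≤ τ) (q≤ : q ≤ 2 * suc τ)
    (n≤ : n ≤ 2 + 2 * suc τ)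
    (deg : ∀ u → degree≥ u (suc (suc τ choose suc ρ)))
    (longest : Path (suc (suc q)) → ⊥)
    (noCycle : (P : Path (suc q)) (h : E) → Unused P h → v P 0 ∊ h → v P (suc q) ∊ h → ⊥) where

    private
      p = suc q
      t = suc τ

    open Closed longest noCycle public
    open Degrees 1≤ρ r≡ ρ<τ deg public
    open FewFree public
    open NoLongerCycle noCycle
    open Counting 1≤ρ r≡ ρ<τ q≤ deg
    open Spanning n≤

    -- The cycle v_1 ... v_p γ misses v_0. Since it does not use e_0, that link may be one of the
    -- two further edges at v_0.
    missing-start : (R : Path p) {γ h h′ : E} → v R 1 ∊ γ → v R p ∊ γ → Free R 0 γ →
      (∀ {u} → u ∊ e R 0 → ∃ λ k → k ≤ p × u ≡ v R k) →
      v R 0 ∊ h → v R 0 ∊ h′ → Free R 0 h → Free R 0 h′ → h ≢ γ → h′ ≢ γ → h ≢ h′ → ⊥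
    missing-start R {γ} {h} {h′} 1∊ p∊ frγ in₀ z∊ z∊′ fr fr′ ne ne′ = missing-absurd L ins (z∊ , un fr , ne) (z∊′ , un fr′ , ne′)
      where
      un : ∀ {h} → Free R 0 h → Unused (tail R) h
      un fr (k , k< , eq) = fr (s≤s k<) (λ ()) eq
      L : Loop q
      L = record { Q = tail R ; φ = γ ; z = v R 0 ; z∉ = λ k≤ eq → 1+n≢0 (sym (v-inj R z≤n (s≤s k≤) eq))
                 ; uφ = un frγ ; x∊ = 1∊ ; y∊ = p∊ }
      locate : ∀ {u} → (∃ λ k → k ≤ p × u ≡ v R k) → u ≡ v R 0 ⊎ ∃ λ k → k ≤ q × u ≡ v R (suc k)
      locate (zero , _ , eq) = inj₁ eq
      locate (suc k , s≤s k≤ , eq) = inj₂ (k , k≤ , eq)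
      ins : ∀ {h u} → Star L h → u ∊ h → u ≡ v R 0 ⊎ ∃ λ k → k ≤ q × u ≡ v R (suc k)
      ins {h} (z∊ , u , _) u∊ with h ≟ᶠ e R 0
      ... | yes refl = locate (in₀ u∊)
      ... | no h≢ = locate (on-path R (λ { (zero , _ , eq) → h≢ eq ; (suc k , s≤s k< , eq) → u (k , k< , eq) }) z∊ u∊)

    -- The cycle v_i ... v_0 f v_{i+2} ... v_p g misses only v_{i+1}, which is on e_i and e_{i+1}.
    no-A-after-A′ : (P : Path p) → ∀ {i} → suc i < p → (∀ {u} → u ∊ e P i → ∃ λ k → k ≤ p × u ≡ v P k) →
      A P (suc i) → A′ P i → ⊥
    no-A-after-A′ P {i} i< in₀ Ai@(f , u , x∊ , s∊) (g , u′ , y∊ , i∊) =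
      missing-start R {g} {e R 0} {e P (suc i)}
        (subst (_∊ g) (sym (rotate-v-lo P i< f x∊ s∊ fr {1} {i} refl)) i∊)
        (subst (_∊ g) (sym (rotate-v-end P i< f x∊ s∊ fr)) y∊)
        (unused⇒free R uR)
        (λ u∊ → let (k , k≤ , eq) = in₀ (subst (_ ∊_) e₀ u∊) in
                flip (suc i) k , flip-≤ (<⇒≤ i<) k≤ , trans eq (cong (v P) (sym (flip-flip (suc i) k))))
        (inl R (s≤s z≤n)) (start∊link P i< Ai) (own-free R (s≤s z≤n)) (unused⇒free R (rotateA-free P i< Ai))
        (λ eq → uR (0 , s≤s z≤n , sym eq)) (λ eq → u′ (suc i , i< , sym eq)) (λ eq → 1+n≢n (sym (e-inj P i<′ i< (trans (sym e₀) eq))))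
      where
      fr = unused⇒free P {suc i} u
      R = rotateA P i< Ai
      i<′ : i < p
      i<′ = <-trans (n<1+n i) i<
      e₀ : e R 0 ≡ e P i
      e₀ = re-lo P {suc i} {f} {0} {i} refl
      uR : Unused R g
      uR = rotateA-unused P i< Ai u′ λ { refl → noCycle P f u x∊ y∊ }

    module _ (P : Path p) where

      private R = reverse P

      -- Because of the offset between A and A′, reversal sends index i to p - 1 - i in both
      -- directions.
      A-reverse : ∀ {k b} → suc (k + b) ≡ p → A′ P b → A R k
      A-reverse {k} {b} eq (g , u , y∊ , b∊) = g , reverse-unused P u , subst (_∊ g) (sym (reverse-v P {0} {p} refl)) y∊ ,
        subst (_∊ g) (sym (reverse-v P eq)) b∊

      A′-reverse : ∀ {k b} → suc (k + b) ≡ p → A P b → A′ R k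
      A′-reverse {k} {b} eq (g , u , y∊ , b∊) = g , reverse-unused P u , subst (_∊ g) (sym (reverse-v P (+-identityʳ p))) y∊ ,
        subst (_∊ g) (sym (reverse-v P (trans (+-suc k b) eq))) b∊

      reverse-A : ∀ {k b} → suc (k + b) ≡ p → A R k → A′ P b
      reverse-A {k} {b} eq (g , u , y∊ , b∊) = g , unused-reverse P u , subst (_∊ g) (reverse-v P {0} {p} refl) y∊ ,
        subst (_∊ g) (reverse-v P eq) b∊

      reverse-A′ : ∀ {k b} → suc (k + b) ≡ p → A′ R k → A P b
      reverse-A′ {k} {b} eq (g , u , y∊ , b∊) = g , unused-reverse P u , subst (_∊ g) (reverse-v P (+-identityʳ p)) y∊ ,
        subst (_∊ g) (reverse-v P (trans (+-suc k b) eq)) b∊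

      mirror : ∀ {i} → i < p → ∃ λ k → suc (k + i) ≡ p × k < p
      mirror {i} i< with <-split i<
      ... | k , eq = k , trans (cong suc (+-comm k i)) eq , subst (k <_) eq (s≤s (m≤n+m k i))

      #A-reverse : #A′ P ≤ #A R
      #A-reverse = cnt-injection (A′? P) (A? R) (λ b k → suc (k + b) ≡ p)
        (λ {b} {b′} {k} eq eq′ → +-cancelˡ-≡ k b b′ (suc-injective (trans eq (sym eq′)))) (upTo⁺ p)
        λ {b} m a → let (k , eq , k<) = mirror (∈-upTo⁻ m) in k , ∈-upTo⁺ k< , A-reverse eq a , eq

      #A′-reverse : #A P ≤ #A′ R
      #A′-reverse = cnt-injection (A? P) (A′? R) (λ b k → suc (k + b) ≡ p)
        (λ {b} {b′} {k} eq eq′ → +-cancelˡ-≡ k b b′ (suc-injective (trans eq (sym eq′)))) (upTo⁺ p)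
        λ {b} m a → let (k , eq , k<) = mirror (∈-upTo⁻ m) in k , ∈-upTo⁺ k< , A′-reverse eq a , eq

      link-above′ : ∀ {i b} → i < p → A′ P i → b < i → v P b ∊ e P i → A P b → ⊥
      link-above′ {i} {b} i< a′ b<i b∊ a with mirror i< | mirror (<-trans b<i i<)
      ... | k , eq , k< | l , eq′ , l< = link-above R k< (A-reverse eq a′) k<l l<
          (subst₂ _∊_ (sym (reverse-v P eq′)) (sym (reverse-e P eq)) b∊) (A′-reverse eq′ a)
        where
        k<l : suc k ≤ l
        k<l = lia (k ∷ i ∷ l ∷ b ∷ p ∷ []) (λ k i l b p → σ (k ⊕ i) ≈ p ⇒ σ (l ⊕ b) ≈ p ⇒ b ≺ i ⇒ σ k ≼ l) refl eq eq′ b<i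

      #reverse-A : #A R ≤ #A′ P
      #reverse-A = cnt-injection (A? R) (A′? P) (λ b k → suc (b + k) ≡ p)
        (λ {b} {b′} {k} eq eq′ → +-cancelʳ-≡ k b b′ (suc-injective (trans eq (sym eq′)))) (upTo⁺ p)
        λ {b} m a → let (k , eq , k<) = mirror (∈-upTo⁻ m) ; eq′ = trans (cong suc (+-comm b k)) eq in k , ∈-upTo⁺ k< , reverse-A eq′ a , eq′

      #reverse-A′ : #A′ R ≤ #A P
      #reverse-A′ = cnt-injection (A′? R) (A? P) (λ b k → suc (b + k) ≡ p)
        (λ {b} {b′} {k} eq eq′ → +-cancelʳ-≡ k b b′ (suc-injective (trans eq (sym eq′)))) (upTo⁺ p)
        λ {b} m a → let (k , eq , k<) = mirror (∈-upTo⁻ m) ; eq′ = trans (cong suc (+-comm b k)) eq in k , ∈-upTo⁺ k< , reverse-A′ eq′ a , eq′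

    -- On a shorter path at most t indices would remain outside A′.
    good-end : (P : Path p) → t ≤ #A′ P → q ≡ 2 * t
    good-end P a′≥ with m≤n⇒m<n∨m≡n q≤
    ... | inj₂ eq = eq
    ... | inj₁ lt = ⊥-elim (few-free-absurd P (lia (#A′ P ∷ #N P ∷ q ∷ τ ∷ [])
            (λ a n q t → a ⊕ n ≈ σ q ⇒ q ≺ 2 ⊛ σ t ⇒ σ t ≼ a ⇒ n ≼ σ t) refl (#N+#A′ P) lt a′≥))

    best-reverse : (P : Path p) → (∀ P′ → #A P′ + #A′ P′ ≤ #A P + #A′ P) → ∀ P′ → #A P′ + #A′ P′ ≤ #A (reverse P) + #A′ (reverse P)
    best-reverse P best P′ = ≤-trans (best P′) (≤-trans (+-mono-≤ (#A′-reverse P) (#A-reverse P)) (≤-reflexive (+-comm (#A′ (reverse P)) (#A (reverse P)))))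

    -- Condition (c): Hamiltonian paths with t neighbours at each end

    module Full (q≡ : q ≡ 2 * suc τ) where

      on-P : (P : Path p) → ∀ u → ∃ λ k → k ≤ p × u ≡ v P k
      on-P P u with on-path? P u
      ... | yes (k , k< , eq) = k , s≤s⁻¹ k< , eq
      ... | no off = ⊥-elim (<⇒≱ (subst (λ m → suc (suc m) ≤ cnt all? (allFin n)) (cong suc q≡) many) (≤-trans (cnt≤length all? (allFin n))
          (≤-trans (≤-reflexive (length-tabulate (λ x → x))) n≤)))
        where
        all? : ∀ (x : V) → Dec (x ≡ x)
        all? x = x ≟ᶠ x
        many : suc (suc p) ≤ cnt all? (allFin n)
        many = ≤-trans (≤-trans (≤-reflexive (+-comm 1 (suc p))) (+-mono-≤ (#on-path≥ P) (cnt≥1 (λ x → x ≟ᶠ u) (∈-allFin u) refl)))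
          (cnt-disjoint (on-path? P) (λ x → x ≟ᶠ u) all? (allFin n) (λ _ _ → refl) (λ _ _ → refl) λ { _ o refl → off o })

      A′≤ : (P : Path p) → #A′ P ≤ t
      A′≤ P = ≮⇒≥ λ lt → few-free-absurd P (lia (#A′ P ∷ #N P ∷ q ∷ τ ∷ [])
        (λ a n q t → a ⊕ n ≈ σ q ⇒ q ≈ 2 ⊛ σ t ⇒ σ t ≺ a ⇒ n ≼ σ t) refl (#N+#A′ P) q≡ lt)

      A≤ : (P : Path p) → #A P ≤ t
      A≤ P = ≤-trans (cnt-injection (A? P) (A′? R) (λ i k → suc (k + i) ≡ p) (λ {i} {i′} {k} eq eq′ → +-cancelˡ-≡ k i i′ (suc-injective (trans eq (sym eq′)))) (upTo⁺ p)
          λ {i} m Ai → let (k , eq) = <-split (∈-upTo⁻ m) in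
            k , ∈-upTo⁺ (subst (k <_) eq (s≤s (m≤n+m k i))) , A′R (trans (cong suc (+-comm k i)) eq) Ai , trans (cong suc (+-comm k i)) eq) (A′≤ R)
        where
        R = reverse P
        A′R : ∀ {i k} → suc (k + i) ≡ p → A P i → A′ R k
        A′R {i} {k} eq (f , u , x∊ , s∊) = f , reverse-unused P u , subst (_∊ f) (sym (reverse-v P (+-identityʳ p))) x∊ ,
          subst (_∊ f) (sym (reverse-v P (trans (+-suc k i) eq))) s∊

      A-after-A′-absurd : (P : Path p) → ∀ {i} → suc i < p → A P (suc i) → A′ P i → ⊥
      A-after-A′-absurd P i< = no-A-after-A′ P i< (λ {u} _ → on-P P u)

      -- The cycle v_i ... v_0 e_{i+1} v_{i+2} ... v_p g misses only v_{i+1}, which would be on e_i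
      -- and on h.
      bypass : (P : Path p) → ∀ {i h} → suc i < p → D P (suc i) → A′ P i → Unused P h → v P (suc i) ∊ h → ⊥
      bypass P {i} {h} i< x∊ a′@(g , u′ , y∊ , i∊) u z∊ =
        missing-start R {g} {e R 0} {h}
          (subst (_∊ g) (sym (rotate-v-lo P i< (e P (suc i)) x∊ (inr P i<) (own-free P i<) {1} {i} refl)) i∊)
          (subst (_∊ g) (sym (rotate-v-end P i< (e P (suc i)) x∊ (inr P i<) (own-free P i<))) y∊)
          (unused⇒free R (rotateD-unused P i< x∊ u′)) (λ {u} _ → on-P R u)
          (inl R (s≤s z≤n)) (subst (_∊ h) (sym (rotateD-start P i< x∊)) z∊) (own-free R (s≤s z≤n)) (unused⇒free R uR)
          (λ eq → rotateD-unused P i< x∊ u′ (0 , s≤s z≤n , sym eq)) (λ { refl → D∩A′ P i< x∊ (h , u , y∊ , z∊) })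
          (λ eq → uR (0 , s≤s z≤n , sym eq))
        where
        R = rotateD P i< x∊
        uR : Unused R h
        uR = rotateD-unused P i< x∊ u

      -- The cycle v_0 … v_j g v_p … v_{i+2} e_{i+1} v_{j+2} … v_{i+1} f, which misses v_{j+1}.
      link-inside-missing : (P : Path p) → ∀ {i j} → suc i < p → A P i → suc j < i → v P (suc (suc j)) ∊ e P (suc i) → A′ P j → ⊥
      link-inside-missing P {i} {j} i< (f , u , x∊f , s∊f) j<i w∊ (g , u′ , y∊g , j∊g) with <-split j<i
      ... | k , refl = missing-absurd L ins {e Tn 0} {e P j} (inl Tn (s≤s z≤n) , un₀ , f≢) (zj∊ , unj , λ eq → u (j , j< , sym eq))
              (λ eq → turn-free P j< g y∊g j∊g fr (λ eq → u′ (j , j< , sym eq)) (0 , s≤s z≤n , sym eq))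
        where
        i′ = suc (suc (j + k))
        fr = unused⇒free P {j} u′
        j< : j < p
        j< = <-trans (n<1+n j) (<-trans j<i (<-trans (n<1+n i′) i<))
        Tn = turn P j< g y∊g j∊g fr
        T₁ = tail Tn
        tv : ∀ {m} → suc (j + m) ≤ p → v Tn m ≡ v P (suc (j + m))
        tv = turn-v P j< g y∊g j∊g fr
        te : ∀ {m} → suc (suc (j + m)) ≤ p → e Tn m ≡ e P (suc (j + m))
        te = turn-e P j< g y∊g j∊g fr
        -- The link e_{i+1} has index k + 1 in T₁.
        idx : suc (j + suc (suc k)) ≡ suc i′
        idx = lia (j ∷ k ∷ []) (λ j k → σ (j ⊕ σ (σ k)) ≈ σ (σ (σ (j ⊕ k)))) refl
        k+1< : suc k < q
        k+1< = lia (j ∷ k ∷ q ∷ []) (λ j k q → σ (σ (σ (j ⊕ k))) ≺ σ q ⇒ σ k ≺ q) refl i<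
        elink : e T₁ (suc k) ≡ e P (suc i′)
        elink = trans (te {suc (suc k)} (subst (λ m → suc m ≤ p) (sym idx) i<)) (cong (e P) idx)
        start∊ : v T₁ 0 ∊ e T₁ (suc k)
        start∊ = subst₂ _∊_ (sym (trans (tv {1} (lia (j ∷ k ∷ q ∷ []) (λ j k q → σ (σ (σ (j ⊕ k))) ≺ σ q ⇒ σ (j ⊕ con 1) ≼ σ q) refl i<)) (cong (λ m → v P (suc m)) (+-comm j 1)))) (sym elink) w∊
        Q₁ = rotate T₁ k+1< (e T₁ (suc k)) start∊ (inr T₁ k+1<) (own-free T₁ k+1<)
        uf : Unused Tn f
        uf = turn-unused P j< g y∊g j∊g fr u (λ { refl → noCycle P f u x∊f y∊g })
        Q₁-unused : ∀ {h} → Unused T₁ h → Unused Q₁ h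
        Q₁-unused {h} uh = rotate-unused T₁ k+1< _ start∊ (inr T₁ k+1<) (own-free T₁ k+1<) uh (λ eq → uh (_ , k+1< , eq))
        T₁-unused : ∀ {h} → Unused Tn h → Unused T₁ h
        T₁-unused uh (m , m< , eq) = uh (suc m , s≤s m< , eq)
        L : Loop q
        L = record
          { Q = Q₁ ; φ = f ; z = v Tn 0
          ; z∉ = λ {m} m≤ eq → 1+n≢0 (sym (v-inj Tn z≤n (s≤s (flip-≤ (<⇒≤ k+1<) m≤)) eq))
          ; uφ = Q₁-unused (T₁-unused uf)
          ; x∊ = subst (_∊ f) (sym (trans (rotate-v-start T₁ k+1< _ start∊ (inr T₁ k+1<) (own-free T₁ k+1<))
                   (trans (tv {suc (suc k)} (subst (_≤ p) (sym idx) (<⇒≤ i<))) (cong (v P) idx)))) s∊f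
          ; y∊ = subst (_∊ f) (sym (trans (rotate-v-end T₁ k+1< _ start∊ (inr T₁ k+1<) (own-free T₁ k+1<)) (turn-end P j< g y∊g j∊g fr))) x∊f }
        ins : ∀ {h u} → Star L h → u ∊ h → u ≡ v Tn 0 ⊎ ∃ λ m → m ≤ q × u ≡ v Q₁ m
        ins {u = u} _ _ with on-P Tn u
        ... | zero , _ , eq = inj₁ eq
        ... | suc m , s≤s m≤ , eq = inj₂ (flip (suc k) m , flip-≤ (<⇒≤ k+1<) m≤ , trans eq (cong (v T₁) (sym (flip-flip (suc k) m))))
        un₀ : Unused Q₁ (e Tn 0)
        un₀ = Q₁-unused λ (m , m< , eq) → 1+n≢0 (sym (e-inj Tn (s≤s z≤n) (s≤s m<) eq))
        f≢ : e Tn 0 ≢ f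
        f≢ eq = uf (0 , s≤s z≤n , sym eq)
        zj∊ : v Tn 0 ∊ e P j
        zj∊ = subst (_∊ e P j) (sym (turn-start P j< g y∊g j∊g fr)) (inr P j<)
        unj : Unused Q₁ (e P j)
        unj = Q₁-unused (T₁-unused (turn-free P j< g y∊g j∊g fr (λ eq → u′ (j , j< , sym eq))))

      -- Two disjoint sets of size t leave exactly one of the 2 t + 1 indices, the gap κ.
      record Balanced (P : Path p) (κ : ℕ) : Set where
        field
          κ< : κ < p
          #A≥ : t ≤ #A P
          #A′≥ : t ≤ #A′ P
          ¬A : ¬ A P κ
          ¬A′ : ¬ A′ P κ
          each : ∀ {k} → k < p → A P k ⊎ A′ P k ⊎ k ≡ κ

      balanced : (P : Path p) → t ≤ #A P → t ≤ #A′ P → ∃ (Balanced P)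
      balanced P a≥ a′≥ with cnt-differ both? (λ k → k <? p) (upTo p) (≤-trans (s≤s both≤) (≤-reflexive (sym (trans (cnt-all (λ k → k <? p) (upTo p) ∈-upTo⁻) (length-upTo p)))))
        where
        both? : ∀ k → Dec (A P k ⊎ A′ P k)
        both? k = A? P k ⊎-dec A′? P k
        both≤ : cnt both? (upTo p) ≤ q
        both≤ = ≤-trans (cnt-cover both? (A? P) (A′? P) (upTo p) (λ _ h → h))
          (lia (#A P ∷ #A′ P ∷ q ∷ τ ∷ []) (λ a b q t → a ≼ σ t ⇒ b ≼ σ t ⇒ q ≈ 2 ⊛ σ t ⇒ a ⊕ b ≼ q) refl (A≤ P) (A′≤ P) q≡)
      ... | κ , m , κ< , none = κ , record
        { κ< = κ< ; #A≥ = a≥ ; #A′≥ = a′≥ ; ¬A = λ a → none (inj₁ a) ; ¬A′ = λ a → none (inj₂ a)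
        ; each = cnt-upTo-full all? p full }
        where
        all? : ∀ k → Dec (A P k ⊎ A′ P k ⊎ k ≡ κ)
        all? k = A? P k ⊎-dec (A′? P k ⊎-dec (k ≟ κ))
        rest? : ∀ k → Dec (A′ P k ⊎ k ≡ κ)
        rest? k = A′? P k ⊎-dec (k ≟ κ)
        full : p ≤ cnt all? (upTo p)
        full = lia (#A P ∷ #A′ P ∷ cnt (λ k → k ≟ κ) (upTo p) ∷ cnt rest? (upTo p) ∷ cnt all? (upTo p) ∷ q ∷ τ ∷ [])
          (λ a b c d f q t → σ t ≼ a ⇒ σ t ≼ b ⇒ con 1 ≼ c ⇒ b ⊕ c ≼ d ⇒ a ⊕ d ≼ f ⇒ q ≈ 2 ⊛ σ t ⇒ σ q ≼ f) refl
          a≥ a′≥ (cnt≥1 (λ k → k ≟ κ) (∈-upTo⁺ κ<) refl)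
          (cnt-disjoint (A′? P) (λ k → k ≟ κ) rest? (upTo p) (λ _ → inj₁) (λ _ → inj₂) λ { _ a refl → none (inj₂ a) })
          (cnt-disjoint (A? P) rest? all? (upTo p) (λ _ → inj₁) (λ _ → inj₂)
            λ { m a (inj₁ a′) → A∩A′ P (∈-upTo⁻ m) a a′ ; _ a (inj₂ refl) → none (inj₁ a) }) q≡

      balanced-reverse : (P : Path p) → ∀ {κ κ′} → suc (κ′ + κ) ≡ p → Balanced P κ → Balanced (reverse P) κ′
      balanced-reverse P {κ} {κ′} eq b = record
        { κ< = subst (κ′ <_) eq (s≤s (m≤m+n κ′ κ))
        ; #A≥ = ≤-trans #A′≥ (#A-reverse P) ; #A′≥ = ≤-trans #A≥ (#A′-reverse P)
        ; ¬A = λ a → ¬A′ (reverse-A P eq a) ; ¬A′ = λ a → ¬A (reverse-A′ P eq a)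
        ; each = each′ }
        where
        open Balanced b
        each′ : ∀ {k} → k < p → A (reverse P) k ⊎ A′ (reverse P) k ⊎ k ≡ κ′
        each′ {k} k< with mirror P k<
        ... | l , eq′ , l< with each l<
        ... | inj₁ a = inj₂ (inj₁ (A′-reverse P (trans (cong suc (+-comm k l)) eq′) a))
        ... | inj₂ (inj₁ a) = inj₁ (A-reverse P (trans (cong suc (+-comm k l)) eq′) a)
        ... | inj₂ (inj₂ refl) = inj₂ (inj₂ (+-cancelʳ-≡ l k κ′ (suc-injective (trans (trans (cong suc (+-comm k l)) eq′) (sym eq)))))

      -- Suppose that A′ contains the index just before the gap. Then every link at v_0 lies within
      -- v_0 and its neighbours, which contradicts `all-inside`; so A′ never reaches the gap from
      -- the left.
      module Left (P : Path p) {κ′ : ℕ} (bal : Balanced P (suc κ′)) (A′κ′ : A′ P κ′) where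

        open Balanced bal

        private
          κ = suc κ′
          κ′< : κ′ < p
          κ′< = <-trans (n<1+n κ′) κ<
          0<κ′ : 0 < κ′
          0<κ′ = ≰⇒> λ { z≤n → start-N P A′κ′ }
          0< = positive P
          A0 : A P 0
          A0 with each 0<
          ... | inj₁ a = a
          ... | inj₂ (inj₁ a′) = ⊥-elim (start-N P a′)
          τ≥2 : 2 ≤ τ
          τ≥2 = ≤-trans (s≤s 1≤ρ) ρ<τ

          N-rotateD : ∀ {i} (i< : i < p) (x∊ : D P i) → #N (rotateD P i< x∊) ≤ suc t
          N-rotateD i< x∊ = lia (#A′ P ∷ #A′ P₂ ∷ #N P₂ ∷ q ∷ τ ∷ []) (λ a b n q t → σ t ≼ a ⇒ a ≼ b ⇒ b ⊕ n ≈ σ q ⇒ q ≈ 2 ⊛ σ t ⇒ n ≼ σ (σ t)) refl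
              #A′≥ (#A′-rotateD P i< x∊) (#N+#A′ P₂) q≡
            where P₂ = rotateD P i< x∊

          -- The freed e_i would put κ into A, directly after κ′ in A′.
          no-early-link : ∀ {i} → i < κ → A P i → v P (suc κ) ∊ e P i → ⊥
          no-early-link {i} i<κ Ai w∊ = A-after-A′-absurd P₁ κ<
              (e P i , rotateA-free P i< Ai , start∊link P i< Ai , subst (_∊ e P i) (sym (cong (v P) (flip-hi (<-trans i<κ (n<1+n κ))))) w∊)
              (subst (A′ P₁) (flip-hi i<κ′) (rotateA-A′ P i< Ai A′κ′))
            where
            i< : i < p
            i< = <-trans i<κ κ<
            P₁ = rotateA P i< Ai
            i<κ′ : i < κ′
            i<κ′ = ≤∧≢⇒< (s≤s⁻¹ i<κ) λ { refl → A∩A′ P i< Ai A′κ′ }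

          gap∌start : D P κ → ⊥
          gap∌start x∊ = by-1 (A′? P 1)
            where
            P₂ = rotateD P κ< x∊
            none : ∀ {h} → Unused P h → v P κ ∊ h → ⊥
            none = bypass P κ< x∊ A′κ′
            A₂-none : #A P₂ ≡ 0
            A₂-none = cnt-none (A? P₂) (upTo p) λ { _ (h , u , z∊ , _) → none (unused-rotateD P κ< x∊ u) (subst (_∊ h) (rotateD-start P κ< x∊) z∊) }
            full : ∀ {i} → i < p → ¬ A′ P₂ i → D P₂ i
            full = D-full P₂ (≤-trans (N-rotateD κ< x∊) (fewer-D P₂ (≤-trans (s≤s (≤-reflexive A₂-none)) (≤-trans (s≤s z≤n) τ≥2))))
            by-1 : Dec (A′ P 1) → ⊥
            by-1 (no ¬1) = link-above P 0< A0 0<κ′ κ′< v∊ A′κ′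
              where
              v∊ : v P κ ∊ e P 0
              v∊ = subst₂ _∊_ (rotateD-start P κ< x∊) (re-lo P {κ} {e P κ} {κ′} {0} (cong suc (+-identityʳ κ′)))
                     (full κ′< λ a′ → ¬1 (subst (A′ P) (flip-lo (+-comm κ′ 1)) (A′-rotateD P κ< x∊ a′)))
            -- Now A′ fills 1, ..., κ′, so A is 0 together with a block directly after the gap. The
            -- block has at least two members because t ≥ 3, and e_{κ+2} gives the crossing.
            by-1 (yes A′1) = block ((suc κ <? p) ×-dec A? P (suc κ)) ((suc (suc κ) <? p) ×-dec A? P (suc (suc κ)))
              where
              low : ∀ l → suc l < κ → A′ P (suc l)
              low zero _ = A′1
              low (suc l) l< with each (<-trans l< κ<)
              ... | inj₁ a = ⊥-elim (A-after-A′-absurd P (<-trans l< κ<) a (low l (<-trans (n<1+n _) l<)))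
              ... | inj₂ (inj₁ a′) = a′
              ... | inj₂ (inj₂ refl) = ⊥-elim (<-irrefl refl l<)
              above : ∀ m → suc (κ + m) < p → A P (suc (κ + m)) → m ≡ 0 ⊎ ∃ λ m′ → m ≡ suc m′ × A P (suc (κ + m′))
              above zero _ _ = inj₁ refl
              above (suc m) m< a with each {suc (κ + m)} (<-trans (n<1+n _) (subst (λ k → suc k < p) (+-suc κ m) m<))
              ... | inj₁ a⁻ = inj₂ (m , refl , a⁻)
              ... | inj₂ (inj₁ a′) = ⊥-elim (A-after-A′-absurd P (subst (λ k → suc k < p) (+-suc κ m) m<) (subst (λ k → A P (suc k)) (+-suc κ m) a) a′)
              ... | inj₂ (inj₂ eq) = ⊥-elim (m≢1+m+n κ (sym eq))
              few-A : ∀ {c} → (∀ {m} → suc (κ + m) < p → A P (suc (κ + m)) → m < c) → #A P ≤ suc c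
              few-A {c} f = ≤-trans (cnt-injection (A? P) (λ j → j <? suc c) (λ k j → (k ≡ 0 × j ≡ 0) ⊎ ∃ λ m → k ≡ suc (κ + m) × j ≡ suc m) inj (upTo⁺ p)
                    λ {k} mem a → place k (∈-upTo⁻ mem) a) (cnt-upTo≤ (λ j → j <? suc c) (suc c))
                where
                inj : ∀ {x x′ y} → (x ≡ 0 × y ≡ 0) ⊎ (∃ λ m → x ≡ suc (κ + m) × y ≡ suc m) → (x′ ≡ 0 × y ≡ 0) ⊎ (∃ λ m → x′ ≡ suc (κ + m) × y ≡ suc m) → x ≡ x′
                inj (inj₁ (refl , refl)) (inj₁ (refl , _)) = refl
                inj (inj₂ (m , refl , refl)) (inj₂ (.m , refl , refl)) = refl
                place : ∀ k → k < p → A P k → ∃ λ j → j ∈ upTo (suc c) × j < suc c × ((k ≡ 0 × j ≡ 0) ⊎ ∃ λ m → k ≡ suc (κ + m) × j ≡ suc m)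
                place zero _ _ = 0 , ∈-upTo⁺ (s≤s z≤n) , s≤s z≤n , inj₁ (refl , refl)
                place (suc k) k< a with <-cmp (suc k) κ
                ... | tri< lt _ _ = ⊥-elim (A∩A′ P k< a (low k lt))
                ... | tri≈ _ refl _ = ⊥-elim (¬A a)
                ... | tri> _ _ gt with <-split gt
                ... | m , refl = suc m , ∈-upTo⁺ (s≤s (f k< a)) , s≤s (f k< a) , inj₂ (m , refl , refl)
              block : Dec (suc κ < p × A P (suc κ)) → Dec (suc (suc κ) < p × A P (suc (suc κ))) → ⊥
              block (no ¬1) _ = <⇒≱ (s≤s (≤-trans (s≤s z≤n) τ≥2)) (≤-trans #A≥ (few-A {0} (λ {m} m< a → ⊥-elim (empty m m< a))))
                where
                empty : ∀ m → suc (κ + m) < p → ¬ A P (suc (κ + m))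
                empty m m< a with above m m< a
                ... | inj₁ refl = ¬1 (subst (λ k → suc k < p × A P (suc k)) (+-identityʳ κ) (m< , a))
                ... | inj₂ (m′ , refl , a⁻) = empty m′ (<-trans (n<1+n _) (subst (λ k → suc k < p) (+-suc κ m′) m<)) a⁻
              block (yes _) (no ¬2) = <⇒≱ (s≤s τ≥2) (≤-trans #A≥ (few-A {1} (λ {m} → only m)))
                where
                only : ∀ m → suc (κ + m) < p → A P (suc (κ + m)) → m < 1
                only zero _ _ = s≤s z≤n
                only (suc m) m< a with above (suc m) m< a
                ... | inj₂ (m′ , refl , a⁻) with only m′ (<-trans (n<1+n _) (subst (λ k → suc k < p) (+-suc κ m′) m<)) a⁻
                ... | s≤s z≤n = ⊥-elim (¬2 (subst (λ k → suc k < p × A P (suc k)) (+-comm κ 1) (m< , a)))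
              block (yes (_ , A1)) (yes (2< , A2)) = link-inside P 2< A1 (s≤s (n≤1+n κ′)) v∊ A′κ′
                where
                v∊ : v P κ ∊ e P (suc (suc κ))
                v∊ = subst₂ _∊_ (rotateD-start P κ< x∊) (rotateD-e-≥ P κ< x∊ (≤-trans (n≤1+n κ) (n≤1+n (suc κ))))
                  (full 2< λ a′ → A∩A′ P 2< A2 (subst (A′ P) (flip-hi (s≤s (n≤1+n κ))) (A′-rotateD P κ< x∊ a′)))

          -- The rotations along f and along e_i have the same start. The freed e_i gives the first
          -- two more members of A, so the second has fewer than τ, and its start v_i is on all
          -- links with index outside A′. One of these is e_0, which `no-early-link` excludes.
          next∌start : suc κ < p → D P (suc κ) → A P (suc κ) → ⊥
          next∌start i< x∊ Ai = no-early-link (s≤s z≤n) A0 v∊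
            where
            i = suc κ
            P₁ = rotateA P i< Ai
            P₂ = rotateD P i< x∊
            f = proj₁ Ai
            ¬1 : ¬ A′ P 1
            ¬1 = link-below P i< Ai (s≤s z≤n) x∊
            start₂ : v P₂ 0 ≡ v P i
            start₂ = rotateD-start P i< x∊
            keep : ∀ {k} → A P₂ k → A P₁ k
            keep (h , u , z∊ , k∊) = h , rotateA-unused P i< Ai u′ h≢f , z∊ , k∊
              where
              u′ = unused-rotateD P i< x∊ u
              h≢f : h ≢ f
              h≢f refl = ¬A (f , u′ , proj₁ (proj₂ (proj₂ Ai)) , subst (_∊ f) start₂ z∊)
            new₁ : A P₁ i
            new₁ = e P i , rotateA-free P i< Ai , start∊link P i< Ai , subst (_∊ e P i) (cong (v P) (sym (flip-hi (n<1+n i)))) (inr P i<)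
            new₂ : A P₁ κ
            new₂ = e P i , rotateA-free P i< Ai , start∊link P i< Ai , subst (_∊ e P i) (cong (v P) (sym (flip-lo (+-identityʳ i)))) x∊
            old₂ : ¬ A P₂ κ
            old₂ (h , u , z∊ , k∊) = ¬A (h , unused-rotateD P i< x∊ u , subst (_∊ h) (cong (v P) (flip-lo (+-identityʳ i))) k∊ , subst (_∊ h) start₂ z∊)
            old₁ : ¬ A P₂ i
            old₁ (h , u , z∊ , k∊) = <⇒≱ (≤-trans (s≤s #A≥) more) (A≤ P₃)
              where
              u′ = unused-rotateD P i< x∊ u
              z∊′ = subst (_∊ h) start₂ z∊
              s∊′ = subst (_∊ h) (cong (v P) (flip-hi (n<1+n i))) k∊
              fr = unused⇒free P {i} u′
              P₃ = replace P i h z∊′ s∊′ fr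
              grown? : ∀ k → Dec (A P k ⊎ k ≡ κ)
              grown? k = A? P k ⊎-dec (k ≟ κ)
              grow : ∀ {k} → A P k ⊎ k ≡ κ → A P₃ k
              grow (inj₁ (f′ , uf , x∊f , k∊)) = f′ , replace-unused P z∊′ s∊′ fr uf (λ { refl → ¬A (h , u′ , x∊f , z∊′) }) , x∊f , k∊
              grow (inj₂ refl) = e P i , replace-unused-mid P z∊′ s∊′ fr i< (λ eq → u′ (i , i< , sym eq)) , x∊ , inl P i<
              more : suc (#A P) ≤ #A P₃
              more = ≤-trans (≤-reflexive (+-comm 1 (#A P))) (≤-trans (+-monoʳ-≤ (#A P) (cnt≥1 (λ k → k ≟ κ) (∈-upTo⁺ κ<) refl))
                (≤-trans (cnt-disjoint (A? P) (λ k → k ≟ κ) grown? (upTo p) (λ _ → inj₁) (λ _ → inj₂) λ { _ a refl → ¬A a })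
                  (cnt-mono grown? (A? P₃) (upTo p) λ _ → grow)))
            two-more : suc (suc (#A P₂)) ≤ #A P₁
            two-more = lia (#A P₂ ∷ cnt (λ k → k ≟ i) (upTo p) ∷ cnt (λ k → k ≟ κ) (upTo p) ∷ cnt g₁? (upTo p) ∷ #A P₁ ∷ [])
                (λ a b c g d → con 1 ≼ b ⇒ con 1 ≼ c ⇒ b ⊕ c ≼ g ⇒ a ⊕ g ≼ d ⇒ σ (σ a) ≼ d) refl
                (cnt≥1 (λ k → k ≟ i) (∈-upTo⁺ i<) refl) (cnt≥1 (λ k → k ≟ κ) (∈-upTo⁺ κ<) refl)
                (cnt-disjoint (λ k → k ≟ i) (λ k → k ≟ κ) g₁? (upTo p) (λ _ → inj₁) (λ _ → inj₂) λ { _ refl () })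
                (cnt-disjoint (A? P₂) g₁? (A? P₁) (upTo p) (λ _ → keep) (λ { _ (inj₁ refl) → new₁ ; _ (inj₂ refl) → new₂ })
                  λ { _ a (inj₁ refl) → old₁ a ; _ a (inj₂ refl) → old₂ a })
              where
              g₁? : ∀ k → Dec (k ≡ i ⊎ k ≡ κ)
              g₁? k = (k ≟ i) ⊎-dec (k ≟ κ)
            v∊ : v P (suc κ) ∊ e P 0
            v∊ = subst₂ _∊_ start₂ (re-lo P {i} {e P i} {κ} {0} (cong suc (+-identityʳ κ)))
              (D-full P₂ (≤-trans (N-rotateD i< x∊) (fewer-D P₂ (s≤s⁻¹ (≤-trans two-more (A≤ P₁))))) κ<
                λ a′ → ¬1 (subst (A′ P) (flip-lo (+-comm κ 1)) (A′-rotateD P i< x∊ a′)))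

        left-absurd : ⊥
        left-absurd = <⇒≱ (all-inside P contained) (C-mono (suc ρ) (A≤ P))
          where
          contained : ∀ {i} → i < p → D P i → ∀ {w} → w ∊ e P i → Inside P w
          contained {i} i< x∊ {w} w∊ with inside? P w | on-P P w | each i<
          ... | yes h | _ | _ = h
          ... | no out | zero , _ , eq | _ = ⊥-elim (out (inj₁ eq))
          ... | no out | suc l , l< , refl | inj₂ (inj₂ refl) = ⊥-elim (gap∌start x∊)
          ... | no out | suc l , l< , refl | inj₂ (inj₁ a′) = ⊥-elim (D∩A′ P i< x∊ a′)
          ... | no out | suc l , l< , refl | inj₁ Ai = ⊥-elim (place (<-cmp l i) (each l<))
            where
            place : _ → A P l ⊎ A′ P l ⊎ l ≡ κ → ⊥
            place _ (inj₁ Al) = out (inj₂ (l , l< , Al , refl))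
            place (tri< lt _ _) o = before i refl
              where
              before : ∀ k → i ≡ k → ⊥
              before zero refl = <⇒≱ lt z≤n
              before (suc i′) refl with each (<-trans (n<1+n i′) i<)
              ... | inj₂ (inj₁ a′) = A-after-A′-absurd P i< Ai a′
              ... | inj₂ (inj₂ refl) = next∌start i< x∊ Ai
              ... | inj₁ Ai′ = inner (m≤n⇒m<n∨m≡n (s≤s⁻¹ lt)) o
                where
                inner : l < i′ ⊎ l ≡ i′ → A P l ⊎ A′ P l ⊎ l ≡ κ → ⊥
                inner (inj₂ refl) _ = out (inj₂ (l , l< , Ai′ , refl))
                inner (inj₁ lt′) (inj₁ Al) = out (inj₂ (l , l< , Al , refl))
                inner (inj₁ lt′) (inj₂ (inj₁ a′)) = link-inside P i< Ai′ lt′ w∊ a′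
                inner (inj₁ lt′) (inj₂ (inj₂ refl)) = link-inside-missing P i< Ai′ lt′ w∊ A′κ′
            place (tri≈ _ refl _) _ = out (inj₂ (l , l< , Ai , refl))
            place (tri> _ _ gt) (inj₂ (inj₁ a′)) = link-above P i< Ai gt l< w∊ a′
            place (tri> _ _ gt) (inj₂ (inj₂ refl)) = no-early-link gt Ai w∊

      private
        -- A cannot directly follow A′, so a member of A′ below κ would spread up to κ - 1, which
        -- `Left` excludes.
        low : (P : Path p) → ∀ {κ} → Balanced P κ → ∀ {l} → l < κ → A P l
        low P {suc κ′} bal {l} l<κ with Balanced.each bal (<-trans l<κ (Balanced.κ< bal))
        ... | inj₁ a = a
        ... | inj₂ (inj₂ refl) = ⊥-elim (<-irrefl refl l<κ)
        ... | inj₂ (inj₁ a′) = ⊥-elim (climb (proj₁ (≤-split (s≤s⁻¹ l<κ))) l (proj₂ (≤-split (s≤s⁻¹ l<κ))) a′)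
          where
          open Balanced bal
          climb : ∀ m l → l + m ≡ κ′ → A′ P l → ⊥
          climb zero l eq a′ = Left.left-absurd P bal (subst (A′ P) (trans (sym (+-identityʳ l)) eq) a′)
          climb (suc m) l eq a′ with each {suc l} sl<
            where
            sl< : suc l < p
            sl< = lia (l ∷ m ∷ κ′ ∷ p ∷ []) (λ l m k p → l ⊕ σ m ≈ k ⇒ σ k ≺ p ⇒ σ l ≺ p) refl eq κ<
          ... | inj₁ a = A-after-A′-absurd P (lia (l ∷ m ∷ κ′ ∷ p ∷ []) (λ l m k p → l ⊕ σ m ≈ k ⇒ σ k ≺ p ⇒ σ l ≺ p) refl eq κ<) a a′
          ... | inj₂ (inj₁ a″) = climb m (suc l) (trans (sym (+-suc l m)) eq) a″
          ... | inj₂ (inj₂ refl) = m≢1+m+n l (sym (trans (sym (+-suc l m)) eq))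

        mirror-κ : (P : Path p) → ∀ {κ} → Balanced P κ → ∃ λ κ′ → suc (κ′ + κ) ≡ p × Balanced (reverse P) κ′
        mirror-κ P bal = let (κ′ , eq , _) = mirror P (Balanced.κ< bal) in κ′ , eq , balanced-reverse P eq bal

        high : (P : Path p) → ∀ {κ} → Balanced P κ → ∀ {l} → κ < l → l < p → A′ P l
        high P {κ} bal {l} κ<l l< with mirror-κ P bal | mirror P l<
        ... | κ′ , eq , balR | k , eq′ , _ = reverse-A P eq′ (low (reverse P) balR
              (lia (k ∷ l ∷ κ ∷ κ′ ∷ p ∷ []) (λ k l a b p → σ (b ⊕ a) ≈ p ⇒ σ (k ⊕ l) ≈ p ⇒ a ≺ l ⇒ k ≺ b) refl eq eq′ κ<l))

        -- This is `all-inside` for the reversed path. Crossings exclude all ways in which a link at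
        -- v_p could leave the neighbourhood of v_p, except the two that are excluded by hypothesis.
        end-excess : (P : Path p) → ∀ {κ} → Balanced P κ → ¬ D′ P κ → (∀ {i} → κ < i → i < p → ¬ v P κ ∊ e P i) → ⊥
        end-excess P {κ} bal ¬D′κ ¬Y = <⇒≱ (all-inside R contained) (C-mono (suc ρ) (A≤ R))
          where
          R = reverse P
          contained : ∀ {k} → k < p → D R k → ∀ {w} → w ∊ e R k → Inside R w
          contained {k} k< y∊ {w} w∊ with mirror P k<
          ... | i , eq , i< = by-place (<-cmp i κ)
            where
            eq′ : suc (k + i) ≡ p
            eq′ = trans (cong suc (+-comm k i)) eq
            y∊′ : D′ P i
            y∊′ = subst₂ _∊_ (reverse-v P {0} {p} refl) (reverse-e P eq′) y∊
            w∊′ : w ∊ e P i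
            w∊′ = subst (w ∊_) (reverse-e P eq′) w∊
            by-place : _ → Inside R w
            by-place (tri< lt _ _) = ⊥-elim (A∩D′ P i< (low P bal lt) y∊′)
            by-place (tri≈ _ refl _) = ⊥-elim (¬D′κ y∊′)
            by-place (tri> _ _ gt) with on-P P w
            ... | l , l≤ , refl with m≤n⇒m<n∨m≡n l≤
            ... | inj₂ refl = inj₁ (sym (reverse-v P {0} {p} refl))
            ... | inj₁ l< with <-cmp l κ
            ... | tri< lt _ _ = ⊥-elim (link-above′ P i< (high P bal gt i<) (<-trans lt gt) w∊′ (low P bal lt))
            ... | tri≈ _ refl _ = ⊥-elim (¬Y gt i< w∊′)
            ... | tri> _ _ κ<l = let (m , eq″ , m<) = mirror P l< in
                    inj₂ (m , m< , A-reverse P eq″ (high P bal κ<l l<) , sym (reverse-v P eq″))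

        -- Freeing e_i puts κ into A of the rotated path. Crossings in that path exclude both
        -- exceptions of `end-excess`.
        no-X : (P : Path p) → ∀ {κ} → Balanced P κ → ∀ {i} → i < κ → v P (suc κ) ∊ e P i → ⊥
        no-X P {κ} bal {i} i<κ w∊ = end-excess P bal
            (λ y∊ → A∩D′ P₁ κ< Aκ (subst₂ _∊_ (sym (rotateA-end P i< Ai)) (sym (re-hi P i<κ)) y∊))
            (λ {i′} κ<i′ i′< v∊ → link-above′ P₁ i′< (subst (A′ P₁) (flip-hi (<-trans i<κ κ<i′)) (rotateA-A′ P i< Ai (high P bal κ<i′ i′<))) κ<i′
              (subst₂ _∊_ (sym (cong (v P) (flip-hi i<κ))) (sym (re-hi P (<-trans i<κ κ<i′))) v∊) Aκ)
          where
          open Balanced bal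
          i< : i < p
          i< = <-trans i<κ κ<
          Ai = low P bal i<κ
          P₁ = rotateA P i< Ai
          Aκ : A P₁ κ
          Aκ = e P i , rotateA-free P i< Ai , start∊link P i< Ai , subst (_∊ e P i) (sym (cong (v P) (flip-hi (<-trans i<κ (n<1+n κ))))) w∊

        no-late-link : (P : Path p) → ∀ {κ} → Balanced P κ → ∀ {i} → κ < i → i < p → ¬ v P κ ∊ e P i
        no-late-link P {κ} bal {i} κ<i i< v∊ with mirror-κ P bal | mirror P i<
        ... | κ′ , eq , balR | k , eq′ , _ = no-X (reverse P) balR
            (lia (k ∷ i ∷ κ ∷ κ′ ∷ p ∷ []) (λ k l a b p → σ (b ⊕ a) ≈ p ⇒ σ (k ⊕ l) ≈ p ⇒ a ≺ l ⇒ k ≺ b) refl eq eq′ κ<i)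
            (subst₂ _∊_ (sym (reverse-v P eq)) (sym (reverse-e P eq′)) v∊)

      -- By counting κ = t, and `end-excess` puts v_p on e_κ. This confines every v_i with i < κ
      -- that is not on e_κ to too few vertices, so e_κ contains v_0, ..., v_{κ+1}, which is t + 2
      -- vertices.
      balanced-absurd : (P : Path p) → ∀ {κ} → Balanced P κ → ⊥
      balanced-absurd P {κ} bal = <⇒≱ (s≤s (s≤s (≤-trans ρ<τ (≤-trans (n≤1+n τ) κ≥)))) (≤-trans
          (≤-trans (≤-reflexive (sym (trans (cnt-all (λ l → l <? suc (suc κ)) (upTo (suc (suc κ))) ∈-upTo⁻) (length-upTo (suc (suc κ))))))
            (indexed≤ (e P κ) (λ l → l <? suc (suc κ)) (suc (suc κ)) (v P) (λ i< j< _ _ → v-inj P (≤-trans (s≤s⁻¹ i<) κ<) (≤-trans (s≤s⁻¹ j<) κ<))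
              (λ l< _ → in-middle (s≤s⁻¹ l<))))
          (≤-reflexive r≡))
        where
        open Balanced bal
        A⇒< : ∀ {l} → l < p → A P l → l < κ
        A⇒< {l} l< a with <-cmp l κ
        ... | tri< lt _ _ = lt
        ... | tri≈ _ refl _ = ⊥-elim (¬A a)
        ... | tri> _ _ gt = ⊥-elim (A∩A′ P l< a (high P bal gt l<))
        κ≥ : t ≤ κ
        κ≥ = ≤-trans #A≥ (≤-trans (cnt-injection (A? P) (λ l → l <? κ) _≡_ (λ { refl refl → refl }) (upTo⁺ p)
               λ {l} m a → let lt = A⇒< (∈-upTo⁻ m) a in l , ∈-upTo⁺ lt , lt , refl) (cnt-upTo≤ (λ l → l <? κ) κ))
        κ≤ : κ ≤ t
        κ≤ = ≤-trans (≤-reflexive (sym (trans (cnt-all (λ l → l <? κ) (upTo κ) ∈-upTo⁻) (length-upTo κ)))) (≤-trans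
               (cnt-injection (λ l → l <? κ) (A? P) _≡_ (λ { refl refl → refl }) (upTo⁺ κ)
                 λ {l} m lt → l , ∈-upTo⁺ (<-trans lt κ<) , low P bal lt , refl) (A≤ P))
        y∊κ : D′ P κ
        y∊κ with v P p ∊? e P κ
        ... | yes h = h
        ... | no h = ⊥-elim (end-excess P bal h (no-late-link P bal))
        -- Otherwise all edges at v_i lie in {v_0 , … , v_κ}.
        in-first : ∀ {i} → i < κ → v P i ∊ e P κ
        in-first {i} i<κ with v P i ∊? e P κ
        ... | yes h = h
        ... | no h = ⊥-elim (<⇒≱ (deg (v P i)) (≤-trans
              (edges-at≤ (v P i ∊?_) others? (suc κ) (v P) (suc ρ) r≡ (v P i) (λ h → h) λ {g} z∊ w∊ → conv w∊ (confined z∊ w∊))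
              (C-mono (suc ρ) (≤-trans (s≤s⁻¹ (cnt-≢ {i} {suc κ} (<-trans i<κ (n<1+n κ)))) κ≤))))
          where
          i< : i < p
          i< = <-trans i<κ κ<
          Ai = low P bal i<κ
          f = proj₁ Ai
          P₁ = rotateA P i< Ai
          others? : ∀ l → Dec (¬ l ≡ i)
          others? l = ¬? (l ≟ i)
          conv : ∀ {g w} → w ∊ g → (∃ λ l → l ≤ κ × w ≡ v P l) → w ≡ v P i ⊎ ∃ λ l → l < suc κ × ¬ l ≡ i × w ≡ v P l
          conv _ (l , l≤ , refl) with l ≟ i
          ... | yes refl = inj₁ refl
          ... | no ne = inj₂ (l , s≤s l≤ , ne , refl)
          A₁κ : ¬ A P₁ κ
          A₁κ a = A∩D′ P₁ κ< a (subst₂ _∊_ (sym (rotateA-end P i< Ai)) (sym (re-hi P i<κ)) y∊κ)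
          unused₁ : ∀ {g} → Unused P₁ g → v P i ∊ g → ∀ {w} → w ∊ g → ∃ λ l → l ≤ κ × w ≡ v P l
          unused₁ {g} u z∊ {w} w∊ with on-P P w
          ... | zero , _ , eq = 0 , z≤n , eq
          ... | suc l , l< , refl with <-cmp l κ
          ... | tri< lt _ _ = suc l , lt , refl
          ... | tri≈ _ refl _ = ⊥-elim (A₁κ (g , u , subst (_∊ g) (sym (rotateA-start P i< Ai)) z∊ , subst (_∊ g) (sym (cong (v P) (flip-hi (<-trans i<κ (n<1+n l))))) w∊))
          ... | tri> _ _ gt = ⊥-elim (A∩A′ P₁ l<
                (g , u , subst (_∊ g) (sym (rotateA-start P i< Ai)) z∊ , subst (_∊ g) (sym (cong (v P) (flip-hi (<-trans (<-trans i<κ gt) (n<1+n l))))) w∊)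
                (subst (A′ P₁) (flip-hi (<-trans i<κ gt)) (rotateA-A′ P i< Ai (high P bal gt l<))))
          confined : ∀ {g} → v P i ∊ g → ∀ {w} → w ∊ g → ∃ λ l → l ≤ κ × w ≡ v P l
          confined {g} z∊ {w} w∊ with anyUpTo? (λ k → g ≟ᶠ e P k) p
          confined {g} z∊ {w} w∊ | no u with g ≟ᶠ f
          ... | no ne = unused₁ (rotateA-unused P i< Ai u ne) z∊ w∊
          ... | yes refl with unused-inside P u (proj₁ (proj₂ (proj₂ Ai))) w∊
          ... | inj₁ eq = 0 , z≤n , eq
          ... | inj₂ (l , l< , a , eq) = suc l , A⇒< l< a , eq
          confined {g} z∊ {w} w∊ | yes (k , k< , refl) with k ≟ i
          ... | yes refl = unused₁ (rotateA-free P i< Ai) z∊ w∊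
          ... | no k≢i with <-cmp k κ
          ... | tri≈ _ refl _ = ⊥-elim (h z∊)
          ... | tri> _ _ gt = ⊥-elim (D∩A′ P₁ k< (subst₂ _∊_ (sym (rotateA-start P i< Ai)) (sym (re-hi P (<-trans i<κ gt))) z∊)
                  (subst (A′ P₁) (flip-hi (<-trans i<κ gt)) (rotateA-A′ P i< Ai (high P bal gt k<))))
          ... | tri< k<κ _ _ with on-P P w
          ... | zero , _ , eq = 0 , z≤n , eq
          ... | suc l , l< , refl with <-cmp l κ
          ... | tri< lt _ _ = suc l , lt , refl
          ... | tri≈ _ refl _ = ⊥-elim (no-X P bal k<κ w∊)
          ... | tri> _ _ gt = ⊥-elim (link-above P k< (low P bal k<κ) (<-trans k<κ gt) l< w∊ (high P bal gt l<))
        in-middle : ∀ {l} → l ≤ suc κ → v P l ∊ e P κ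
        in-middle {l} l≤ with <-cmp l κ
        ... | tri< lt _ _ = in-first lt
        ... | tri≈ _ refl _ = inl P κ<
        ... | tri> _ _ gt = subst (λ k → v P k ∊ e P κ) (≤-antisym gt l≤) (inr P κ<)

      both-good-absurd : (P : Path p) → t ≤ #A P → t ≤ #A′ P → ⊥
      both-good-absurd P a≥ a′≥ = balanced-absurd P (proj₂ (balanced P a≥ a′≥))

  -- Condition (c) for r < t

  module SmallEdges {ρ τ q : ℕ} (1≤ρ : 1 ≤ ρ) (r≡ : r ≡ suc (suc ρ)) (ρ<τ : suc ρ ≤ τ) (q≤ : q ≤ 2 * suc τ)
    (n≤ : n ≤ 2 + 2 * suc τ)
    (deg : ∀ u → degree≥ u (suc (suc τ choose suc ρ)))
    (longest : Path (suc (suc q)) → ⊥)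
    (noCycle : (P : Path (suc q)) (h : E) → Unused P h → v P 0 ∊ h → v P (suc q) ∊ h → ⊥)
    (r<t : suc (suc ρ) ≤ τ) where

    open Context 1≤ρ r≡ ρ<τ q≤ n≤ deg longest noCycle

    private
      p = suc q
      t = suc τ

      unusedAt? : ∀ (P : Path p) u h → Dec (Unused P h × u ∊ h)
      unusedAt? P u h = unused? P h ×-dec (u ∊? h)

      used≥ : (P : Path p) (u : V) → cnt (unusedAt? P u) (allFin M) ≤ τ choose suc ρ → suc (τ choose ρ) ≤ cnt (λ k → u ∊? e P k) (upTo p)
      used≥ P u le = lia (τ choose ρ ∷ τ choose suc ρ ∷ cnt (unusedAt? P u) (allFin M) ∷ cnt (λ k → u ∊? e P k) (upTo p) ∷ [])
        (λ x y f d → σ (x ⊕ y) ≼ f ⊕ d ⇒ f ≼ y ⇒ σ x ≼ d) refl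
        (subst (λ c → suc c ≤ cnt (unusedAt? P u) (allFin M) + cnt (λ k → u ∊? e P k) (upTo p)) (pascal τ ρ) (≤-trans (deg u) (degree-split P u))) le

      -- Count the incidences between the links and the possible ends v_i, i in D, and v_p.
      no-good-end : (P : Path p) → (∀ P′ → #A P′ + #A′ P′ ≤ #A P + #A′ P) → #A P ≤ τ → #A′ P ≤ τ → ⊥
      no-good-end P best a≤ a′≤ = degree-sum-bound {ρ} {τ choose ρ} {3 + 2 * τ} {#D P} (product-bound 1≤ρ r<t) (few P a≤)
          (≤-trans lower (≤-trans (≤-reflexive (double-count (λ i k → v P i ∊? e P k) xs (upTo p))) (≤-trans upper upper′)))
        where
        I : ℕ → Set
        I i = (i < p × D P i) ⊎ i ≡ p
        I? : ∀ i → Dec (I i)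
        I? i = ((i <? p) ×-dec D? P i) ⊎-dec (i ≟ p)
        xs = filter I? (upTo (suc p))
        start≥ : ∀ {i} → i < p → D P i → suc (τ choose ρ) ≤ cnt (λ k → v P i ∊? e P k) (upTo p)
        start≥ {i} i< x∊ = used≥ P (v P i) (≤-trans (cnt-mono (unusedAt? P (v P i)) (F? P₂) (allFin M)
              λ { {h} _ (u , z∊) → rotateD-unused P i< x∊ u , subst (_∊ h) (sym (rotateD-start P i< x∊)) z∊ })
            (≤-trans (#F≤ P₂) (C-mono (suc ρ) (≤-trans a₂≤ a≤))))
          where
          P₂ = rotateD P i< x∊
          a₂≤ : #A P₂ ≤ #A P
          a₂≤ = lia (#A P₂ ∷ #A′ P₂ ∷ #A P ∷ #A′ P ∷ []) (λ a b c d → a ⊕ b ≼ c ⊕ d ⇒ d ≼ b ⇒ a ≼ c) refl (best P₂) (#A′-rotateD P i< x∊)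
        end≥ : suc (τ choose ρ) ≤ cnt (λ k → v P p ∊? e P k) (upTo p)
        end≥ = used≥ P (v P p) (≤-trans (cnt-mono (unusedAt? P (v P p)) (F? R) (allFin M)
              λ { {h} _ (u , z∊) → reverse-unused P u , subst (_∊ h) (sym (reverse-v P {0} {p} refl)) z∊ })
            (≤-trans (#F≤ R) (C-mono (suc ρ) (≤-trans (#reverse-A P) a′≤))))
          where R = reverse P
        each≥ : ∀ {i} → I i → suc (τ choose ρ) ≤ cnt (λ k → v P i ∊? e P k) (upTo p)
        each≥ (inj₁ (i< , x∊)) = start≥ i< x∊
        each≥ (inj₂ refl) = end≥
        len : suc (#D P) ≤ length xs
        len = ≤-trans (≤-trans (≤-reflexive (+-comm 1 (#D P))) (≤-trans (+-mono-≤
            (cnt-injection (D? P) (λ i → (i <? p) ×-dec D? P i) _≡_ (λ { refl refl → refl }) (upTo⁺ p)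
              λ {i} m h → i , ∈-upTo⁺ (≤-trans (∈-upTo⁻ m) (n≤1+n p)) , (∈-upTo⁻ m , h) , refl)
            (cnt≥1 (λ i → i ≟ p) {upTo (suc p)} (∈-upTo⁺ ≤-refl) refl))
            (cnt-disjoint (λ i → (i <? p) ×-dec D? P i) (λ i → i ≟ p) I? (upTo (suc p)) (λ _ → inj₁) (λ _ → inj₂) λ { _ (lt , _) refl → <-irrefl refl lt })))
          (≤-reflexive (cnt≡ I? (upTo (suc p))))
        lower : suc (#D P) * suc (τ choose ρ) ≤ sum (map (λ i → cnt (λ k → v P i ∊? e P k) (upTo p)) xs)
        lower = ≤-trans (*-monoˡ-≤ (suc (τ choose ρ)) len) (≤-trans (≤-reflexive (sym (sum-const (suc (τ choose ρ)) xs)))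
          (sum-mono (λ _ → suc (τ choose ρ)) (λ i → cnt (λ k → v P i ∊? e P k) (upTo p)) xs λ m → each≥ (proj₂ (∈-filter⁻ I? {xs = upTo (suc p)} m))))
        -- A link has ρ vertices besides the two that it joins; these two count only if they are
        -- possible ends.
        link≤ : ∀ {k} → k < p → cnt (λ i → v P i ∊? e P k) xs ≤ ρ + (𝟙 (I? k) + 𝟙 (I? (suc k)))
        link≤ {k} k< = lia (cnt (λ i → v P i ∊? e P k) xs ∷ O ∷ cnt (λ i → i ≟ k) xs ∷ cnt (λ i → i ≟ suc k) xs ∷ cnt own? xs ∷ 𝟙 (I? k) ∷ 𝟙 (I? (suc k)) ∷ ρ ∷ r ∷ [])
            (λ a o b c d x y ρ r → a ≼ o ⊕ d ⇒ d ≼ b ⊕ c ⇒ b ≼ x ⇒ c ≼ y ⇒ o ⊕ con 2 ≼ r ⇒ r ≈ σ (σ ρ) ⇒ a ≼ ρ ⊕ (x ⊕ y)) refl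
            (cnt-cover (λ i → v P i ∊? e P k) other? own? xs λ {i} _ h → split i h)
            (cnt-cover own? (λ i → i ≟ k) (λ i → i ≟ suc k) xs λ _ h → h)
            (single k) (single (suc k)) others r≡
          where
          own? : ∀ i → Dec (i ≡ k ⊎ i ≡ suc k)
          own? i = (i ≟ k) ⊎-dec (i ≟ suc k)
          other? : ∀ i → Dec (v P i ∊ e P k × ¬ (i ≡ k ⊎ i ≡ suc k))
          other? i = (v P i ∊? e P k) ×-dec ¬? (own? i)
          O = cnt other? xs
          split : ∀ i → v P i ∊ e P k → (v P i ∊ e P k × ¬ (i ≡ k ⊎ i ≡ suc k)) ⊎ (i ≡ k ⊎ i ≡ suc k)
          split i h with own? i
          ... | yes o = inj₂ o
          ... | no o = inj₁ (h , o)
          uxs = filter⁺ I? (upTo⁺ (suc p))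
          in-xs : ∀ {i} → i ∈ xs → i ≤ p × I i
          in-xs m = let (m′ , h) = ∈-filter⁻ I? {xs = upTo (suc p)} m in s≤s⁻¹ (∈-upTo⁻ m′) , h
          single : ∀ j → cnt (λ i → i ≟ j) xs ≤ 𝟙 (I? j)
          single j = go (cnt (λ i → i ≟ j) xs ≟ 0)
            where
            go : Dec (cnt (λ i → i ≟ j) xs ≡ 0) → cnt (λ i → i ≟ j) xs ≤ 𝟙 (I? j)
            go (yes eq) = subst (_≤ 𝟙 (I? j)) (sym eq) z≤n
            go (no ne) with cnt-∃ (λ i → i ≟ j) xs (n≢0⇒n>0 ne)
            ... | .j , m , refl = ≤-trans (cnt≤1 (λ i → i ≟ j) xs uxs λ { _ _ refl refl → refl }) (𝟙≥1 (I? j) (proj₂ (in-xs m)))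
          all? : ∀ i → Dec (v P i ∊ e P k)
          all? i = v P i ∊? e P k
          others : O + 2 ≤ r
          others = ≤-trans (≤-trans (+-mono-≤ O≤ two) (cnt-disjoint other? own? all? (upTo (suc p)) (λ _ → proj₁)
                (λ { _ (inj₁ refl) → inl P k< ; _ (inj₂ refl) → inr P k< }) λ { _ (_ , ν) o → ν o }))
              (indexed≤ (e P k) all? (suc p) (v P) (λ i< j< _ _ → v-inj P (s≤s⁻¹ i<) (s≤s⁻¹ j<)) (λ _ h → h))
            where
            O≤ : O ≤ cnt other? (upTo (suc p))
            O≤ = cnt-injection other? other? _≡_ (λ { refl refl → refl }) uxs λ {i} m h → i , ∈-upTo⁺ (s≤s (proj₁ (in-xs m))) , h , refl
            two : 2 ≤ cnt own? (upTo (suc p))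
            two = ≤-trans (+-mono-≤ (cnt≥1 (λ i → i ≟ k) {upTo (suc p)} (∈-upTo⁺ (<-trans k< (n<1+n p))) refl) (cnt≥1 (λ i → i ≟ suc k) {upTo (suc p)} (∈-upTo⁺ (s≤s k<)) refl))
              (cnt-disjoint (λ i → i ≟ k) (λ i → i ≟ suc k) own? (upTo (suc p)) (λ _ → inj₁) (λ _ → inj₂) λ { _ refl () })
        upper : sum (map (λ k → cnt (λ i → v P i ∊? e P k) xs) (upTo p)) ≤ p * ρ + (cnt I? (upTo p) + cnt (λ k → I? (suc k)) (upTo p))
        upper = ≤-trans (sum-mono _ (λ k → ρ + (𝟙 (I? k) + 𝟙 (I? (suc k)))) (upTo p) λ m → link≤ (∈-upTo⁻ m))
          (≤-reflexive (trans (sum-+ (λ _ → ρ) (λ k → 𝟙 (I? k) + 𝟙 (I? (suc k))) (upTo p))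
            (cong₂ _+_ (trans (sum-const ρ (upTo p)) (cong (_* ρ) (length-upTo p)))
              (trans (sum-+ (λ k → 𝟙 (I? k)) (λ k → 𝟙 (I? (suc k))) (upTo p)) (sym (cong₂ _+_ (cnt≡sum I? (upTo p)) (cnt≡sum (λ k → I? (suc k)) (upTo p))))))))
        upper′ : p * ρ + (cnt I? (upTo p) + cnt (λ k → I? (suc k)) (upTo p)) ≤ ρ * (3 + 2 * τ) + (#D P + #D P)
        upper′ = +-mono-≤ (≤-trans (≤-reflexive (*-comm p ρ)) (*-monoʳ-≤ ρ (lia (q ∷ τ ∷ []) (λ q t → q ≼ 2 ⊛ σ t ⇒ σ q ≼ con 3 ⊕ 2 ⊛ t) refl q≤)))
            (+-mono-≤ (cnt-mono I? (D? P) (upTo p) λ { m (inj₁ (_ , h)) → h ; m (inj₂ refl) → ⊥-elim (<-irrefl refl (∈-upTo⁻ m)) }) shifted)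
          where
          -- k = p - 1 corresponds to the end; send it to the index 0, which is always in D.
          shifted : cnt (λ k → I? (suc k)) (upTo p) ≤ #D P
          shifted = cnt-injection (λ k → I? (suc k)) (D? P) (λ k j → (suc k ≡ j) ⊎ (suc k ≡ p × j ≡ 0))
            (λ { (inj₁ eq) (inj₁ eq′) → suc-injective (trans eq (sym eq′)) ; (inj₁ ()) (inj₂ (_ , refl)) ; (inj₂ (_ , refl)) (inj₁ ())
               ; (inj₂ (eq , _)) (inj₂ (eq′ , _)) → suc-injective (trans eq (sym eq′)) }) (upTo⁺ p)
            λ { {k} m (inj₁ (sk< , h)) → suc k , ∈-upTo⁺ sk< , h , inj₁ refl
              ; {k} m (inj₂ eq) → 0 , ∈-upTo⁺ (positive P) , inl P (positive P) , inj₂ (eq , refl) }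

      one-good-end : (P : Path p) → (∀ P′ → #A P′ + #A′ P′ ≤ #A P + #A′ P) → #A P ≤ τ → q ≡ 2 * t → t ≤ #A′ P → ⊥
      one-good-end P best a≤ q≡ a′≥ = by-uniformity (ρ ≟ 1)
        where
        N≤ : #N P ≤ suc t
        N≤ = lia (#A′ P ∷ #N P ∷ q ∷ τ ∷ []) (λ a n q t → a ⊕ n ≈ σ q ⇒ q ≈ 2 ⊛ σ t ⇒ σ t ≼ a ⇒ n ≼ σ (σ t)) refl (#N+#A′ P) q≡ a′≥
        by-uniformity : Dec (ρ ≡ 1) → ⊥
        by-uniformity (no ρ≢1) = lia (τ ∷ τ choose ρ ∷ #D P ∷ #N P ∷ ρ ∷ []) (λ t c d n ρ → 2 ⊛ t ≼ con 2 ⊕ c ⇒ σ c ≼ d ⇒ d ≼ n ⇒ n ≼ σ (σ t) ⇒ con 2 ≼ ρ ⇒ σ (σ ρ) ≼ t ⇒ absurd) refl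
            (C≥2n∸2 τ ρ 2≤ρ r<t) (few P a≤) (#D≤#N P) N≤ 2≤ρ r<t
          where
          2≤ρ : 2 ≤ ρ
          2≤ρ = ≤∧≢⇒< 1≤ρ (λ eq → ρ≢1 (sym eq))
        by-uniformity (yes refl) = lia (τ ∷ τ choose 2 ∷ #F P ∷ #D P ∷ #A P ∷ #N P ∷ cnt X? (upTo p) ∷ cnt both? (upTo p) ∷ [])
            (λ t c f d a n x b → σ (t ⊕ c) ≼ f ⊕ d ⇒ f ⊕ x ≼ c ⇒ d ⊕ a ≼ n ⊕ b ⇒ b ≼ x ⊕ con 1 ⇒ n ≼ σ (σ t) ⇒ t ≼ a ⇒ con 3 ≼ t ⇒ absurd) refl
            (subst (λ c → suc c ≤ #F P + #D P) (trans (pascal τ 1) (cong (_+ τ choose 2) (choose-1 τ))) (total P))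
            extra D+A both≤ N≤ (many-A P (best-A P (≤-refl) ) N≤) r<t
          where
          many-A : (P′ : Path p) → #A P′ ≤ τ → #N P′ ≤ suc t → τ ≤ #A P′
          many-A P′ a≤′ N≤′ = ≮⇒≥ λ lt → fewer (<-split (≤-trans (s≤s z≤n) r<t)) lt
            where
            fewer : (∃ λ σ′ → suc σ′ ≡ τ) → #A P′ < τ → ⊥
            fewer (s , refl) lt = lia (s ∷ s choose 2 ∷ #F P′ ∷ #D P′ ∷ #N P′ ∷ [])
              (λ s c f d n → σ (σ s ⊕ (s ⊕ c)) ≼ f ⊕ d ⇒ f ≼ c ⇒ d ≼ n ⇒ n ≼ σ (σ (σ s)) ⇒ con 3 ≼ σ s ⇒ absurd) refl
              (subst (λ c → suc c ≤ #F P′ + #D P′) (trans (pascal (suc s) 1) (cong₂ _+_ (choose-1 (suc s)) (trans (pascal s 1) (cong (_+ s choose 2) (choose-1 s))))) (total P′))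
              (≤-trans (#F≤ P′) (C-mono 2 (s≤s⁻¹ lt))) (#D≤#N P′) N≤′ r<t
          best-A : (P′ : Path p) → #A′ P ≤ #A′ P′ → #A P′ ≤ τ
          best-A P′ le = ≤-trans (lia (#A P′ ∷ #A′ P′ ∷ #A P ∷ #A′ P ∷ []) (λ a b c d → a ⊕ b ≼ c ⊕ d ⇒ d ≼ b ⇒ a ≼ c) refl (best P′) le) a≤
          both? : ∀ i → Dec (D P i × A P i)
          both? i = D? P i ×-dec A? P i
          X : ℕ → Set
          X i = i ≢ 0 × D P i × A P i
          X? : ∀ i → Dec (X i)
          X? i = ¬? (i ≟ 0) ×-dec both? i
          both≤ : cnt both? (upTo p) ≤ cnt X? (upTo p) + 1
          both≤ = ≤-trans (cnt-cover both? X? (λ i → i ≟ 0) (upTo p) λ {i} _ h → split i h)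
            (+-monoʳ-≤ (cnt X? (upTo p)) (cnt≤1 (λ i → i ≟ 0) (upTo p) (upTo⁺ p) λ { _ _ refl refl → refl }))
            where
            split : ∀ i → D P i × A P i → X i ⊎ i ≡ 0
            split i h with i ≟ 0
            ... | yes eq = inj₂ eq
            ... | no ne = inj₁ (ne , h)
          D+A : #D P + #A P ≤ #N P + cnt both? (upTo p)
          D+A = lia (#D P ∷ #A P ∷ #N P ∷ cnt both? (upTo p) ∷ cnt only? (upTo p) ∷ []) (λ d a n b o → d ≼ b ⊕ o ⇒ o ⊕ a ≼ n ⇒ d ⊕ a ≼ n ⊕ b) refl
            (cnt-cover (D? P) both? only? (upTo p) λ {i} _ h → split i h)
            (cnt-disjoint only? (A? P) (N? P) (upTo p) (λ m (h , _) → D∩A′ P (∈-upTo⁻ m) h) (λ m h → A∩A′ P (∈-upTo⁻ m) h) λ { _ (_ , ν) a → ν a })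
            where
            only? : ∀ i → Dec (D P i × ¬ A P i)
            only? i = D? P i ×-dec ¬? (A? P i)
            split : ∀ i → D P i → (D P i × A P i) ⊎ (D P i × ¬ A P i)
            split i h with A? P i
            ... | yes a = inj₁ (h , a)
            ... | no a = inj₂ (h , a)
          -- v_i is a neighbour of the start, for otherwise rotating along f instead of e_i would gain a neighbour.
          previous : ∀ {i} → suc i < p → D P (suc i) → A P (suc i) → A P i
          previous {i} i< x∊ Ai with A? P i
          ... | yes a = a
          ... | no ¬a = ⊥-elim (<⇒≱ (≤-trans (s≤s (many-A P₂ (best-A P₂ (#A′-rotateD P i< x∊)) N₂≤)) gain) (best-A P₁ (#A′-rotateA P i< Ai)))
            where
            f = proj₁ Ai
            P₁ = rotateA P i< Ai
            P₂ = rotateD P i< x∊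
            start₂ : v P₂ 0 ≡ v P (suc i)
            start₂ = rotateD-start P i< x∊
            N₂≤ : #N P₂ ≤ suc t
            N₂≤ = lia (#A′ P ∷ #A′ P₂ ∷ #N P₂ ∷ q ∷ τ ∷ []) (λ a b n q t → σ t ≼ a ⇒ a ≼ b ⇒ b ⊕ n ≈ σ q ⇒ q ≈ 2 ⊛ σ t ⇒ n ≼ σ (σ t)) refl
                a′≥ (#A′-rotateD P i< x∊) (#N+#A′ P₂) q≡
            keep : ∀ {k} → A P₂ k → A P₁ k
            keep (h , u , z∊ , k∊) = h , rotateA-unused P i< Ai u′ (λ { refl → ¬a (f , u′ , proj₁ (proj₂ (proj₂ Ai)) , subst (_∊ f) start₂ z∊) }) , z∊ , k∊
              where u′ = unused-rotateD P i< x∊ u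
            i<′ : i < p
            i<′ = <-trans (n<1+n i) i<
            new : A P₁ i
            new = e P (suc i) , rotateA-free P i< Ai , start∊link P i< Ai , subst (_∊ e P (suc i)) (cong (v P) (sym (flip-lo (+-identityʳ (suc i))))) x∊
            old : ¬ A P₂ i
            old (h , u , z∊ , k∊) = ¬a (h , unused-rotateD P i< x∊ u , subst (_∊ h) (cong (v P) (flip-lo (+-identityʳ (suc i)))) k∊ , subst (_∊ h) start₂ z∊)
            gain : suc (#A P₂) ≤ #A P₁
            gain = ≤-trans (≤-reflexive (+-comm 1 (#A P₂))) (≤-trans (+-monoʳ-≤ (#A P₂) (cnt≥1 (λ k → k ≟ i) (∈-upTo⁺ i<′) refl))
              (cnt-disjoint (A? P₂) (λ k → k ≟ i) (A? P₁) (upTo p) (λ _ → keep) (λ { _ refl → new }) λ { _ a refl → old a }))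
          triple : ∀ {i} → suc i < p → D P (suc i) → ∀ {w} → w ∊ e P (suc i) → w ≡ v P 0 ⊎ w ≡ v P (suc i) ⊎ w ≡ v P (suc (suc i))
          triple {i} i< x∊ {w} w∊ with w ≟ᶠ v P 0 | w ≟ᶠ v P (suc i) | w ≟ᶠ v P (suc (suc i))
          ... | yes eq | _ | _ = inj₁ eq
          ... | no _ | yes eq | _ = inj₂ (inj₁ eq)
          ... | no _ | no _ | yes eq = inj₂ (inj₂ eq)
          ... | no n₀ | no n₁ | no n₂ = ⊥-elim (<⇒≱ (s≤s (≤-reflexive r≡)) (members≤ (e P (suc i)) (w ∷ v P 0 ∷ v P (suc i) ∷ v P (suc (suc i)) ∷ [])
                ((n₀ ∷ n₁ ∷ n₂ ∷ []) ∷ ((λ eq → 0≢1+n (v-inj P z≤n (<⇒≤ i<) eq)) ∷ (λ eq → 0≢1+n (v-inj P z≤n i< eq)) ∷ []) ∷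
                 ((λ eq → 1+n≢n (sym (v-inj P (<⇒≤ i<) i< eq))) ∷ []) ∷ [] ∷ [])
                λ { (here refl) → w∊ ; (there (here refl)) → x∊ ; (there (there (here refl))) → inl P i< ; (there (there (there (here refl)))) → inr P i< }))
          extra : #F P + cnt X? (upTo p) ≤ τ choose 2
          extra = ≤-trans (≤-trans (+-monoʳ-≤ (#F P) X≤) (≤-trans
              (cnt-disjoint (F? P) link? all? (allFin M) (λ _ → inj₁) (λ _ → inj₂) λ { _ (u , _) (k , k< , _ , eq) → u (k , k< , eq) })
              (edges-at≤ all? (A? P) p (λ i → v P (suc i)) 2 r≡ (v P 0) start∊ ins)))
              (C-mono 2 a≤)
            where
            Link : E → Set
            Link h = ∃ λ k → k < p × X k × h ≡ e P k
            link? : ∀ h → Dec (Link h)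
            link? h = anyUpTo? (λ k → X? k ×-dec (h ≟ᶠ e P k)) p
            all? : ∀ h → Dec ((Unused P h × v P 0 ∊ h) ⊎ Link h)
            all? h = F? P h ⊎-dec link? h
            X≤ : cnt X? (upTo p) ≤ cnt link? (allFin M)
            X≤ = cnt-injection X? link? (λ k h → k < p × h ≡ e P k) (λ { (k< , refl) (l< , eq) → e-inj P k< l< eq }) (upTo⁺ p)
              λ {k} m x → e P k , ∈-allFin (e P k) , (k , ∈-upTo⁻ m , x , refl) , ∈-upTo⁻ m , refl
            start∊ : ∀ {h} → (Unused P h × v P 0 ∊ h) ⊎ Link h → v P 0 ∊ h
            start∊ (inj₁ (_ , x∊)) = x∊
            start∊ (inj₂ (k , _ , (_ , x∊ , _) , refl)) = x∊
            ins : ∀ {h w} → (Unused P h × v P 0 ∊ h) ⊎ Link h → w ∊ h → Inside P w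
            ins (inj₁ (u , x∊)) w∊ = unused-inside P u x∊ w∊
            ins (inj₂ (zero , _ , (ne , _) , refl)) w∊ = ⊥-elim (ne refl)
            ins (inj₂ (suc k , k< , (_ , x∊ , a) , refl)) w∊ with triple k< x∊ w∊
            ... | inj₁ eq = inj₁ eq
            ... | inj₂ (inj₁ eq) = inj₂ (k , <-trans (n<1+n k) k< , previous k< x∊ a , eq)
            ... | inj₂ (inj₂ eq) = inj₂ (suc k , k< , a , eq)

    best-path-absurd : (P : Path p) → (∀ P′ → #A P′ + #A′ P′ ≤ #A P + #A′ P) → ⊥
    best-path-absurd P best with t ≤? #A P | t ≤? #A′ P
    ... | yes a≥ | yes a′≥ = Full.both-good-absurd (good-end P a′≥) P a≥ a′≥
    ... | no a< | yes a′≥ = one-good-end P best (s≤s⁻¹ (≰⇒> a<)) (good-end P a′≥) a′≥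
    ... | no a< | no a′< = no-good-end P best (s≤s⁻¹ (≰⇒> a<)) (s≤s⁻¹ (≰⇒> a′<))
    ... | yes a≥ | no a′< = one-good-end R (best-reverse P best) (≤-trans (#reverse-A P) (s≤s⁻¹ (≰⇒> a′<))) (good-end R a≥R) a≥R
      where
      R = reverse P
      a≥R : t ≤ #A′ R
      a≥R = ≤-trans a≥ (#A′-reverse P)

  -- Condition (c) for r = t

  length-allFin : ∀ m → length (allFin m) ≡ m
  length-allFin m = length-tabulate {n = m} id

  -- Two different edges cover at least r + 1 vertices.
  two-avoid : ∀ {g₁ g₂} → g₁ ≢ g₂ → {X : V → Set} (X? : ∀ w → Dec (X w)) →
    (∀ {w} → X w → ¬ w ∊ g₁) → (∀ {w} → X w → ¬ w ∊ g₂) → cnt X? (allFin n) + suc r ≤ n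
  two-avoid {g₁} {g₂} ne {X} X? a₁ a₂ with any? (λ w → (w ∊? g₂) ×-dec ¬? (w ∊? g₁))
  ... | no none = ⊥-elim (ne (sym (ext g₂ g₁ λ w w∊ → decidable-stable (w ∊? g₁) λ nw → none (w , w∊ , nw))))
  ... | yes (w , w∊ , w∉) = ≤-trans (+-monoʳ-≤ (cnt X? (allFin n)) big)
          (≤-reflexive (trans (cnt-¬ X? (allFin n)) (length-allFin _)))
    where
    big : suc r ≤ cnt (λ u → ¬? (X? u)) (allFin n)
    big = subst (λ m → suc m ≤ cnt (λ u → ¬? (X? u)) (allFin n)) (size g₁)
      (≤-trans (≤-reflexive (+-comm 1 _)) (≤-trans (+-monoʳ-≤ _ (cnt≥1 (λ u → u ≟ᶠ w) (∈-allFin w) refl))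
        (cnt-disjoint (λ u → u ∊? g₁) (λ u → u ≟ᶠ w) (λ u → ¬? (X? u)) (allFin n)
          (λ _ u∊ x → a₁ x u∊) (λ { _ refl x → a₂ x w∊ }) λ { _ u∊ refl → w∉ u∊ })))

  same-edge : {Q : E → Set} (Q? : ∀ h → Dec (Q h)) → cnt Q? (allFin M) ≤ 1 → ∀ {h h′} → Q h → Q h′ → h ≡ h′
  same-edge Q? le {h} {h′} qh qh′ = decidable-stable (h ≟ᶠ h′) λ ne → <⇒≱
    (≤-trans (+-mono-≤ (cnt≥1 (λ g → g ≟ᶠ h) (∈-allFin h) refl) (cnt≥1 (λ g → g ≟ᶠ h′) (∈-allFin h′) refl))
      (cnt-disjoint (λ g → g ≟ᶠ h) (λ g → g ≟ᶠ h′) Q? (allFin M) (λ { _ refl → qh }) (λ { _ refl → qh′ }) λ { _ refl eq → ne eq })) le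

  handshake : ∀ d → (∀ u → degree≥ u d) → n * d ≤ M * r
  handshake d deg = ≤-trans (≤-reflexive (sym (trans (sum-const d (allFin n)) (cong (_* d) (length-allFin n)))))
    (≤-trans (sum-mono (λ _ → d) (λ u → cnt (u ∊?_) (allFin M)) (allFin n) λ {u} _ → deg u)
    (≤-trans (≤-reflexive (double-count _∊?_ (allFin n) (allFin M)))
    (≤-trans (sum-mono (λ e → cnt (λ u → u ∊? e) (allFin n)) (λ _ → r) (allFin M) λ {e} _ → ≤-reflexive (size e))
      (≤-reflexive (trans (sum-const r (allFin M)) (cong (_* r) (length-allFin M)))))))

  module LargeEdges {ρ q : ℕ} (1≤ρ : 1 ≤ ρ) (r≡ : r ≡ suc (suc ρ)) (q≤ : q ≤ 2 * suc (suc ρ))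
    (n≤ : n ≤ 2 + 2 * suc (suc ρ)) (n≥ : suc (2 * suc (suc ρ)) ≤ n)
    (deg : ∀ u → degree≥ u (suc (suc (suc ρ) choose suc ρ)))
    (longest : Path (suc (suc q)) → ⊥)
    (noCycle : (P : Path (suc q)) (h : E) → Unused P h → v P 0 ∊ h → v P (suc q) ∊ h → ⊥) where

    open Context {ρ} {suc ρ} {q} 1≤ρ r≡ ≤-refl q≤ n≤ deg longest noCycle

    private
      p = suc q
      τ t : ℕ
      τ = suc ρ
      t = suc τ

      deg≥ : suc t ≤ suc (t choose τ)
      deg≥ = s≤s (C≥n t τ (s≤s z≤n) ≤-refl)

      total′ : (P : Path p) → suc t ≤ #F P + #D P
      total′ P = ≤-trans deg≥ (total P)

      one : (P : Path p) → #A P ≤ τ → #F P ≤ 1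
      one P a≤ = ≤-trans (#F≤ P) (C≤1 a≤)

      -- Double counting gives n (t + 1) ≤ M t, so M > n + 2 because n > 2 t, while at most n - 1
      -- edges are links.
      many-unused : (P : Path p) → 4 ≤ cnt (unused? P) (allFin M)
      many-unused P = ≰⇒> λ U≤ → lia (n * t ∷ n ∷ M * t ∷ τ ∷ []) (λ nt n mt t → n ⊕ nt ≼ mt ⇒ mt ≼ nt ⊕ 2 ⊛ σ t ⇒ σ (2 ⊛ σ t) ≼ n ⇒ absurd) refl
          (subst₂ _≤_ (*-suc n t) (cong (M *_) r≡) (handshake (suc t) λ u → ≤-trans deg≥ (deg u)))
          (≤-trans (*-monoˡ-≤ t (M≤ U≤)) (≤-reflexive (*-distribʳ-+ t n 2))) n≥
        where
        U = cnt (unused? P) (allFin M)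
        used? : ∀ h → Dec (Used P h)
        used? h = anyUpTo? (λ k → h ≟ᶠ e P k) p
        below? : ∀ k → Dec (k < p)
        below? k = k <? p
        M≤ : U ≤ 3 → M ≤ n + 2
        M≤ U≤ = lia (M ∷ U ∷ cnt used? (allFin M) ∷ cnt below? (upTo p) ∷ p ∷ n ∷ [])
          (λ m u s b p n → u ⊕ s ≈ m ⇒ s ≼ b ⇒ b ≼ p ⇒ p ≺ n ⇒ u ≼ con 3 ⇒ m ≼ n ⊕ con 2) refl
          (trans (+-comm U _) (trans (cnt-¬ used? (allFin M)) (length-allFin _)))
          (cnt-injection used? below? (λ h k → h ≡ e P k) (λ { refl refl → refl }) (allFin⁺ M) λ { _ (k , k< , eq) → k , ∈-upTo⁺ k< , k< , eq })
          (cnt-upTo≤ below? p) (path<n P) U≤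

      end-unused : (P : Path p) → #A′ P ≤ τ → cnt (λ h → unused? P h ×-dec (v P p ∊? h)) (allFin M) ≤ 1
      end-unused P a′≤ = ≤-trans (cnt-mono (λ h → unused? P h ×-dec (v P p ∊? h)) (F? R) (allFin M)
            λ { {h} _ (u , y∊) → reverse-unused P u , subst (_∊ h) (sym (reverse-v P {0} {p} refl)) y∊ }) (one R (≤-trans (#reverse-A P) a′≤))
        where R = reverse P

      avoiding-ends : (P : Path p) → #A P ≤ τ → #A′ P ≤ τ → ∃ λ g₁ → ∃ λ g₂ → g₁ ≢ g₂ ×
        (Unused P g₁ × ¬ v P 0 ∊ g₁ × ¬ v P p ∊ g₁) × (Unused P g₂ × ¬ v P 0 ∊ g₂ × ¬ v P p ∊ g₂)
      avoiding-ends P a≤ a′≤ =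
        let (g₁ , _ , z₁) = cnt-∃ Z? (allFin M) (≤-trans (s≤s z≤n) two)
            (g₂ , _ , z₂ , ne) = two-elements Z? _≟ᶠ_ (allFin M) (allFin⁺ M) two g₁
        in g₁ , g₂ , (λ eq → ne (sym eq)) , z₁ , z₂
        where
        Z? : ∀ h → Dec (Unused P h × ¬ v P 0 ∊ h × ¬ v P p ∊ h)
        Z? h = unused? P h ×-dec (¬? (v P 0 ∊? h) ×-dec ¬? (v P p ∊? h))
        end? : ∀ h → Dec (Unused P h × v P p ∊ h)
        end? h = unused? P h ×-dec (v P p ∊? h)
        ends? : ∀ h → Dec ((Unused P h × v P 0 ∊ h) ⊎ (Unused P h × v P p ∊ h))
        ends? h = F? P h ⊎-dec end? h
        split : ∀ {h} → Unused P h → ((Unused P h × v P 0 ∊ h) ⊎ (Unused P h × v P p ∊ h)) ⊎ (Unused P h × ¬ v P 0 ∊ h × ¬ v P p ∊ h)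
        split {h} u with v P 0 ∊? h | v P p ∊? h
        ... | yes a | _ = inj₁ (inj₁ (u , a))
        ... | no _ | yes b = inj₁ (inj₂ (u , b))
        ... | no a | no b = inj₂ (u , a , b)
        two : 2 ≤ cnt Z? (allFin M)
        two = lia (cnt (unused? P) (allFin M) ∷ cnt ends? (allFin M) ∷ cnt Z? (allFin M) ∷ #F P ∷ cnt end? (allFin M) ∷ [])
          (λ u e z f g → con 4 ≼ u ⇒ u ≼ e ⊕ z ⇒ e ≼ f ⊕ g ⇒ f ≼ con 1 ⇒ g ≼ con 1 ⇒ con 2 ≼ z) refl
          (many-unused P) (cnt-cover (unused? P) ends? Z? (allFin M) λ _ → split)
          (cnt-cover ends? (F? P) end? (allFin M) λ _ h → h) (one P a≤) (end-unused P a′≤)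

      no-start-edge : (P : Path p) → (∀ P′ → #A′ P ≤ #A′ P′ → #A P′ ≤ #A P) → #A′ P ≤ τ → #F P ≡ 0 → ⊥
      no-start-edge P best a′≤ F≡0 with avoiding-ends P (≤-trans (≤-reflexive A≡0) z≤n) a′≤
        where
        A≡0 : #A P ≡ 0
        A≡0 = cnt-none (A? P) (upTo p) λ { _ (f , u , x∊ , _) → cnt-0 (F? P) (allFin M) F≡0 (∈-allFin f) (u , x∊) }
      ... | g₁ , g₂ , ne , (u₁ , _ , y₁) , (u₂ , _ , y₂) = lia (cnt X? (allFin n) ∷ #D P ∷ #F P ∷ cnt S? (allFin n) ∷ r ∷ n ∷ ρ ∷ [])
          (λ x d f s r n t → x ⊕ σ r ≼ n ⇒ r ≈ σ (σ t) ⇒ σ (σ (σ t)) ≼ f ⊕ d ⇒ f ≈ con 0 ⇒ d ≼ s ⇒ s ⊕ con 1 ≼ x ⇒ n ≼ con 2 ⊕ 2 ⊛ σ (σ t) ⇒ absurd) refl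
          (two-avoid ne X? (avoid u₁ y₁) (avoid u₂ y₂)) r≡ (total′ P) F≡0
          (cnt-injection (D? P) S? (λ i w → i < p × w ≡ v P i) (λ { (i< , refl) (j< , eq) → v-inj P (<⇒≤ i<) (<⇒≤ j<) eq }) (upTo⁺ p)
            λ {i} m x∊ → v P i , ∈-allFin (v P i) , (i , ∈-upTo⁻ m , x∊ , refl) , ∈-upTo⁻ m , refl)
          (≤-trans (+-monoʳ-≤ _ (cnt≥1 (λ w → w ≟ᶠ v P p) (∈-allFin (v P p)) refl))
            (cnt-disjoint S? (λ w → w ≟ᶠ v P p) X? (allFin n) (λ _ → inj₁) (λ _ → inj₂)
              λ { _ (i , i< , _ , refl) eq → <⇒≢ i< (v-inj P (<⇒≤ i<) ≤-refl eq) }))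
          n≤
        where
        S X : V → Set
        S w = ∃ λ i → i < p × D P i × w ≡ v P i
        X w = S w ⊎ w ≡ v P p
        S? : ∀ w → Dec (S w)
        S? w = anyUpTo? (λ i → D? P i ×-dec (w ≟ᶠ v P i)) p
        X? : ∀ w → Dec (X w)
        X? w = S? w ⊎-dec (w ≟ᶠ v P p)
        A≡0 : #A P ≡ 0
        A≡0 = cnt-none (A? P) (upTo p) λ { _ (f , u , x∊ , _) → cnt-0 (F? P) (allFin M) F≡0 (∈-allFin f) (u , x∊) }
        avoid : ∀ {g} → Unused P g → ¬ v P p ∊ g → ∀ {w} → X w → ¬ w ∊ g
        avoid u y∉ (inj₂ refl) = y∉
        avoid {g} u y∉ (inj₁ (i , i< , x∊ , refl)) w∊ = cnt-0 (F? P₂) (allFin M) F₂≡0 (∈-allFin g)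
            (rotateD-unused P i< x∊ u , subst (_∊ g) (sym (rotateD-start P i< x∊)) w∊)
          where
          P₂ = rotateD P i< x∊
          F₂≡0 : #F P₂ ≡ 0
          F₂≡0 = n≤0⇒n≡0 (≤-trans (#F≤ P₂) (≤-trans (C-mono τ (≤-trans (best P₂ (#A′-rotateD P i< x∊)) (≤-reflexive A≡0))) (≤-reflexive (C≡0 (s≤s z≤n)))))

      Tame : Path p → Set
      Tame P = ∀ P′ → #A′ P ≤ #A′ P′ → #A P′ ≤ τ

      at-A : (P : Path p) → Tame P → ∀ {i g} → i < p → A P i → Unused P g → v P i ∊ g → v P 0 ∊ g
      at-A P tame {i} {g} i< Ai u z∊ = decidable-stable (v P 0 ∊? g) λ x∉ → u (i , i< , sym (same-edge (F? P₁) (one P₁ (tame P₁ (#A′-rotateA P i< Ai)))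
          (rotateA-free P i< Ai , start∊link P i< Ai)
          (rotateA-unused P i< Ai u (λ eq → x∉ (subst (v P 0 ∊_) (sym eq) (proj₁ (proj₂ (proj₂ Ai))))) , subst (_∊ g) (sym (rotateA-start P i< Ai)) z∊)))
        where P₁ = rotateA P i< Ai

      -- P need not contain all vertices here. That e_i lies on P comes from `link-on-path` for the
      -- reversed path, where A′ becomes A.
      no-A-after-A″ : (P : Path p) → ∀ {i} → suc i < p → A P (suc i) → A′ P i → ⊥
      no-A-after-A″ P {i} i< Ai A′i with mirror P (<-trans (n<1+n i) i<)
      ... | k , eq , k< = no-A-after-A′ P i< (λ {u} u∊ →
          let (j , j≤ , w≡) = link-on-path (reverse P) k< (A-reverse P eq A′i) (subst (u ∊_) (sym (reverse-e P eq)) u∊)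
          in p ∸ j , m∸n≤m p j , w≡) Ai A′i

      many-A : (P : Path p) → 1 ≤ #F P → τ ≤ #A P
      many-A P F≥ = ≮⇒≥ λ lt → <⇒≱ F≥ (≤-trans (#F≤ P) (≤-reflexive (C≡0 lt)))

      both-start-edges : (P : Path p) → Tame P → Tame (reverse P) → #A′ P ≤ τ → 1 ≤ #F P → 1 ≤ #F (reverse P) → ⊥
      both-start-edges P tame tameR a′≤ F≥ F≥R with avoiding-ends P (tame P ≤-refl) a′≤
      ... | g₁ , g₂ , ne , (u₁ , x₁ , y₁) , (u₂ , x₂ , y₂) = conclude (in-L {v P 0} x₁ x₂)
        where
        R = reverse P
        L₁ L₂ L : V → Set
        L₁ w = ∃ λ i → i < p × A P i × w ≡ v P i
        L₂ w = ∃ λ i → i < p × A′ P i × w ≡ v P (suc i)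
        L w = L₁ w ⊎ L₂ w
        L₁? : ∀ w → Dec (L₁ w)
        L₁? w = anyUpTo? (λ i → A? P i ×-dec (w ≟ᶠ v P i)) p
        L₂? : ∀ w → Dec (L₂ w)
        L₂? w = anyUpTo? (λ i → A′? P i ×-dec (w ≟ᶠ v P (suc i))) p
        L? : ∀ w → Dec (L w)
        L? w = L₁? w ⊎-dec L₂? w
        #L≥ : τ + τ ≤ cnt L? (allFin n)
        #L≥ = ≤-trans (+-mono-≤
          (≤-trans (many-A P F≥) (cnt-injection (A? P) L₁? (λ i w → i < p × w ≡ v P i) (λ { (i< , refl) (j< , eq) → v-inj P (<⇒≤ i<) (<⇒≤ j<) eq }) (upTo⁺ p)
            λ {i} m a → v P i , ∈-allFin (v P i) , (i , ∈-upTo⁻ m , a , refl) , ∈-upTo⁻ m , refl))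
          (≤-trans (≤-trans (many-A R F≥R) (#reverse-A P)) (cnt-injection (A′? P) L₂? (λ i w → i < p × w ≡ v P (suc i)) (λ { (i< , refl) (j< , eq) → suc-injective (v-inj P i< j< eq) }) (upTo⁺ p)
            λ {i} m a → v P (suc i) , ∈-allFin (v P (suc i)) , (i , ∈-upTo⁻ m , a , refl) , ∈-upTo⁻ m , refl)))
          (cnt-disjoint L₁? L₂? L? (allFin n) (λ _ → inj₁) (λ _ → inj₂)
            λ { _ (i , i< , a , refl) (j , j< , a′ , eq) → clash i< j< (v-inj P (<⇒≤ i<) j< eq) a a′ })
          where
          clash : ∀ {i j} → i < p → j < p → i ≡ suc j → A P i → A′ P j → ⊥
          clash i< _ refl a a′ = no-A-after-A″ P i< a a′
        avoid : ∀ {g} → Unused P g → ¬ v P 0 ∊ g → ¬ v P p ∊ g → ∀ {w} → L w → ¬ w ∊ g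
        avoid u x∉ y∉ (inj₁ (i , i< , a , refl)) w∊ = x∉ (at-A P tame i< a u w∊)
        avoid {g} u x∉ y∉ (inj₂ (i , i< , a′ , refl)) w∊ with mirror P i<
        ... | k , eq , k< = y∉ (subst (_∊ g) (reverse-v P {0} {p} refl) (at-A R tameR k< (A-reverse P eq a′) (reverse-unused P u)
            (subst (_∊ g) (sym (reverse-v P (trans (+-suc k i) eq))) w∊)))
        in-L : ∀ {w} → ¬ w ∊ g₁ → ¬ w ∊ g₂ → L w
        in-L {w} w₁ w₂ = decidable-stable (L? w) λ out → lia (cnt X? (allFin n) ∷ cnt L? (allFin n) ∷ r ∷ n ∷ ρ ∷ [])
            (λ x l r n t → x ⊕ σ r ≼ n ⇒ r ≈ σ (σ t) ⇒ σ t ⊕ σ t ≼ l ⇒ l ⊕ con 1 ≼ x ⇒ n ≼ con 2 ⊕ 2 ⊛ σ (σ t) ⇒ con 1 ≼ t ⇒ absurd) refl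
            (two-avoid ne X? (λ { (inj₁ l) → avoid u₁ x₁ y₁ l ; (inj₂ refl) → w₁ }) (λ { (inj₁ l) → avoid u₂ x₂ y₂ l ; (inj₂ refl) → w₂ }))
            r≡ #L≥
            (≤-trans (+-monoʳ-≤ _ (cnt≥1 (λ u → u ≟ᶠ w) (∈-allFin w) refl))
              (cnt-disjoint L? (λ u → u ≟ᶠ w) X? (allFin n) (λ _ → inj₁) (λ _ → inj₂) λ { _ l refl → out l })) n≤ 1≤ρ
          where
          X? : ∀ u → Dec (L u ⊎ u ≡ w)
          X? u = L? u ⊎-dec (u ≟ᶠ w)
        conclude : L (v P 0) → ⊥
        conclude (inj₂ (i , i< , _ , eq)) = 0≢1+n (v-inj P z≤n i< eq)
        conclude (inj₁ (i , i< , a , eq)) = go (v-inj P z≤n (<⇒≤ i<) eq) i< a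
          where
          go : ∀ {i} → 0 ≡ i → i < p → A P i → ⊥
          go refl 0< (f , u , x∊ , s∊) = e₀≢f (ext (e P 0) f λ w w∊ → inside (unused-inside P₂ free x₀∊ w∊))
            where
            fr = unused⇒free P {0} u
            P₂ = replace P 0 f x∊ s∊ fr
            e₀≢f : e P 0 ≢ f
            e₀≢f eq = u (0 , 0< , sym eq)
            free : Unused P₂ (e P 0)
            free = replace-unused-mid P x∊ s∊ fr 0< e₀≢f
            x₀∊ = inl P 0<
            A′₂ : ∀ {k} → A′ P k → A′ P₂ k
            A′₂ (g , u′ , y∊ , k∊) = g , replace-unused P x∊ s∊ fr u′ (λ { refl → noCycle P f u x∊ y∊ }) , y∊ , k∊
            tame₂ : Tame P₂
            tame₂ P′ le = tame P′ (≤-trans (cnt-mono (A′? P) (A′? P₂) (upTo p) (λ _ → A′₂)) le)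
            A₂ : ∀ {k} → k < p → A P₂ k → A P k
            A₂ {k} k< a₂ = back (in-L {v P k}
                (λ k∊ → x₁ (at-A P₂ tame₂ k< a₂ (replace-unused P x∊ s∊ fr u₁ (λ { refl → x₁ x∊ })) k∊))
                (λ k∊ → x₂ (at-A P₂ tame₂ k< a₂ (replace-unused P x∊ s∊ fr u₂ (λ { refl → x₂ x∊ })) k∊)))
              where
              back : L (v P k) → A P k
              back (inj₁ (i , i< , a , eq)) = subst (A P) (sym (v-inj P (<⇒≤ k<) (<⇒≤ i<) eq)) a
              back (inj₂ (j , j< , a′ , eq)) = ⊥-elim (no-A-after-A″ P₂ (subst (_< p) k≡ k<) (subst (A P₂) k≡ a₂) (A′₂ a′))
                where k≡ = v-inj P (<⇒≤ k<) j< eq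
            inside : ∀ {w} → Inside P₂ w → w ∊ f
            inside (inj₁ refl) = x∊
            inside (inj₂ (i , i< , a₂ , refl)) with A₂ i< a₂
            ... | f′ , u′ , x∊′ , s∊′ = subst (_ ∊_) (same-edge (F? P) (one P (tame P ≤-refl)) (u′ , x∊′) (u , x∊)) s∊′

    module OneGoodEnd (q≡ : q ≡ 2 * suc (suc ρ)) where

      open Full q≡

      private
        Good : Path p → Set
        Good P = Tame P × t ≤ #A′ P

        good-rotateD : (P : Path p) → ∀ {i} (i< : i < p) (x∊ : D P i) → Good P → Good (rotateD P i< x∊)
        good-rotateD P i< x∊ (tame , a′≥) = (λ P′ le → tame P′ (≤-trans (#A′-rotateD P i< x∊) le)) , ≤-trans a′≥ (#A′-rotateD P i< x∊)

        N≤ : (P : Path p) → Good P → #N P ≤ suc t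
        N≤ P (_ , a′≥) = lia (#A′ P ∷ #N P ∷ q ∷ τ ∷ []) (λ a n q t → a ⊕ n ≈ σ q ⇒ q ≈ 2 ⊛ σ t ⇒ σ t ≼ a ⇒ n ≼ σ (σ t)) refl (#N+#A′ P) q≡ a′≥

        N≥ : (P : Path p) → suc t ≤ #N P
        N≥ P = lia (#A′ P ∷ #N P ∷ q ∷ τ ∷ []) (λ a n q t → a ⊕ n ≈ σ q ⇒ q ≈ 2 ⊛ σ t ⇒ a ≼ σ t ⇒ σ (σ t) ≼ n) refl (#N+#A′ P) q≡ (A′≤ P)

        -- Below i the link e_l moves to index i - 1 - l, where membership in A′ is that of l + 1 in
        -- P; this accounts for the two different side conditions.
        link-position : (P : Path p) → ∀ {i} (i< : i < p) (x∊ : D P i) {l} → l < p → (l < i → ¬ A′ P (suc l)) → (i < l → ¬ A′ P l) →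
          ∃ λ a → a < p × e (rotateD P i< x∊) a ≡ e P l × ¬ A′ (rotateD P i< x∊) a
        link-position P {i} i< x∊ {l} l< lo hi with <-cmp l i
        ... | tri> _ _ i<l = l , l< , rotateD-e-≥ P i< x∊ (<⇒≤ i<l) , λ a′ → hi i<l (subst (A′ P) (flip-hi i<l) (A′-rotateD P i< x∊ a′))
        ... | tri≈ _ refl _ = l , l< , rotateD-e-≥ P i< x∊ ≤-refl , λ a′ → start-N P (subst (A′ P) (flip-lo (+-identityʳ l)) (A′-rotateD P i< x∊ a′))
        ... | tri< l<i _ _ with <-split l<i
        ... | b , eq = b , <-trans (subst (b <_) eq (s≤s (m≤n+m b l))) i< , re-lo P {i} {e P i} {b} {l} (trans (cong suc (+-comm b l)) eq) ,
          λ a′ → lo l<i (subst (A′ P) (flip-lo (trans (+-suc b l) (trans (cong suc (+-comm b l)) eq))) (A′-rotateD P i< x∊ a′))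

        nearly-full : (P : Path p) → Good P → ∀ {k l} → k < p → l < p → k ≢ l → ¬ A′ P k → ¬ A′ P l → ¬ D P k → ¬ D P l → ⊥
        nearly-full P good@(tame , _) {k} {l} k< l< ne nk nl dk dl = lia (#F P ∷ #D P ∷ #N P ∷ cnt Y? (upTo p) ∷ τ ∷ [])
            (λ f d n y t → σ (σ t) ≼ f ⊕ d ⇒ f ≼ con 1 ⇒ n ≼ σ (σ t) ⇒ d ⊕ y ≼ n ⇒ con 2 ≼ y ⇒ absurd) refl
            (total′ P) (one P (tame P ≤-refl)) (N≤ P good)
            (cnt-disjoint (D? P) Y? (N? P) (upTo p) (λ m → D∩A′ P (∈-upTo⁻ m)) (λ { _ (inj₁ refl) → nk ; _ (inj₂ refl) → nl })
              λ { _ d (inj₁ refl) → dk d ; _ d (inj₂ refl) → dl d })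
            (≤-trans (+-mono-≤ (cnt≥1 (λ m → m ≟ k) (∈-upTo⁺ k<) refl) (cnt≥1 (λ m → m ≟ l) (∈-upTo⁺ l<) refl))
              (cnt-disjoint (λ m → m ≟ k) (λ m → m ≟ l) Y? (upTo p) (λ _ → inj₁) (λ _ → inj₂) λ { _ refl eq → ne eq }))
          where
          Y? : ∀ m → Dec (m ≡ k ⊎ m ≡ l)
          Y? m = (m ≟ k) ⊎-dec (m ≟ l)

        start-edge : (P : Path p) → Good P → ∀ {j} → j < p → ¬ A′ P j → ¬ D P j → ∃ λ f → Unused P f × v P 0 ∊ f
        start-edge P good {j} j< nj dj = let (f , _ , h) = cnt-∃ (F? P) (allFin M) F≥ in f , h
          where
          F≥ : 1 ≤ #F P
          F≥ = lia (#F P ∷ #D P ∷ #N P ∷ τ ∷ []) (λ f d n t → σ (σ t) ≼ f ⊕ d ⇒ n ≼ σ (σ t) ⇒ d ⊕ con 1 ≼ n ⇒ con 1 ≼ f) refl (total′ P) (N≤ P good)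
            (≤-trans (+-monoʳ-≤ (#D P) (cnt≥1 (λ m → m ≟ j) (∈-upTo⁺ j<) refl))
              (cnt-disjoint (D? P) (λ m → m ≟ j) (N? P) (upTo p) (λ m → D∩A′ P (∈-upTo⁻ m)) (λ { _ refl → nj }) λ { _ d refl → dj d }))

        keep-last : (P : Path p) → ∀ {i} (i< : i < p) (x∊ : D P i) {j} → i < j → ¬ A′ P j → ¬ v P i ∊ e P j →
          ¬ A′ (rotateD P i< x∊) j × ¬ D (rotateD P i< x∊) j
        keep-last P i< x∊ i<j nj i∉ = (λ a′ → nj (subst (A′ P) (flip-hi i<j) (A′-rotateD P i< x∊ a′))) ,
          λ d → i∉ (subst₂ _∊_ (rotateD-start P i< x∊) (rotateD-e-≥ P i< x∊ (<⇒≤ i<j)) d)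

        Off : Path p → ℕ → ℕ → Set
        Off P j i = ¬ A′ P i × ¬ v P i ∊ e P j

        off? : ∀ P j i → Dec (Off P j i)
        off? P j i = N? P i ×-dec ¬? (v P i ∊? e P j)

        -- Of the t vertices of e_j one is v_{j+1}, whose index is not in N. So e_j takes at most t
        -- - 1 of the t + 1 vertices indexed by N.
        off-last : (P : Path p) → ∀ {j} → j < p → (∀ {k} → j < k → k < p → A′ P k) → 2 ≤ cnt (off? P j) (upTo p)
        off-last P {j} j< above = lia (#N P ∷ cnt on? (upTo p) ∷ cnt (off? P j) (upTo p) ∷ r ∷ ρ ∷ [])
            (λ n o f r t → σ (σ (σ t)) ≼ n ⇒ n ≼ o ⊕ f ⇒ o ⊕ con 1 ≼ r ⇒ r ≈ σ (σ t) ⇒ con 2 ≼ f) refl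
            (N≥ P) (cnt-cover (N? P) on? (off? P j) (upTo p) λ {i} m h → split i (∈-upTo⁻ m) h)
            (≤-trans (+-mono-≤
                (cnt-injection on? on? _≡_ (λ { refl refl → refl }) (upTo⁺ p) λ {i} m h → i , ∈-upTo⁺ (≤-trans (∈-upTo⁻ m) (n≤1+n p)) , h , refl)
                (cnt≥1 (λ i → i ≟ suc j) {upTo (suc p)} (∈-upTo⁺ (s≤s j<)) refl))
              (≤-trans (cnt-disjoint on? (λ i → i ≟ suc j) I? (upTo (suc p)) (λ _ → inj₁) (λ _ → inj₂) λ { _ (lt , nk , _) refl → nk (above ≤-refl lt) })
                (indexed≤ (e P j) I? (suc p) (v P) (λ i< j< _ _ → v-inj P (s≤s⁻¹ i<) (s≤s⁻¹ j<)) λ { _ (inj₁ (_ , _ , h)) → h ; _ (inj₂ refl) → inr P j< })))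
            r≡
          where
          on? : ∀ i → Dec (i < p × ¬ A′ P i × v P i ∊ e P j)
          on? i = (i <? p) ×-dec (N? P i ×-dec (v P i ∊? e P j))
          I? : ∀ i → Dec ((i < p × ¬ A′ P i × v P i ∊ e P j) ⊎ i ≡ suc j)
          I? i = on? i ⊎-dec (i ≟ suc j)
          split : ∀ i → i < p → ¬ A′ P i → (i < p × ¬ A′ P i × v P i ∊ e P j) ⊎ Off P j i
          split i i< h with v P i ∊? e P j
          ... | yes a = inj₁ (i< , h , a)
          ... | no a = inj₂ (h , a)

      module Final (P : Path p) (good : Good P) {j} (j< : j < p) (nj : ¬ A′ P j) (above : ∀ {k} → j < k → k < p → A′ P k) (x∉ : ¬ D P j) where

        private
          tame = proj₁ good
          0< = positive P

          D-all : ∀ {i} → i < p → ¬ A′ P i → i ≢ j → D P i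
          D-all {i} i< ni ne = decidable-stable (D? P i) λ nd → nearly-full P good i< j< ne ni nj nd x∉

          ≤j : ∀ {i} → i < p → ¬ A′ P i → i ≤ j
          ≤j i< ni = ≮⇒≥ λ j<i → ni (above j<i i<)

          f = proj₁ (start-edge P good j< nj x∉)
          uf = proj₁ (proj₂ (start-edge P good j< nj x∉))
          x∊f = proj₂ (proj₂ (start-edge P good j< nj x∉))

          #A≥ : τ ≤ #A P
          #A≥ = many-A P (cnt≥1 (F? P) (∈-allFin f) (uf , x∊f))

          -- A omits at most two of the t + 1 indices in N, and these are 0 and i.
          third-in-A : ∀ {i l} → i < p → l < p → ¬ A′ P i → ¬ A′ P l → ¬ A P 0 → ¬ A P i → i ≢ 0 → l ≢ 0 → l ≢ i → A P l
          third-in-A {i} {l} i< l< ni nl a0 ai i≢0 l≢0 l≢i = decidable-stable (A? P l) λ al →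
            lia (#A P ∷ #N P ∷ cnt X? (upTo p) ∷ cnt Y? (upTo p) ∷ τ ∷ [])
              (λ a n x y t → t ≼ a ⇒ n ≼ σ (σ t) ⇒ a ⊕ x ≼ n ⇒ con 1 ⊕ y ≼ x ⇒ con 2 ≼ y ⇒ absurd) refl
              #A≥ (N≤ P good)
              (cnt-disjoint (A? P) X? (N? P) (upTo p) (λ m → A∩A′ P (∈-upTo⁻ m))
                (λ { _ (inj₁ refl) → start-N P ; _ (inj₂ (inj₁ refl)) → ni ; _ (inj₂ (inj₂ refl)) → nl })
                λ { _ a (inj₁ refl) → a0 a ; _ a (inj₂ (inj₁ refl)) → ai a ; _ a (inj₂ (inj₂ refl)) → al a })
              (≤-trans (+-monoˡ-≤ _ (cnt≥1 (λ m → m ≟ 0) (∈-upTo⁺ 0<) refl))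
                (cnt-disjoint (λ m → m ≟ 0) Y? X? (upTo p) (λ _ → inj₁) (λ _ → inj₂)
                  λ { _ refl (inj₁ eq) → i≢0 (sym eq) ; _ refl (inj₂ eq) → l≢0 (sym eq) }))
              (≤-trans (+-mono-≤ (cnt≥1 (λ m → m ≟ i) (∈-upTo⁺ i<) refl) (cnt≥1 (λ m → m ≟ l) (∈-upTo⁺ l<) refl))
                (cnt-disjoint (λ m → m ≟ i) (λ m → m ≟ l) Y? (upTo p) (λ _ → inj₁) (λ _ → inj₂) λ { _ refl eq → l≢i (sym eq) }))
            where
            Y? : ∀ m → Dec (m ≡ i ⊎ m ≡ l)
            Y? m = (m ≟ i) ⊎-dec (m ≟ l)
            X? : ∀ m → Dec (m ≡ 0 ⊎ (m ≡ i ⊎ m ≡ l))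
            X? m = (m ≟ 0) ⊎-dec Y? m

          unused-at : ∀ {l} → l < p → Off P j l → ∃ λ h → Unused P h × v P l ∊ h
          unused-at {l} l< (nl , l∉) =
              let (h , u , z∊) = start-edge P₃ (good-rotateD P l< x∊ᵢ good) j< (proj₁ kept) (proj₂ kept)
              in h , unused-rotateD P l< x∊ᵢ u , subst (_∊ h) (rotateD-start P l< x∊ᵢ) z∊
            where
            l≢j : l ≢ j
            l≢j refl = l∉ (inl P l<)
            x∊ᵢ : D P l
            x∊ᵢ = D-all l< nl l≢j
            P₃ : Path p
            P₃ = rotateD P l< x∊ᵢ
            kept : ¬ A′ P₃ j × ¬ D P₃ j
            kept = keep-last P l< x∊ᵢ (≤∧≢⇒< (≤j l< nl) l≢j) nj l∉

          module Gap {i′} (i< : suc i′ < p) (ni : ¬ A′ P (suc i′)) (i≢j : suc i′ ≢ j) (A′i′ : A′ P i′) where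

            i = suc i′
            x∊ᵢ : D P i
            x∊ᵢ = D-all i< ni i≢j
            i′< : i′ < p
            i′< = <-trans (n<1+n i′) i<
            1≤i′ : 1 ≤ i′
            1≤i′ = ≰⇒> λ { z≤n → start-N P A′i′ }
            ¬Ai : ¬ A P i
            ¬Ai a = A-after-A′-absurd P i< a A′i′
            i<j : i < j
            i<j = ≤∧≢⇒< (≤j i< ni) i≢j
            P₂ = rotateD P i< x∊ᵢ
            good₂ : Good P₂
            good₂ = good-rotateD P i< x∊ᵢ good
            F₂≡0 : #F P₂ ≡ 0
            F₂≡0 = cnt-none (F? P₂) (allFin M) λ { {h} _ (u , z∊) → bypass P i< x∊ᵢ A′i′ (unused-rotateD P i< x∊ᵢ u) (subst (_∊ h) (rotateD-start P i< x∊ᵢ) z∊) }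
            D₂ : ∀ {k} → k < p → ¬ A′ P₂ k → D P₂ k
            D₂ = D-full P₂ (≤-trans (N≤ P₂ good₂) (subst (λ m → suc t ≤ m + #D P₂) F₂≡0 (total′ P₂)))
            on : ∀ {l} → l < p → (l < i → ¬ A′ P (suc l)) → (i < l → ¬ A′ P l) → v P i ∊ e P l
            on l< lo hi with link-position P i< x∊ᵢ l< lo hi
            ... | a , a< , eq , na = subst₂ _∊_ (rotateD-start P i< x∊ᵢ) eq (D₂ a< na)
            ¬A′1 : ¬ A′ P 1
            ¬A′1 a′ = bypass P₂ {i′} {f} i< (subst₂ _∊_ (sym (rotateD-start P i< x∊ᵢ)) (sym (rotateD-e-≥ P i< x∊ᵢ ≤-refl)) (inl P i<))
              (subst (A′ P₂) (flip-lo refl) (rotateD-A′ P i< x∊ᵢ a′)) (rotateD-unused P i< x∊ᵢ uf)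
              (subst (_∊ f) (cong (v P) (sym (flip-lo (+-identityʳ i)))) x∊f)
            ¬A0 : ¬ A P 0
            ¬A0 a = link-above P 0< a 1≤i′ i′< (on 0< (λ _ → ¬A′1) (λ ())) A′i′

            below : ∀ {l′} → suc l′ < i → Off P j (suc l′) → (∃ λ h → Unused P h × v P (suc l′) ∊ h) → ⊥
            below {l′} l<i (nl , l∉) (h , u , l∊) = link-above P l< Al l<i′ i′< (on l< (λ _ → ¬A′) (λ i<l → ⊥-elim (<-asym i<l l<i))) A′i′
              where
              l = suc l′
              l< : l < p
              l< = <-trans l<i i<
              l<i′ : l < i′
              l<i′ = ≤∧≢⇒< (s≤s⁻¹ l<i) λ { refl → nl A′i′ }
              Al : A P l
              Al = third-in-A i< l< ni nl ¬A0 ¬Ai (λ ()) (λ ()) (<⇒≢ l<i)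
              ¬A′ : ¬ A′ P (suc l)
              ¬A′ a′ with ≤-split (s≤s⁻¹ l<i)
              ... | b , eq = bypass P₂ {b} {h} b<
                  (subst₂ _∊_ (sym (rotateD-start P i< x∊ᵢ)) (sym (re-lo P {i} {e P i} {suc b} {l′} (cong suc (trans (cong suc (+-comm b l′)) eq))))
                    (on (<-trans (n<1+n l′) l<) (λ _ → nl) (λ i<l′ → ⊥-elim (<-asym i<l′ (<-trans (n<1+n l′) l<i)))))
                  (subst (A′ P₂) (flip-lo (cong suc eq)) (rotateD-A′ P i< x∊ᵢ a′)) (rotateD-unused P i< x∊ᵢ u)
                  (subst (_∊ h) (cong (v P) (sym (flip-lo (trans (cong suc (+-comm b l)) (cong suc eq))))) l∊)
                where
                b< : suc b < p
                b< = ≤-trans (s≤s (s≤s (subst (b ≤_) eq (m≤n+m b l)))) i<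

            beyond : ∀ {l′} → i < suc l′ → suc l′ < p → Off P j (suc l′) → (∃ λ h → Unused P h × v P (suc l′) ∊ h) → ⊥
            beyond {l′} i<l l< (nl , l∉) (h , u , l∊) with l′ ≟ i
            ... | yes refl = ¬Ai (h , u , at-A P tame l< (third-in-A i< l< ni nl ¬A0 ¬Ai (λ ()) (λ ()) (λ eq → <⇒≢ i<l (sym eq))) u l∊ , l∊)
            ... | no ne = link-inside P {l′} {i′} l< (third-in-A i< l′< ni nl′ ¬A0 ¬Ai (λ ()) l′≢0 ne) (s≤s⁻¹ i<l)
                (on l< (λ l<i → ⊥-elim (<-asym i<l l<i)) (λ _ → nl)) A′i′
              where
              l′< : l′ < p
              l′< = <-trans (n<1+n l′) l<
              l′≢0 : l′ ≢ 0
              l′≢0 refl = <⇒≱ (s≤s⁻¹ i<l) z≤n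
              nl′ : ¬ A′ P l′
              nl′ a′ = bypass P l< (D-all l< nl λ { refl → l∉ (inl P l<) }) a′ u l∊

            absurdity : ⊥
            absurdity = found (two-elements (off? P j) _≟_ (upTo p) (upTo⁺ p) (off-last P j< above) 0)
              where
              locate : ∀ {l′} → suc l′ < p → Off P j (suc l′) → ⊥
              locate {l′} l< off with <-cmp (suc l′) i
              ... | tri< lt _ _ = below lt off (unused-at l< off)
              ... | tri≈ _ refl _ = proj₂ off (on j< (λ j<i → ⊥-elim (<-asym j<i i<j)) (λ _ → nj))
              ... | tri> _ _ gt = beyond gt l< off (unused-at l< off)
              found : (∃ λ l → l ∈ upTo p × Off P j l × l ≢ 0) → ⊥
              found (zero , _ , _ , ne) = ne refl
              found (suc l′ , m , off , _) = locate (∈-upTo⁻ m) off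

          down : ∀ {i k} → i < p → ¬ A′ P i → i ≢ j → k ≤ i → ¬ A′ P k
          down {zero} i< ni ne z≤n = ni
          down {suc i} {k} i< ni ne k≤ with m≤n⇒m<n∨m≡n k≤
          ... | inj₂ refl = ni
          ... | inj₁ k<i = down i′< (λ a′ → Gap.absurdity i< ni ne a′) (λ { refl → <⇒≱ ≤-refl (≤j i< ni) }) (s≤s⁻¹ k<i)
            where i′< = <-trans (n<1+n i) i<

          J? : ∀ k → Dec (¬ A′ P k × k ≢ j)
          J? k = N? P k ×-dec ¬? (k ≟ j)

          J-bound : ∀ b → (∀ {k} → k < p → ¬ A′ P k → k ≢ j → k < b) → t ≤ b
          J-bound b bound = lia (#N P ∷ cnt J? (upTo p) ∷ cnt (λ k → k ≟ j) (upTo p) ∷ b ∷ τ ∷ [])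
              (λ n c d b t → σ (σ t) ≼ n ⇒ n ≼ c ⊕ d ⇒ d ≼ con 1 ⇒ c ≼ b ⇒ σ t ≼ b) refl
              (N≥ P) (cnt-cover (N? P) J? (λ k → k ≟ j) (upTo p) λ {k} _ nk → split k nk)
              (cnt≤1 (λ k → k ≟ j) (upTo p) (upTo⁺ p) λ { _ _ refl refl → refl })
              (≤-trans (cnt-injection J? J? _≡_ (λ { refl refl → refl }) {upTo p} {upTo b} (upTo⁺ p)
                λ {k} m h → k , ∈-upTo⁺ (bound (∈-upTo⁻ m) (proj₁ h) (proj₂ h)) , h , refl) (cnt-upTo≤ J? b))
            where
            split : ∀ k → ¬ A′ P k → (¬ A′ P k × k ≢ j) ⊎ k ≡ j
            split k nk with k ≟ j
            ... | yes eq = inj₂ eq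
            ... | no ne = inj₁ (nk , ne)

          t≤j : t ≤ j
          t≤j = J-bound j λ k< nk ne → ≤∧≢⇒< (≤j k< nk) ne

          t≤p : t ≤ p
          t≤p = ≤-trans t≤j (<⇒≤ j<)

          initial : ∀ {i} → i < t → ¬ A′ P i
          initial {i} i<t a′ = <⇒≱ i<t (J-bound i λ k< nk ne → ≰⇒> λ i≤k → down k< nk ne i≤k a′)

          -- Rotated to the start, v_i is subject to `nearly-full`, and the links of N keep indices
          -- outside A′.
          one-miss : ∀ {i l l′} → i < t → l < p → l′ < p → l ≢ l′ → (l < t ⊎ l ≡ j) → (l′ < t ⊎ l′ ≡ j) → ¬ v P i ∊ e P l → ¬ v P i ∊ e P l′ → ⊥
          one-miss {i} {l} {l′} i<t l< l′< ne c c′ m m′ = clash (position l< c) (position l′< c′)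
            where
            i< : i < p
            i< = ≤-trans i<t t≤p
            x∊ᵢ : D P i
            x∊ᵢ = D-all i< (initial i<t) (<⇒≢ (≤-trans i<t t≤j))
            P₂ : Path p
            P₂ = rotateD P i< x∊ᵢ
            At : ℕ → Set
            At l = ∃ λ a → a < p × e P₂ a ≡ e P l × ¬ A′ P₂ a
            position : ∀ {l} → l < p → (l < t ⊎ l ≡ j) → At l
            position l< (inj₁ l<t) = link-position P i< x∊ᵢ l< (λ l<i → initial (≤-trans (s≤s l<i) i<t)) (λ _ → initial l<t)
            position l< (inj₂ refl) = link-position P i< x∊ᵢ l< (λ j<i → ⊥-elim (<⇒≱ (<-trans j<i i<t) t≤j)) (λ _ → nj)
            clash : At l → At l′ → ⊥
            clash (a , a< , eq , na) (a′ , a′< , eq′ , na′) = nearly-full P₂ (good-rotateD P i< x∊ᵢ good) a< a′<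
              (λ { refl → ne (e-inj P l< l′< (trans (sym eq) eq′)) }) na na′
              (λ d → m (subst₂ _∊_ (rotateD-start P i< x∊ᵢ) eq d)) (λ d → m′ (subst₂ _∊_ (rotateD-start P i< x∊ᵢ) eq′ d))

          bad? : ∀ l → Dec (∃ λ i → i < t × ¬ v P i ∊ e P l)
          bad? l = anyUpTo? (λ i → ¬? (v P i ∊? e P l)) t

          last? : ∀ i → Dec (v P i ∊ e P j)
          last? i = v P i ∊? e P j

          -- Assign to a bad link e_l a vertex v_i that it misses. By `one-miss` this vertex does
          -- not miss e_j, and it determines l.
          bad≤ : cnt bad? (upTo t) ≤ cnt last? (upTo t)
          bad≤ = cnt-injection bad? last? (λ l i → l < t × i < t × ¬ v P i ∊ e P l)
            (λ {l} {l′} (l<t , i<t , m) (l<t′ , _ , m′) → decidable-stable (l ≟ l′) λ ne →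
              one-miss i<t (≤-trans l<t t≤p) (≤-trans l<t′ t≤p) ne (inj₁ l<t) (inj₁ l<t′) m m′) (upTo⁺ t)
            λ { {l} m (i , i<t , miss) → i , ∈-upTo⁺ i<t , decidable-stable (last? i) (λ miss′ →
                  one-miss i<t (≤-trans (∈-upTo⁻ m) t≤p) j< (<⇒≢ (≤-trans (∈-upTo⁻ m) t≤j)) (inj₁ (∈-upTo⁻ m)) (inj₂ refl) miss miss′) ,
                ∈-upTo⁻ m , i<t , miss }

          last≤ : cnt last? (upTo t) + 2 ≤ r
          last≤ = ≤-trans (+-mono-≤
              (cnt-injection last? on? _≡_ (λ { refl refl → refl }) (upTo⁺ t) λ {i} m h → i , ∈-upTo⁺ (≤-trans (∈-upTo⁻ m) (≤-trans t≤p (n≤1+n p))) , (∈-upTo⁻ m , h) , refl)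
              (≤-trans (+-mono-≤ (cnt≥1 (λ i → i ≟ j) {upTo (suc p)} (∈-upTo⁺ (<-trans j< (n<1+n p))) refl) (cnt≥1 (λ i → i ≟ suc j) {upTo (suc p)} (∈-upTo⁺ (s≤s j<)) refl))
                (cnt-disjoint (λ i → i ≟ j) (λ i → i ≟ suc j) own? (upTo (suc p)) (λ _ → inj₁) (λ _ → inj₂) λ { _ refl eq → 1+n≢n (sym eq) })))
              (≤-trans (cnt-disjoint on? own? I? (upTo (suc p)) (λ _ → inj₁) (λ _ → inj₂)
                  λ { _ (lt , _) (inj₁ refl) → <⇒≱ lt t≤j ; _ (lt , _) (inj₂ refl) → <⇒≱ lt (≤-trans t≤j (n≤1+n j)) })
                (indexed≤ (e P j) I? (suc p) (v P) (λ i< j< _ _ → v-inj P (s≤s⁻¹ i<) (s≤s⁻¹ j<))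
                  λ { _ (inj₁ (_ , h)) → h ; _ (inj₂ (inj₁ refl)) → inl P j< ; _ (inj₂ (inj₂ refl)) → inr P j< }))
            where
            on? : ∀ i → Dec (i < t × v P i ∊ e P j)
            on? i = (i <? t) ×-dec last? i
            own? : ∀ i → Dec (i ≡ j ⊎ i ≡ suc j)
            own? i = (i ≟ j) ⊎-dec (i ≟ suc j)
            I? : ∀ i → Dec ((i < t × v P i ∊ e P j) ⊎ (i ≡ j ⊎ i ≡ suc j))
            I? i = on? i ⊎-dec own? i

          good-links : 2 ≤ cnt (λ l → ¬? (bad? l)) (upTo t)
          good-links = lia (cnt bad? (upTo t) ∷ cnt (λ l → ¬? (bad? l)) (upTo t) ∷ cnt last? (upTo t) ∷ r ∷ ρ ∷ [])
            (λ b g l r t → b ⊕ g ≈ σ (σ t) ⇒ b ≼ l ⇒ l ⊕ con 2 ≼ r ⇒ r ≈ σ (σ t) ⇒ con 2 ≼ g) refl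
            (trans (cnt-¬ bad? (upTo t)) (length-upTo t)) bad≤ last≤ r≡

          contains : ∀ {l} → ¬ (∃ λ i → i < t × ¬ v P i ∊ e P l) → ∀ {i} → i < t → v P i ∊ e P l
          contains {l} nb {i} i<t = decidable-stable (v P i ∊? e P l) λ miss → nb (i , i<t , miss)

        -- At most r - 2 of v_0, ..., v_{t-1} are on e_j, so at least two of the links e_0, ...,
        -- e_{t-1} are not bad. Both consist of exactly these t vertices.
        final-absurd : ⊥
        final-absurd =
            let (l , m , nb) = cnt-∃ (λ l → ¬? (bad? l)) (upTo t) (≤-trans (s≤s z≤n) good-links)
                (l′ , m′ , nb′ , ne) = two-elements (λ l → ¬? (bad? l)) _≟_ (upTo t) (upTo⁺ t) good-links l
            in ne (sym (e-inj P (≤-trans (∈-upTo⁻ m) t≤p) (≤-trans (∈-upTo⁻ m′) t≤p) (ext (e P l) (e P l′) (same nb nb′))))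
          where
          first? : ∀ w → Dec (∃ λ i → i < t × w ≡ v P i)
          first? w = anyUpTo? (λ i → w ≟ᶠ v P i) t
          below? : ∀ i → Dec (i < t)
          below? i = i <? t
          same : ∀ {l l′} → ¬ (∃ λ i → i < t × ¬ v P i ∊ e P l) → ¬ (∃ λ i → i < t × ¬ v P i ∊ e P l′) → ∀ w → w ∊ e P l → w ∊ e P l′
          same {l} {l′} nb nb′ w w∊ = decidable-stable (w ∊? e P l′) λ w∉ → lia (cnt first? (allFin n) ∷ cnt below? (upTo t) ∷ r ∷ ρ ∷ [])
            (λ a b r t → b ≈ σ (σ t) ⇒ b ≼ a ⇒ a ⊕ con 1 ≼ r ⇒ r ≈ σ (σ t) ⇒ absurd) refl
            (trans (cnt-all below? (upTo t) ∈-upTo⁻) (length-upTo t))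
            (cnt-injection below? first? (λ i w → i < t × w ≡ v P i)
              (λ { (i< , refl) (j< , eq) → v-inj P (≤-trans (<⇒≤ i<) t≤p) (≤-trans (<⇒≤ j<) t≤p) eq }) (upTo⁺ t)
              λ {i} _ i< → v P i , ∈-allFin (v P i) , (i , i< , refl) , i< , refl)
            (subst (cnt first? (allFin n) + 1 ≤_) (size (e P l))
              (≤-trans (+-monoʳ-≤ _ (cnt≥1 (λ u → u ≟ᶠ w) (∈-allFin w) refl))
                (cnt-disjoint first? (λ u → u ≟ᶠ w) (λ u → u ∊? e P l) (allFin n) (λ { _ (i , i< , refl) → contains nb i< }) (λ { _ refl → w∊ })
                  λ { _ (i , i< , refl) refl → w∉ (contains nb′ i<) })))
            r≡

      -- Of two vertices off the last link of N, `nearly-full` makes one a possible start; rotating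
      -- to it leads to `Final`.
      one-good-end : (P : Path p) → Tame P → t ≤ #A′ P → ⊥
      one-good-end P tame a′≥ = rotate-away (max (N? P) p (positive P) (start-N P))
        where
        good : Good P
        good = tame , a′≥
        rotate-away : (∃ λ j → j < p × ¬ A′ P j × (∀ {k} → j < k → k < p → ¬ ¬ A′ P k)) → ⊥
        rotate-away (j , j< , nj , above) =
            let (i , m , off) = cnt-∃ (off? P j) (upTo p) (≤-trans (s≤s z≤n) two)
                (i₂ , m₂ , off₂ , ne) = two-elements (off? P j) _≟_ (upTo p) (upTo⁺ p) two i
            in select (∈-upTo⁻ m) (∈-upTo⁻ m₂) off off₂ ne (D? P i) (D? P i₂)
          where
          two : 2 ≤ cnt (off? P j) (upTo p)
          two = off-last P j< (λ a b → A′-stable P (above a b))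
          use : ∀ {i} → i < p → Off P j i → D P i → ⊥
          use {i} i< (ni , i∉) x∊ = Final.final-absurd (rotateD P i< x∊) (good-rotateD P i< x∊ good) j< (proj₁ kept)
              (λ {k} j<k k< → subst (A′ (rotateD P i< x∊)) (flip-hi (<-trans i<j j<k)) (rotateD-A′ P i< x∊ (A′-stable P (above j<k k<)))) (proj₂ kept)
            where
            i<j : i < j
            i<j = ≤∧≢⇒< (≮⇒≥ λ j<i → above j<i i< ni) λ { refl → i∉ (inl P i<) }
            kept = keep-last P i< x∊ i<j nj i∉
          select : ∀ {i i₂} → i < p → i₂ < p → Off P j i → Off P j i₂ → i₂ ≢ i → Dec (D P i) → Dec (D P i₂) → ⊥
          select i< _ off _ _ (yes d) _ = use i< off d
          select _ i₂< _ off₂ _ _ (yes d) = use i₂< off₂ d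
          select i< i₂< off off₂ ne (no d) (no d₂) = nearly-full P good i₂< i< ne (proj₁ off₂) (proj₁ off) d₂ d

    private
      tame-best : (P : Path p) → (∀ P′ → #A P′ + #A′ P′ ≤ #A P + #A′ P) → ∀ P′ → #A′ P ≤ #A′ P′ → #A P′ ≤ #A P
      tame-best P best P′ le = lia (#A P′ ∷ #A′ P′ ∷ #A P ∷ #A′ P ∷ []) (λ a b c d → a ⊕ b ≼ c ⊕ d ⇒ d ≼ b ⇒ a ≼ c) refl (best P′) le

    best-path-absurd : (P : Path p) → (∀ P′ → #A P′ + #A′ P′ ≤ #A P + #A′ P) → ⊥
    best-path-absurd P best with t ≤? #A P | t ≤? #A′ P
    ... | yes a≥ | yes a′≥ = Full.both-good-absurd (good-end P a′≥) P a≥ a′≥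
    ... | no a< | yes a′≥ = OneGoodEnd.one-good-end (good-end P a′≥) P (λ P′ le → ≤-trans (tame-best P best P′ le) (s≤s⁻¹ (≰⇒> a<))) a′≥
    ... | yes a≥ | no a′< = OneGoodEnd.one-good-end (good-end R a≥R) R
          (λ P′ le → ≤-trans (tame-best R (best-reverse P best) P′ le) (≤-trans (#reverse-A P) (s≤s⁻¹ (≰⇒> a′<)))) a≥R
      where
      R = reverse P
      a≥R = ≤-trans a≥ (#A′-reverse P)
    ... | no a< | no a′< = cases (#F P ≟ 0) (#F R ≟ 0)
      where
      R = reverse P
      a≤ : #A P ≤ τ
      a≤ = s≤s⁻¹ (≰⇒> a<)
      a′≤ : #A′ P ≤ τ
      a′≤ = s≤s⁻¹ (≰⇒> a′<)
      bestR = best-reverse P best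
      cases : Dec (#F P ≡ 0) → Dec (#F R ≡ 0) → ⊥
      cases (yes F≡0) _ = no-start-edge P (tame-best P best) a′≤ F≡0
      cases _ (yes F≡0) = no-start-edge R (tame-best R bestR) (≤-trans (#reverse-A′ P) a≤) F≡0
      cases (no F≢0) (no F≢0R) = both-start-edges P (λ P′ le → ≤-trans (tame-best P best P′ le) a≤)
        (λ P′ le → ≤-trans (tame-best R bestR P′ le) (≤-trans (#reverse-A P) a′≤)) a′≤ (n≢0⇒n>0 F≢0) (n≢0⇒n>0 F≢0R)

  -- Extremal choice of the path, and cycles that are not Hamiltonian

  longest-absurd : (∀ p → (Path (suc p) → ⊥) → Path p → ⊥) → ∀ {p} → Path p → ⊥
  longest-absurd step {p} P = go n (m≤n+m n p) P
    where
    go : ∀ d {p} → n ≤ p + d → Path p → ⊥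
    go zero {p} le P = <⇒≱ (path<n P) (≤-trans le (≤-reflexive (+-identityʳ p)))
    go (suc d) {p} le P = step p (go d (≤-trans le (≤-reflexive (+-suc p d)))) P

  maximum-absurd : ∀ {p} (m : Path p → ℕ) {b} → (∀ P → m P ≤ b) → (∀ P → (∀ P′ → m P′ ≤ m P) → ⊥) → Path p → ⊥
  maximum-absurd m {b} m≤ step P = go b P (m≤n+m b (m P))
    where
    go : ∀ d P → b ≤ m P + d → ⊥
    go zero P le = step P λ P′ → ≤-trans (m≤ P′) (≤-trans le (≤-reflexive (+-identityʳ (m P))))
    go (suc d) P le = step P λ P′ → ≮⇒≥ λ lt → go d P′ (≤-trans le (≤-trans (≤-reflexive (+-suc (m P) d)) (+-monoˡ-≤ d lt)))

  -- An edge leaving a cycle extends the cycle, cut suitably, to a longer path.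
  extend : ∀ {p} (L : Loop p) {h k} → z L ∊ h → k ≤ p → v (Q L) k ∊ h → Path (suc p)
  extend {p} L {h} {k} z∊ k≤ k∊ with anyUpTo? (λ l → h ≟ᶠ e (Q L) l) p | h ≟ᶠ φ L
  ... | yes (l , l< , refl) | _ = cons (Q loop) (z loop) (φ loop) (z∉ loop) (uφ loop)
          (subst₂ _∊_ (sym same-z) (sym (trans closing (link-lo L l<))) z∊) (x∊ loop)
    where open CutAt (cut L l (<⇒≤ l<))
  ... | no _ | yes refl = cons (Q L) (z L) h (z∉ L) (uφ L) z∊ (x∊ L)
  ... | no u | no ne = cons (reverse (Q loop)) (z loop) h (λ {l} l≤ → z∉ loop (m∸n≤m p l)) (reverse-unused (Q loop) (proj₁ (proj₂ (star (z∊ , u , ne)))))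
          (subst (_∊ h) (sym same-z) z∊) (subst (_∊ h) (sym (trans (reverse-v (Q loop) {0} {p} refl) at-end)) k∊)
    where open CutAt (cut L k k≤)

  module _ {ρ τ : ℕ} (1≤ρ : 1 ≤ ρ) (r≡ : r ≡ suc (suc ρ)) (ρ<τ : suc ρ ≤ τ)
    (n≤ : n ≤ 2 + 2 * suc τ) (n≥ : suc (2 * suc τ) ≤ n)
    (deg : ∀ u → degree≥ u (suc (suc τ choose suc ρ)))
    (noCycle : NoCycle≥ n) where

    module _ {p : ℕ} (longest : Path (suc p) → ⊥) where

      private
        t = suc τ

      -- If p < t, a cycle on t + 2 or more vertices would contain a path longer than P. So there is
      -- none, and case (b) applies with s = τ.
      t≤ : Path p → t ≤ p
      t≤ P = ≮⇒≥ λ p< → MediumLength.path-absurd 1≤ρ r≡ ρ<τ (short p<) deg longest P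
        where
        short : p < t → NoCycle≥ (suc (suc (suc τ)))
        short p< le P′ _ _ _ _ = longest (take P′ (≤-trans p< (≤-trans (n≤1+n _) (s≤s⁻¹ le))))

      module _ (P : Path p) {u : V} (off : ¬ (∃ λ k → k < suc p × u ≡ v P k)) where

        private
          -- `edges-at≤` expects vertices indexed by numbers; u is only a default value beyond n.
          nth : ℕ → V
          nth i with i <? n
          ... | yes i< = fromℕ< i<
          ... | no _ = u

          nth-toℕ : ∀ w → nth (toℕ w) ≡ w
          nth-toℕ w with toℕ w <? n
          ... | yes i< = fromℕ<-toℕ w i<
          ... | no i≮ = ⊥-elim (i≮ (toℕ<n w))

          nth-inj : ∀ {i j} → i < n → j < n → nth i ≡ nth j → i ≡ j
          nth-inj {i} {j} i< j< eq with i <? n | j <? n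
          ... | yes _ | yes _ = fromℕ<-injective i j i< j< eq
          ... | no ne | _ = ⊥-elim (ne i<)
          ... | yes _ | no ne = ⊥-elim (ne j<)

          on? : ∀ w → Dec (∃ λ k → k < suc p × w ≡ v P k)
          on? = on-path? P

          Out : V → Set
          Out w = ¬ (∃ λ k → k < suc p × w ≡ v P k) × w ≢ u
          out? : ∀ w → Dec (Out w)
          out? w = ¬? (on? w) ×-dec ¬? (w ≟ᶠ u)
          all? : ∀ (w : V) → Dec (w ≡ w)
          all? w = w ≟ᶠ w
          rest? : ∀ w → Dec (Out w ⊎ w ≡ u)
          rest? w = out? w ⊎-dec (w ≟ᶠ u)

          out≤ : cnt (λ i → out? (nth i)) (upTo n) + suc (suc p) ≤ n
          out≤ = lia (cnt (λ i → out? (nth i)) (upTo n) ∷ cnt out? (allFin n) ∷ cnt (λ w → w ≟ᶠ u) (allFin n) ∷ cnt rest? (allFin n) ∷ cnt on? (allFin n) ∷ cnt all? (allFin n) ∷ p ∷ n ∷ [])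
            (λ i o s r c a p n → i ≼ o ⇒ con 1 ≼ s ⇒ o ⊕ s ≼ r ⇒ σ p ≼ c ⇒ r ⊕ c ≼ a ⇒ a ≼ n ⇒ i ⊕ σ (σ p) ≼ n) refl
            (cnt-injection (λ i → out? (nth i)) out? (λ i w → i < n × w ≡ nth i) (λ { (i< , refl) (j< , eq) → nth-inj i< j< eq }) (upTo⁺ n)
              λ {i} m o → nth i , ∈-allFin (nth i) , o , ∈-upTo⁻ m , refl)
            (cnt≥1 (λ w → w ≟ᶠ u) (∈-allFin u) refl)
            (cnt-disjoint out? (λ w → w ≟ᶠ u) rest? (allFin n) (λ _ → inj₁) (λ _ → inj₂) λ _ → proj₂)
            (#on-path≥ P)
            (cnt-disjoint rest? on? all? (allFin n) (λ _ _ → refl) (λ _ _ → refl) λ { _ (inj₁ (ν , _)) o → ν o ; _ (inj₂ refl) o → off o })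
            (≤-trans (cnt≤length all? (allFin n)) (≤-reflexive (length-tabulate {n = n} id)))

        -- By `extend` no edge at u meets the cycle. Besides u, at most n - p - 2 ≤ t vertices are
        -- off it, which bounds the degree of u by C(t, r - 1).
        outside-absurd : (h : E) → Unused P h → v P 0 ∊ h → v P p ∊ h → ⊥
        outside-absurd h uh x∊h y∊h = lia (I ∷ p ∷ n ∷ τ ∷ []) (λ i p n t → i ⊕ σ (σ p) ≼ n ⇒ σ t ≺ i ⇒ σ t ≼ p ⇒ n ≼ con 2 ⊕ 2 ⊛ σ t ⇒ absurd) refl
            out≤ (≰⇒> λ I≤ → <⇒≱ (deg u) (≤-trans few (C-mono (suc ρ) I≤))) (t≤ P) n≤
          where
          I = cnt (λ i → out? (nth i)) (upTo n)
          L : Loop p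
          L = record { Q = P ; φ = h ; z = u ; z∉ = λ k≤ eq → off (_ , s≤s k≤ , eq) ; uφ = uh ; x∊ = x∊h ; y∊ = y∊h }
          inside : ∀ {g w} → u ∊ g → w ∊ g → w ≡ u ⊎ ∃ λ i → i < n × Out (nth i) × w ≡ nth i
          inside {g} {w} u∊ w∊ with w ≟ᶠ u | on? w
          ... | yes eq | _ = inj₁ eq
          ... | no _ | yes (k , k< , refl) = ⊥-elim (longest (extend L u∊ (s≤s⁻¹ k<) w∊))
          ... | no ne | no o = inj₂ (toℕ w , toℕ<n w , subst Out (sym (nth-toℕ w)) (o , ne) , sym (nth-toℕ w))
          few : cnt (u ∊?_) (allFin M) ≤ I choose suc ρ
          few = edges-at≤ (u ∊?_) (λ i → out? (nth i)) n nth (suc ρ) r≡ u id inside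

      no-closing : (P : Path p) (h : E) → Unused P h → v P 0 ∊ h → v P p ∊ h → ⊥
      no-closing P h uh x∊h y∊h with any? (λ u → ¬? (on-path? P u))
      ... | yes (u , off) = outside-absurd P off h uh x∊h y∊h
      ... | no none = noCycle n≤p P h uh x∊h y∊h
        where
        below? : ∀ k → Dec (k < suc p)
        below? k = k <? suc p
        all? : ∀ (w : V) → Dec (w ≡ w)
        all? w = w ≟ᶠ w
        n≤p : n ≤ suc p
        n≤p = ≤-trans (≤-reflexive (sym (trans (cnt-all all? (allFin n) (λ _ → refl)) (length-tabulate {n = n} id))))
          (≤-trans (cnt-injection all? below? (λ w k → w ≡ v P k) (λ { refl refl → refl }) (allFin⁺ n)
            λ {w} _ _ → let (k , k< , eq) = decidable-stable (on-path? P w) (λ off → none (w , off)) in k , ∈-upTo⁺ k< , k< , eq) (cnt-upTo≤ below? (suc p)))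

    spanning-absurd : ∀ {p} → Path p → ⊥
    spanning-absurd = longest-absurd step
      where
      conclude : ∀ q → (Path (suc (suc q)) → ⊥) → (P : Path (suc q)) → ⊥
      conclude q longest P = maximum-absurd (λ P → #A P + #A′ P) {suc q + suc q} (λ P → +-mono-≤ (cnt-upTo≤ (A? P) (suc q)) (cnt-upTo≤ (A′? P) (suc q))) (best (m≤n⇒m<n∨m≡n ρ<τ)) P
        where
        open Closed longest (no-closing longest)
        q≤ : q ≤ 2 * suc τ
        q≤ = s≤s⁻¹ (s≤s⁻¹ (≤-trans (path<n P) n≤))
        best : suc ρ < τ ⊎ suc ρ ≡ τ → (P : Path (suc q)) → (∀ P′ → #A P′ + #A′ P′ ≤ #A P + #A′ P) → ⊥
        best (inj₁ lt) = SmallEdges.best-path-absurd 1≤ρ r≡ ρ<τ q≤ n≤ deg longest (no-closing longest) lt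
        best (inj₂ refl) = LargeEdges.best-path-absurd 1≤ρ r≡ q≤ n≤ n≥ deg longest (no-closing longest)
      step : ∀ p → (Path (suc p) → ⊥) → Path p → ⊥
      step zero longest P = <⇒≱ (s≤s z≤n) (t≤ longest P)
      step (suc q) = conclude q

-- From hypergraphs to incidences, and the three cases

cnt-subset : ∀ {m} {A : Set} {P : A → Set} (P? : ∀ x → Dec (P x)) (f : Fin m → A) (s : Subset m) →
  (∀ {i} → P (f i) → i ∈ₛ s) → (∀ {i} → i ∈ₛ s → P (f i)) → cnt P? (tabulate f) ≡ ∣ s ∣
cnt-subset P? f [] to from = cnt-none P? [] λ ()
cnt-subset P? f (true ∷ s) to from = trans (cnt-∷-yes P? (from here))
  (cong suc (cnt-subset P? (f ∘ suc) s (drop-there ∘ to) (from ∘ there)))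
cnt-subset P? f (false ∷ s) to from = trans (cnt-∷-no P? λ p → case (to p))
  (cnt-subset P? (f ∘ suc) s (drop-there ∘ to) (from ∘ there))
  where
  case : zero ∈ₛ (false ∷ s) → ⊥
  case ()

cnt-map : {A B : Set} {P : B → Set} (P? : ∀ x → Dec (P x)) (f : A → B) (xs : List A) → cnt P? (map f xs) ≡ cnt (λ x → P? (f x)) xs
cnt-map P? f [] = trans (cnt-none P? [] λ ()) (sym (cnt-none (λ x → P? (f x)) [] λ ()))
cnt-map P? f (x ∷ xs) with P? (f x)
... | yes p = trans (cnt-∷-yes P? p) (trans (cong suc (cnt-map P? f xs)) (sym (cnt-∷-yes (λ x → P? (f x)) p)))
... | no p = trans (cnt-∷-no P? p) (trans (cnt-map P? f xs) (sym (cnt-∷-no (λ x → P? (f x)) p)))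

lookup-injective : {A : Set} (xs : List A) → Unique xs → ∀ {i j} → lookup xs i ≡ lookup xs j → i ≡ j
lookup-injective (x ∷ xs) (x∉ ∷ u) {zero} {zero} eq = refl
lookup-injective (x ∷ xs) (x∉ ∷ u) {zero} {suc j} eq = ⊥-elim (All.lookup x∉ (∈-lookup {xs = xs} j) eq)
lookup-injective (x ∷ xs) (x∉ ∷ u) {suc i} {zero} eq = ⊥-elim (All.lookup x∉ (∈-lookup {xs = xs} i) (sym eq))
lookup-injective (x ∷ xs) (x∉ ∷ u) {suc i} {suc j} eq = cong suc (lookup-injective xs u eq)

module _ {n r : ℕ} (H : UniformHypergraph n r) where

  private
    M = length (edges H)

    _∊_ : Fin n → EdgeIndex H → Set
    u ∊ e = u ∈ₛ edge H e

    _∊?_ : ∀ u e → Dec (u ∊ e)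
    u ∊? e = u ∈? edge H e

    card : ∀ e → ∣ edge H e ∣ ≡ r
    card e = All.lookup (uniform H) (∈-lookup {xs = edges H} e)

    size : ∀ e → cnt (λ u → u ∊? e) (allFin n) ≡ r
    size e = trans (cnt-subset (λ u → u ∊? e) id (edge H e) id id) (card e)

    ext : ∀ e f → (∀ u → u ∊ e → u ∊ f) → e ≡ f
    ext e f e⊆f = lookup-injective (edges H) (distinct H) (⊆-antisym (λ {u} → e⊆f u) λ {u} u∊f → decidable-stable (u ∊? e) λ u∉e →
      <⇒≢ (p⊂q⇒∣p∣<∣q∣ ((λ {u} → e⊆f u) , u , u∊f , u∉e)) (trans (card e) (sym (card f))))

    degree≡ : ∀ u → degree H u ≡ cnt (λ e → u ∊? e) (allFin M)
    degree≡ u = trans (sym (cnt≡ (u ∈?_) (edges H)))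
      (trans (cong (cnt (u ∈?_)) (sym (trans (map-tabulate id (lookup (edges H))) (tabulate-lookup (edges H)))))
        (cnt-map (u ∈?_) (lookup (edges H)) (allFin M)))

  open Incidence n M r _∊_ _∊?_ size ext public

  degrees : ∀ {d} → minDegree≥ H d → ∀ u → degree≥ u d
  degrees deg u = ≤-trans (deg u) (≤-reflexive (degree≡ u))

  private
    IsCycle : ∀ {ℓ} → (Fin ℓ → Fin n) → (Fin ℓ → EdgeIndex H) → Set
    IsCycle f g = (∀ i j → f i ≡ f j → i ≡ j) × (∀ i j → g i ≡ g j → i ≡ j) × (∀ i → f i ∊ g i) × (∀ i → f (csuc i) ∊ g i)

    isCycle? : ∀ {ℓ} (f : Fin ℓ → Fin n) g → Dec (IsCycle f g)
    isCycle? f g = allᶠ? (λ i → allᶠ? λ j → (f i ≟ᶠ f j) →-dec (i ≟ᶠ j)) ×-dec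
      (allᶠ? (λ i → allᶠ? λ j → (g i ≟ᶠ g j) →-dec (i ≟ᶠ j)) ×-dec (allᶠ? (λ i → f i ∊? g i) ×-dec allᶠ? (λ i → f (csuc i) ∊? g i)))

    -- The argument above derives a contradiction from the absence of cycles. To obtain an actual
    -- cycle, existence has to be decidable, so the sequences of vertices and edges are enumerated
    -- as numbers.
    Coded : ℕ → Set
    Coded ℓ = ∃ λ (a : Fin (n ^ ℓ)) → ∃ λ (b : Fin (M ^ ℓ)) → IsCycle {ℓ} (finToFun a) (finToFun b)

    coded? : ∀ ℓ → Dec (Coded ℓ)
    coded? ℓ = any? λ a → any? λ b → isCycle? {ℓ} (finToFun a) (finToFun b)

    decode : ∀ {ℓ} → Coded ℓ → BergeCycle H ℓ
    decode {ℓ} (a , b , fi , gi , hi , next) = record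
      { vtx = finToFun a ; edg = finToFun b ; vtx-inj = fi _ _ ; edg-inj = gi _ _ ; here∈ = hi ; next∈ = next }

    code : ∀ {ℓ} (f : Fin ℓ → Fin n) g → IsCycle f g → Coded ℓ
    code f g (fi , gi , hi , next) = funToFin f , funToFin g ,
        (λ i j eq → fi i j (trans (sym (f≗ i)) (trans eq (f≗ j)))) , (λ i j eq → gi i j (trans (sym (g≗ i)) (trans eq (g≗ j)))) ,
        (λ i → subst₂ _∊_ (sym (f≗ i)) (sym (g≗ i)) (hi i)) , λ i → subst₂ _∊_ (sym (f≗ (csuc i))) (sym (g≗ i)) (next i)
      where
      f≗ = finToFun-funToFin f
      g≗ = finToFun-funToFin g

    module _ {p} (P : Path p) (h : E) (u : Unused P h) (x∊ : v P 0 ∊ h) (y∊ : v P p ∊ h) where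

      f : Fin (suc p) → Fin n
      f i = v P (toℕ i)
      g′ : ℕ → E
      g′ k with k <? p
      ... | yes _ = e P k
      ... | no _ = h

      g′-inj : ∀ {k l} → k ≤ p → l ≤ p → g′ k ≡ g′ l → k ≡ l
      g′-inj {k} {l} k≤ l≤ eq with k <? p | l <? p
      ... | yes a | yes b = e-inj P a b eq
      ... | yes a | no b = ⊥-elim (u (k , a , sym eq))
      ... | no a | yes b = ⊥-elim (u (l , b , eq))
      ... | no a | no b = trans (≤-antisym k≤ (≮⇒≥ a)) (sym (≤-antisym l≤ (≮⇒≥ b)))

      here′ : ∀ {k} → k ≤ p → v P k ∊ g′ k
      here′ {k} k≤ with k <? p
      ... | yes a = inl P a
      ... | no a = subst (λ m → v P m ∊ h) (≤-antisym (≮⇒≥ a) k≤) y∊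

      next′ : ∀ i → f (csuc i) ∊ g′ (toℕ i)
      next′ i with suc (toℕ i) <? suc p | toℕ i <? p
      ... | yes a | yes b = subst (λ m → v P m ∊ e P (toℕ i)) (sym (toℕ-fromℕ< a)) (inr P b)
      ... | yes a | no b = ⊥-elim (b (s≤s⁻¹ a))
      ... | no a | yes b = ⊥-elim (a (s≤s b))
      ... | no _ | no _ = x∊

      path-code : Coded (suc p)
      path-code = code f (g′ ∘ toℕ) ((λ i j eq → toℕ-injective (v-inj P (s≤s⁻¹ (toℕ<n i)) (s≤s⁻¹ (toℕ<n j)) eq)) ,
        (λ i j eq → toℕ-injective (g′-inj (s≤s⁻¹ (toℕ<n i)) (s≤s⁻¹ (toℕ<n j)) eq)) , (λ i → here′ (s≤s⁻¹ (toℕ<n i))) , next′)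

  -- A cycle that arises from a path has at most n vertices by `path<n`, so the search is bounded.
  no-cycle-absurd : ∀ k → (NoCycle≥ k → ⊥) → HasBergeCycle≥ H k
  no-cycle-absurd k absurd′ with anyUpTo? (λ ℓ → (k ≤? ℓ) ×-dec coded? ℓ) (suc n)
  ... | yes (ℓ , _ , k≤ , c) = ℓ , k≤ , decode c
  ... | no none = ⊥-elim (absurd′ λ {p} k≤ P h u x∊ y∊ → none (suc p , s≤s (path<n P) , k≤ , path-code P h u x∊ y∊))

  trivial-path : ∀ {d} → Fin n → minDegree≥ H (suc d) → Path 0
  trivial-path {d} u deg = let (h , _) = cnt-∃ (u ∊?_) (allFin M) (≤-trans (s≤s z≤n) (degrees deg u)) in record
    { v = λ _ → u ; e = λ _ → h ; v-inj = λ { z≤n z≤n _ → refl } ; e-inj = λ () ; inl = λ () ; inr = λ () }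

  short : Fin n → ∀ κ → 1 ≤ κ → suc κ ≤ r → minDegree≥ H (suc κ) → HasBergeCycle≥ H (suc (suc κ))
  short u κ 1≤κ κ<r deg = no-cycle-absurd (suc (suc κ)) λ noCycle →
    longest-absurd (λ p → SmallLength.path-absurd 1≤κ κ<r noCycle (degrees deg)) (trivial-path u deg)

  medium : Fin n → ∀ ρ s → 1 ≤ ρ → r ≡ suc (suc ρ) → suc ρ ≤ s → minDegree≥ H (suc (suc s choose suc ρ)) → HasBergeCycle≥ H (suc (suc (suc s)))
  medium u ρ s 1≤ρ r≡ ρ<s deg = no-cycle-absurd (suc (suc (suc s))) λ noCycle →
    longest-absurd (λ p → MediumLength.path-absurd 1≤ρ r≡ ρ<s noCycle (degrees deg)) (trivial-path u deg)

  long : Fin n → ∀ k ρ τ → k ≤ n → 1 ≤ ρ → r ≡ suc (suc ρ) → suc ρ ≤ τ → n ≤ 2 + 2 * suc τ → suc (2 * suc τ) ≤ n →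
    minDegree≥ H (suc (suc τ choose suc ρ)) → HasBergeCycle≥ H k
  long u k ρ τ k≤ 1≤ρ r≡ ρ<τ n≤ n≥ deg = no-cycle-absurd k λ noCycle →
    spanning-absurd 1≤ρ r≡ ρ<τ n≤ n≥ (degrees deg) (λ n≤p → noCycle (≤-trans k≤ n≤p)) (trivial-path u deg)

theorem1p7 : (n k r : ℕ) → 3 ≤ k → k ≤ n → 3 ≤ r → r ≤ (n ∸ 1) / 2 →
    (H : UniformHypergraph n r) →
    ((k ≤ r + 1 × minDegree≥ H (k ∸ 1))
      ⊎ (r + 2 ≤ k × k < (n ∸ 1) / 2 + 2 × minDegree≥ H ((k ∸ 2) C (r ∸ 1) + 1))
      ⊎ ((n ∸ 1) / 2 + 2 ≤ k × minDegree≥ H (((n ∸ 1) / 2) C (r ∸ 1) + 1))) →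
    HasBergeCycle≥ H k
theorem1p7 (suc n) (suc (suc (suc κ))) r (s≤s (s≤s (s≤s _))) k≤ 3≤r r≤ H (inj₁ (k≤r , deg)) =
  short H zero (suc κ) (s≤s z≤n) (s≤s⁻¹ (≤-trans k≤r (≤-reflexive (+-comm r 1)))) deg
theorem1p7 (suc n) (suc (suc (suc s))) (suc (suc ρ)) (s≤s (s≤s (s≤s _))) k≤ (s≤s (s≤s 1≤ρ)) r≤ H (inj₂ (inj₁ (r≤k , _ , deg))) =
  medium H zero ρ s 1≤ρ refl (lia (ρ ∷ s ∷ []) (λ ρ s → con 2 ⊕ ρ ⊕ con 2 ≼ con 3 ⊕ s ⇒ σ ρ ≼ s) refl r≤k)
    λ u → subst (_≤ degree H u) (trans (+-comm _ 1) (cong suc (sym (C≡ (suc s) (suc ρ))))) (deg u)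
theorem1p7 (suc n) k@(suc (suc (suc _))) (suc (suc ρ)) (s≤s (s≤s (s≤s _))) k≤ (s≤s (s≤s 1≤ρ)) r≤ H (inj₂ (inj₂ (_ , deg))) = at-half (n / 2) refl
  where
  at-half : ∀ t → n / 2 ≡ t → HasBergeCycle≥ H k
  at-half zero eq = ⊥-elim (<⇒≱ (s≤s z≤n) (subst (suc (suc ρ) ≤_) eq r≤))
  -- Here `n` is one less than the number of vertices. It is 2 t or 2 t + 1, so the hypergraph has 2
  -- t + 1 or 2 t + 2 vertices.
  at-half (suc τ) eq = long H zero k ρ τ k≤ 1≤ρ refl (s≤s⁻¹ (subst (suc (suc ρ) ≤_) eq r≤))
      (lia (n ∷ n % 2 ∷ τ ∷ []) (λ n m t → n ≈ m ⊕ 2 ⊛ σ t ⇒ m ≺ con 2 ⇒ σ n ≼ con 2 ⊕ 2 ⊛ σ t) refl n≡ (m%n<n n 2))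
      (lia (n ∷ n % 2 ∷ τ ∷ []) (λ n m t → n ≈ m ⊕ 2 ⊛ σ t ⇒ σ (2 ⊛ σ t) ≼ σ n) refl n≡)
      λ u → subst (_≤ degree H u) (trans (+-comm _ 1) (cong suc (trans (cong (_C suc ρ) eq) (sym (C≡ (suc τ) (suc ρ)))))) (deg u)
    where
    n≡ : n ≡ n % 2 + 2 * suc τ
    n≡ = trans (m≡m%n+[m/n]*n n 2) (cong (n % 2 +_) (trans (*-comm (n / 2) 2) (cong (2 *_) eq)))
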